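{- Let $p>3$ be a prime with $\big(\frac p{31}\big)=1$. Then $$\sum_{k=0}^{[p/3]}\binom{3k}k(-1)^k\equiv\begin{cases}1\pmod p&\text{if }p=x^2+xy+70y^2,\ 9x^2+9xy+10y^2\text{ or }8x^2+3xy+9y^2,\\ (15x-14y)/(31y)\pmod p&\text{if }p=5x^2+xy+14y^2\neq5,\\ (21x-14y)/(31y)\pmod p&\text{if }p=7x^2+xy+10y^2\neq7,\\ (57x-8y)/(31y)\pmod p&\text{if }p=19x^2+5xy+4y^2\neq19,\\ -(105x+17y)/(31y)\pmod p&\text{if }p=35x^2+xy+2y^2,\end{cases}$$ where in each case $x,y\in\mathbb Z$.
   Context: $[x]$ is the greatest integer not exceeding $x$; $\big(\frac{\cdot}{\cdot}\big)$ is the Legendre symbol. Quotients are interpreted modulo $p$. -}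

module Defs where

open import Data.Nat as ℕ using (ℕ; suc; _%_; _/_)
open import Data.Nat.Combinatorics using (_C_)
open import Data.Integer as ℤ using (ℤ; +_; -1ℤ; _-_)
open import Data.Integer.Divisibility as ℤD using ()
open import Data.Nat.Divisibility as ℕD using ()
open import Data.List using (map; foldr; upTo)
open import Data.Product using (∃; _×_)
open import Relation.Nullary using (¬_)
open import Relation.Binary.PropositionalEquality using (_≡_)

LegendreOne : ℕ → (q : ℕ) → .{{_ : ℕ.NonZero q}} → Set
LegendreOne a q = ¬ (q ℕD.∣ a) × ∃ λ t → (t ℕ.* t) % q ≡ a % q

infix 4 _≡_[mod_]
_≡_[mod_] : ℤ → ℤ → ℕ → Set
a ≡ b [mod m ] = (+ m) ℤD.∣ (a - b)

S : ℕ → ℤ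
S p = foldr ℤ._+_ (+ 0) (map (λ k → (+ ((3 ℕ.* k) C k)) ℤ.* (-1ℤ ℤ.^ k)) (upTo (suc (p / 3))))

{-# OPTIONS --safe #-}
module Submission where

-- Write n = [p/3]. Modulo p one has C(3k,k) ≡ C(n+k,2k)(−27)^k, so the sum is a Morgan-Voyce number, that is,
-- (ε^(n+1) + ε^(−n))/(ε + 1) for the unit ε = (29 + 3√93)/2. All seven forms of discriminant −279 are
-- restrictions of X² + XY + 8Y² or 2X² + XY + 4Y². If p = aX² + XY + cY² with ac = 8, then ε ≡ A/Ā modulo p
-- for the Eisenstein integer A = Y − aX + 3Yω, whose norm is ap − Y². Cubic reciprocity turns ε^((p∓1)/3) into
-- the cubic symbol of p modulo A; there ap ≡ Y², and the symbol of Y is trivial because A ≡ Ā modulo Y, so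
-- only the symbol of a remains, which is a power of the symbol of 2. The choice of a makes ap ≡ 2 modulo 3,
-- which keeps A prime to 3 and avoids the supplementary laws.
-- Reciprocity comes from the Gauss sum, viewed as the operator of convolution with a cubic character of
-- prime modulus, and the Frobenius map on commuting operators; A is factored by splitting off Jacobi sums.

open import Defs
open import Level using (0ℓ; _⊔_)
open import Algebra.Bundles using (CommutativeMonoid; CommutativeRing; Semiring)
import Algebra.Construct.Pointwise as Pointwise
open import Algebra.Solver.Ring.AlmostCommutativeRing using (fromCommutativeRing)
import Algebra.Solver.Ring.Simple
open import Data.Fin as Fin using (Fin; toℕ; inject₁; fromℕ; fromℕ<)
import Data.Fin.Properties as Fin
open import Data.Fin.Permutation using (permutation)
open import Data.Integer as ℤ using (ℤ; +_; -[1+_])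
import Data.Integer.Properties as ℤ
open import Data.Integer.DivMod using (_/ℕ_; n%ℕd<d; a≡a%ℕn+[a/ℕn]*n)
open import Data.Integer.Divisibility.Signed as ℤD using (_∣_; divides)
open import Data.Integer.Tactic.RingSolver using (solve-∀)
open import Data.List using ([]; _∷_; foldr; map; upTo; applyUpTo)
open import Data.List.Relation.Unary.All using (All; []; _∷_)
open import Data.Nat as ℕ using (ℕ; zero; suc; _∸_; _!; _>_)
import Data.Nat.Properties as ℕ
open import Data.Nat.Combinatorics using (_C_; nCn≡1; nCk≡n!/k![n-k]!; k![n∸k]!∣n!; k>n⇒nCk≡0; nCk+nC[k+1]≡[n+1]C[k+1])
import Data.Nat.Divisibility as ℕD
open import Data.Nat.DivMod using (_%_; _/_; m/n*n≡m; m≡m%n+[m/n]*n; m%n<n)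
open import Data.Nat.Induction using (<-rec)
open import Data.Nat.ListAction using (product)
open import Data.Nat.Primality using (Prime; euclidsLemma; prime?; prime[2]; prime⇒irreducible; prime⇒nonTrivial)
open import Data.Nat.Primality.Factorisation using (factorise; PrimeFactorisation)
open import Data.Nat.Tactic.RingSolver using () renaming (solve-∀ to solveℕ-∀)
open import Data.Product using (∃; _,_; _×_; proj₁; proj₂)
open import Data.Sum using (_⊎_; inj₁; inj₂; [_,_]′)
open import Data.Vec.Functional using (Vector)
open import Function using (_∘_)
open import Relation.Nullary using (¬_; Dec; yes; no; contradiction)
open import Relation.Nullary.Decidable using (from-yes; map′; _×-dec_)
open import Relation.Binary.PropositionalEquality as ≡ using (_≡_; _≢_; refl; cong; cong₂; subst)

-- The unit ε lives in the field of √93, and 93 = (-3)(-31). A representation p = aX² + XY + cY²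
-- with ac = 8 gives 4ap = (2aX + Y)² + 31Y², so √-31 is (2aX + Y)/Y modulo p up to sign, and ε
-- acquires a representative built from √-3 alone; this is what brings in ℤ[ω]. If θ is the symbol
-- of p modulo A, the Morgan-Voyce quotient collapses to (θA + θ̄Ā)/(A + Ā). For X² + XY + 8Y² the
-- coefficient a is 1 or 8, a cube, so θ = 1 and the sum is 1; for 2X² + XY + 4Y² it is 2 or 4, so θ
-- is ω or ω² and the quotient is a fraction in X and Y. The obstacle is to have reciprocity with
-- elementary means. Gauss sums would need a ring containing ℓ-th roots of unity; translations of
-- functions on ℤ take their place, and all that Frobenius asks of them is that they commute.
-- Primitive roots are replaced by power sums of polynomials of low degree, and Euclidean division
-- in ℤ[ω] by Jacobi sums, which supply an element of norm ℓ for each prime ℓ ≡ 1 modulo 3, already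
-- normalised modulo 3.

C-factorials : ∀ j k → ((j ℕ.+ k) C k) ℕ.* (k ! ℕ.* j !) ≡ (j ℕ.+ k) !
C-factorials j k = begin
  ((j ℕ.+ k) C k) ℕ.* (k ! ℕ.* j !)                                        ≡⟨ cong (λ i → ((j ℕ.+ k) C k) ℕ.* (k ! ℕ.* i !)) (ℕ.m+n∸n≡m j k) ⟨
  ((j ℕ.+ k) C k) ℕ.* (k ! ℕ.* (j ℕ.+ k ∸ k) !)                            ≡⟨ cong (ℕ._* (k ! ℕ.* (j ℕ.+ k ∸ k) !)) (nCk≡n!/k![n-k]! (ℕ.m≤n+m k j)) ⟩
  (j ℕ.+ k) ! ℕ./ (k ! ℕ.* (j ℕ.+ k ∸ k) !) ℕ.* (k ! ℕ.* (j ℕ.+ k ∸ k) !)  ≡⟨ m/n*n≡m (k![n∸k]!∣n! (ℕ.m≤n+m k j)) ⟩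
  (j ℕ.+ k) !                                                              ∎
  where
  open ≡.≡-Reasoning
  instance _ = k ℕ.!* (j ℕ.+ k ∸ k) !≢0

prime∤! : ∀ {p} → Prime p → ∀ k → k ℕ.< p → ¬ (p ℕD.∣ k !)
prime∤! {p} pp zero    k<p p∣1 = contradiction (ℕD.∣1⇒≡1 p∣1) (ℕ.nonTrivial⇒≢1 {{prime⇒nonTrivial pp}})
prime∤! {p} pp (suc k) k<p p∣k! with euclidsLemma (suc k) (k !) pp p∣k!
... | inj₁ p∣k  = contradiction (ℕD.∣⇒≤ p∣k) (ℕ.<⇒≱ k<p)
... | inj₂ p∣k!′ = prime∤! pp k (ℕ.<-trans (ℕ.n<1+n k) k<p) p∣k!′

-- p divides p! = C · k! · j!, and neither factorial contains p when both lower indices are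
-- positive.
prime∣C : ∀ {p} → Prime p → ∀ j k → suc j ℕ.+ suc k ≡ p → p ℕD.∣ p C suc k
prime∣C pp j k refl with euclidsLemma ((suc j ℕ.+ suc k) C suc k) _ pp
  (subst ((suc j ℕ.+ suc k) ℕD.∣_) (≡.sym (C-factorials (suc j) (suc k))) (ℕD.m∣m*n {suc j ℕ.+ suc k} ((j ℕ.+ suc k) !)))
... | inj₁ p∣C = p∣C
... | inj₂ p∣!! with euclidsLemma (suc k !) (suc j !) pp p∣!!
...   | inj₁ p∣k! = contradiction p∣k! (prime∤! pp (suc k) (ℕ.m<n+m (suc k) ℕ.z<s))
...   | inj₂ p∣j! = contradiction p∣j! (prime∤! pp (suc j) (ℕ.m<m+n (suc j) ℕ.z<s))

-- The Frobenius map on commuting elements of a semiring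

module Frobenius {c ℓ} (S : Semiring c ℓ) where
  open Semiring S renaming (refl to ≈-refl)
  open import Algebra.Properties.Semiring.Mult S renaming (_×_ to _⋆_)
  open import Algebra.Properties.Semiring.Exp S
  open import Algebra.Properties.Semiring.Sum S
  import Algebra.Properties.Semiring.Binomial S as Binomial
  open import Relation.Binary.Reasoning.Setoid setoid

  HasChar : ℕ → Set (c ⊔ ℓ)
  HasChar p = ∀ x → p ⋆ x ≈ 0#

  ×-multiple : ∀ {p n} → HasChar p → p ℕD.∣ n → ∀ x → n ⋆ x ≈ 0#
  ×-multiple {p} char (ℕD.divides m refl) x = begin
    (m ℕ.* p) ⋆ x  ≈⟨ ×-congˡ (ℕ.*-comm m p) ⟩
    (p ℕ.* m) ⋆ x  ≈⟨ ×-assocˡ x p m ⟨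
    p ⋆ (m ⋆ x)    ≈⟨ char (m ⋆ x) ⟩
    0#             ∎

  sum-zero : ∀ {n} (t : Vector Carrier n) → (∀ i → t i ≈ 0#) → sum t ≈ 0#
  sum-zero {n} t t≈0 = trans (sum-cong-≋ t≈0) (sum-replicate-zero n)

  -- Only x and y have to commute. This matters because the lemma is applied to operators, whose
  -- semiring is not commutative.
  frobenius-+ : ∀ {p} → Prime p → HasChar p → ∀ {x y} → x * y ≈ y * x → (x + y) ^ p ≈ x ^ p + y ^ p
  frobenius-+ {zero}  pp char xy = contradiction pp λ ()
  frobenius-+ {suc m} pp char {x} {y} xy = begin
    (x + y) ^ suc m                                                ≈⟨ Binomial.theorem x y xy (suc m) ⟩
    t Fin.zero + sum (t ∘ Fin.suc)                                 ≈⟨ +-cong first (sum-init-last (t ∘ Fin.suc)) ⟩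
    y ^ suc m + (sum (t ∘ Fin.suc ∘ inject₁) + t (fromℕ (suc m)))  ≈⟨ +-congˡ (+-cong (sum-zero _ middle) last) ⟩
    y ^ suc m + (0# + x ^ suc m)                                   ≈⟨ +-congˡ (+-identityˡ _) ⟩
    y ^ suc m + x ^ suc m                                          ≈⟨ +-comm _ _ ⟩
    x ^ suc m + y ^ suc m                                          ∎
    where
    t : Vector Carrier (suc (suc m))
    t = Binomial.binomialTerm x y (suc m)

    first : t Fin.zero ≈ y ^ suc m
    first = trans (×-homo-1 _) (*-identityˡ _)

    middle : ∀ i → t (Fin.suc (inject₁ i)) ≈ 0#
    middle i = ×-multiple char (prime∣C pp (m ∸ suc k) k eq) _
      where
      k = toℕ (inject₁ i)
      k<m : k ℕ.< m
      k<m = subst (ℕ._< m) (≡.sym (Fin.toℕ-inject₁ i)) (Fin.toℕ<n i)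
      eq : suc (m ∸ suc k) ℕ.+ suc k ≡ suc m
      eq = cong suc (ℕ.m∸n+n≡m k<m)

    last : t (fromℕ (suc m)) ≈ x ^ suc m
    last rewrite Fin.toℕ-fromℕ m | nCn≡1 (suc m) | ℕ.n∸n≡0 m = trans (×-homo-1 _) (*-identityʳ _)

  sum-commute : ∀ {n} x (t : Vector Carrier n) → (∀ i → x * t i ≈ t i * x) → x * sum t ≈ sum t * x
  sum-commute x t comm = begin
    x * sum t            ≈⟨ *-distribˡ-sum x t ⟩
    sum (λ i → x * t i)  ≈⟨ sum-cong-≋ comm ⟩
    sum (λ i → t i * x)  ≈⟨ *-distribʳ-sum x t ⟨
    sum t * x            ∎

  frobenius-sum : ∀ {p} → Prime p → HasChar p → ∀ {n} (t : Vector Carrier n) →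
    (∀ i j → t i * t j ≈ t j * t i) → sum t ^ p ≈ sum (λ i → t i ^ p)
  frobenius-sum {zero}  pp char t comm = contradiction pp λ ()
  frobenius-sum {suc _} pp char {zero}  t comm = zeroˡ _
  frobenius-sum {suc _} pp char {suc n} t comm =
    trans (frobenius-+ pp char (sum-commute (t Fin.zero) (t ∘ Fin.suc) (comm Fin.zero ∘ Fin.suc)))
          (+-congˡ (frobenius-sum pp char (t ∘ Fin.suc) λ i j → comm (Fin.suc i) (Fin.suc j)))

-- The semiring of endomorphisms of a commutative monoid

module Endomorphisms {c ℓ} (M : CommutativeMonoid c ℓ) where
  open CommutativeMonoid M renaming (Carrier to V; _∙_ to _⊕_; ε to 0ᴹ; refl to ≈-refl)
  open import Algebra.Properties.CommutativeMonoid.Sum M using () renaming (sum to sumᴹ)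
  open import Algebra.Properties.CommutativeMonoid.Mult M using () renaming (_×_ to _×ᴹ_)
  open import Algebra.Properties.CommutativeSemigroup commutativeSemigroup using (interchange)

  record End : Set (c ⊔ ℓ) where
    field
      apply  : V → V
      a-cong : ∀ {x y} → x ≈ y → apply x ≈ apply y
      a-⊕    : ∀ x y → apply (x ⊕ y) ≈ apply x ⊕ apply y
      a-0    : apply 0ᴹ ≈ 0ᴹ
  open End public

  semiring : Semiring (c ⊔ ℓ) (c ⊔ ℓ)
  semiring = record
    { Carrier = End
    ; _≈_ = λ f g → ∀ x → apply f x ≈ apply g x
    ; _+_ = λ f g → record
        { apply = λ x → apply f x ⊕ apply g x
        ; a-cong = λ e → ∙-cong (a-cong f e) (a-cong g e)
        ; a-⊕ = λ x y → trans (∙-cong (a-⊕ f x y) (a-⊕ g x y)) (interchange _ _ _ _)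
        ; a-0 = trans (∙-cong (a-0 f) (a-0 g)) (identityˡ _) }
    ; _*_ = λ f g → record
        { apply = apply f ∘ apply g
        ; a-cong = a-cong f ∘ a-cong g
        ; a-⊕ = λ x y → trans (a-cong f (a-⊕ g x y)) (a-⊕ f _ _)
        ; a-0 = trans (a-cong f (a-0 g)) (a-0 f) }
    ; 0# = record { apply = λ _ → 0ᴹ ; a-cong = λ _ → ≈-refl ; a-⊕ = λ _ _ → sym (identityˡ _) ; a-0 = ≈-refl }
    ; 1# = record { apply = λ x → x ; a-cong = λ e → e ; a-⊕ = λ _ _ → ≈-refl ; a-0 = ≈-refl }
    ; isSemiring = record
        { isSemiringWithoutAnnihilatingZero = record
            { +-isCommutativeMonoid = record
                { isMonoid = record
                    { isSemigroup = record
                        { isMagma = record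
                            { isEquivalence = record { refl = λ _ → ≈-refl ; sym = λ e x → sym (e x) ; trans = λ e e′ x → trans
                                (e x) (e′ x) }
                            ; ∙-cong = λ e e′ x → ∙-cong (e x) (e′ x) }
                        ; assoc = λ _ _ _ _ → assoc _ _ _ }
                    ; identity = (λ _ _ → identityˡ _) , (λ _ _ → identityʳ _) }
                ; comm = λ _ _ _ → comm _ _ }
            ; *-cong = λ {f} {g} {h} {k} e e′ x → trans (e _) (a-cong g (e′ x))
            ; *-assoc = λ _ _ _ _ → ≈-refl
            ; *-identity = (λ _ _ → ≈-refl) , (λ _ _ → ≈-refl)
            ; distrib = (λ f g h x → a-⊕ f _ _) , (λ _ _ _ _ → ≈-refl) }
        ; zero = (λ _ _ → ≈-refl) , (λ f _ → a-0 f) } }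

  open import Algebra.Properties.Semiring.Mult semiring using () renaming (_×_ to _⋆_)
  open import Algebra.Properties.Semiring.Sum semiring using (sum)

  apply-× : ∀ n f x → apply (n ⋆ f) x ≈ n ×ᴹ apply f x
  apply-× zero    f x = ≈-refl
  apply-× (suc n) f x = ∙-congˡ (apply-× n f x)

  End-hasChar : ∀ {p} → (∀ x → p ×ᴹ x ≈ 0ᴹ) → Frobenius.HasChar semiring p
  End-hasChar {p} char f x = trans (apply-× p f x) (char (apply f x))

  apply-sum : ∀ {n} (t : Vector End n) x → apply (sum t) x ≈ sumᴹ (λ i → apply (t i) x)
  apply-sum {zero}  t x = ≈-refl
  apply-sum {suc n} t x = ∙-congˡ (apply-sum (t ∘ Fin.suc) x)

module _ {a c ℓ} {A : Set a} (M : CommutativeMonoid c ℓ) where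
  private
    module M = CommutativeMonoid M
    open import Algebra.Properties.CommutativeMonoid.Mult M using () renaming (_×_ to _⋆_)
    open import Algebra.Properties.CommutativeMonoid.Mult (Pointwise.commutativeMonoid A M) using () renaming (_×_ to _×ᴾ_)
    open import Algebra.Properties.CommutativeMonoid.Sum M using (sum)
    open import Algebra.Properties.CommutativeMonoid.Sum (Pointwise.commutativeMonoid A M) using () renaming (sum to sumᴾ)

  pointwise-× : ∀ n (f : A → M.Carrier) x → (n ×ᴾ f) x ≡ n ⋆ f x
  pointwise-× zero    f x = refl
  pointwise-× (suc n) f x = cong (f x M.∙_) (pointwise-× n f x)

  pointwise-sum : ∀ {n} (t : Vector (A → M.Carrier) n) x → sumᴾ t x ≡ sum (λ i → t i x)
  pointwise-sum {zero}  t x = refl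
  pointwise-sum {suc n} t x = cong (t Fin.zero x M.∙_) (pointwise-sum (t ∘ Fin.suc) x)

-- Quotients of commutative rings

module Quotient {c ℓ} (R : CommutativeRing c ℓ) (m : CommutativeRing.Carrier R) where
  open CommutativeRing R renaming (refl to ≈-refl)
  open import Algebra.Properties.Ring ring using (-‿+-comm; -‿distribʳ-*)
  open import Algebra.Properties.CommutativeSemigroup +-commutativeSemigroup using (interchange)
  open import Relation.Binary.Reasoning.Setoid setoid

  infix 4 _≋_
  -- The quotient keeps the carrier and the operations and only coarsens equality, so an identity of
  -- the ring is at once a congruence, and the quotient witness stays available.
  record _≋_ (x y : Carrier) : Set (c ⊔ ℓ) where
    constructor by
    field
      quot   : Carrier
      excess : x ≈ y + m * quot
  open _≋_ public

  +-multiple-0 : ∀ y → y ≈ y + m * 0#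
  +-multiple-0 y = sym (trans (+-congˡ (zeroʳ m)) (+-identityʳ y))

  ≈⇒≋ : ∀ {x y} → x ≈ y → x ≋ y
  ≈⇒≋ e = by 0# (trans e (+-multiple-0 _))

  commutativeRing : CommutativeRing c (c ⊔ ℓ)
  commutativeRing = record
    { Carrier = Carrier ; _≈_ = _≋_ ; _+_ = _+_ ; _*_ = _*_ ; -_ = -_ ; 0# = 0# ; 1# = 1#
    ; isCommutativeRing = record
      { isRing = record
        { +-isAbelianGroup = record
          { isGroup = record
            { isMonoid = record
              { isSemigroup = record
                { isMagma = record
                  { isEquivalence = record { refl = ≈⇒≋ ≈-refl ; sym = ≋-sym ; trans = ≋-trans }
                  ; ∙-cong = ≋-+ }
                ; assoc = λ x y z → ≈⇒≋ (+-assoc x y z) }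
              ; identity = (λ x → ≈⇒≋ (+-identityˡ x)) , (λ x → ≈⇒≋ (+-identityʳ x)) }
            ; inverse = (λ x → ≈⇒≋ (-‿inverseˡ x)) , (λ x → ≈⇒≋ (-‿inverseʳ x))
            ; ⁻¹-cong = ≋-neg }
          ; comm = λ x y → ≈⇒≋ (+-comm x y) }
        ; *-cong = ≋-*
        ; *-assoc = λ x y z → ≈⇒≋ (*-assoc x y z)
        ; *-identity = (λ x → ≈⇒≋ (*-identityˡ x)) , (λ x → ≈⇒≋ (*-identityʳ x))
        ; distrib = (λ x y z → ≈⇒≋ (distribˡ x y z)) , (λ x y z → ≈⇒≋ (distribʳ x y z)) }
      ; *-comm = λ x y → ≈⇒≋ (*-comm x y) } }
    where
    ≋-sym : ∀ {x y} → x ≋ y → y ≋ x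
    ≋-sym {x} {y} (by k e) = by (- k) (sym (begin
      x + m * - k            ≈⟨ +-congʳ e ⟩
      (y + m * k) + m * - k  ≈⟨ +-assoc _ _ _ ⟩
      y + (m * k + m * - k)  ≈⟨ +-congˡ (distribˡ m k (- k)) ⟨
      y + m * (k + - k)      ≈⟨ +-congˡ (*-congˡ (-‿inverseʳ k)) ⟩
      y + m * 0#             ≈⟨ +-multiple-0 y ⟨
      y                      ∎))
    ≋-trans : ∀ {x y z} → x ≋ y → y ≋ z → x ≋ z
    ≋-trans {z = z} (by k e) (by l e′) = by (l + k) (trans e (trans (+-congʳ e′)
        (trans (+-assoc _ _ _) (+-congˡ (sym (distribˡ m l k))))))
    ≋-+ : ∀ {x y z w} → x ≋ y → z ≋ w → x + z ≋ y + w
    ≋-+ {y = y} {w = w} (by k e) (by l e′) = by (k + l) (trans (+-cong e e′)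
        (trans (interchange _ _ _ _) (+-congˡ (sym (distribˡ m k l)))))
    ≋-*ʳ : ∀ {x y} z → x ≋ y → x * z ≋ y * z
    ≋-*ʳ {y = y} z (by k e) = by (k * z) (trans (*-congʳ e) (trans (distribʳ z y (m * k)) (+-congˡ (*-assoc m k z))))
    ≋-* : ∀ {x y z w} → x ≋ y → z ≋ w → x * z ≋ y * w
    ≋-* {y = y} {z} {w} e e′ =
      ≋-trans (≋-*ʳ z e) (≋-trans (≈⇒≋ (*-comm y z)) (≋-trans (≋-*ʳ y e′) (≈⇒≋ (*-comm w y))))
    ≋-neg : ∀ {x y} → x ≋ y → - x ≋ - y
    ≋-neg {y = y} (by k e) = by (- k) (trans (-‿cong e) (trans (sym (-‿+-comm y (m * k))) (+-congˡ (-‿distribʳ-* m k))))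

open import Data.Integer using (_+_; _*_; _-_; -_)

-- Eisenstein integers

-- a ⊹ b stands for a + b ω, where ω² + ω + 1 = 0.
infix 5 _⊹_
data 𝔼 : Set where
  _⊹_ : ℤ → ℤ → 𝔼

re im : 𝔼 → ℤ
re (a ⊹ b) = a
im (a ⊹ b) = b

infixl 6 _+ᴱ_
infixl 7 _*ᴱ_
_+ᴱ_ _*ᴱ_ : 𝔼 → 𝔼 → 𝔼
(a ⊹ b) +ᴱ (c ⊹ d) = a + c ⊹ b + d
(a ⊹ b) *ᴱ (c ⊹ d) = a * c - b * d ⊹ a * d + b * c - b * d

infix 8 -ᴱ_
-ᴱ_ : 𝔼 → 𝔼
-ᴱ (a ⊹ b) = - a ⊹ - b

𝔼-ring : CommutativeRing 0ℓ 0ℓ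
𝔼-ring = record
  { Carrier = 𝔼 ; _≈_ = _≡_
  ; _+_ = _+ᴱ_ ; _*_ = _*ᴱ_ ; -_ = -ᴱ_
  ; 0# = + 0 ⊹ + 0 ; 1# = + 1 ⊹ + 0
  ; isCommutativeRing = record
    { isRing = record
      { +-isAbelianGroup = record
        { isGroup = record
          { isMonoid = record
            { isSemigroup = record
              { isMagma = record { isEquivalence = ≡.isEquivalence ; ∙-cong = λ { refl refl → refl } }
              ; assoc = λ { (a ⊹ b) (c ⊹ d) (e ⊹ f) → cong₂ _⊹_ (ℤ.+-assoc a c e) (ℤ.+-assoc b d f) } }
            ; identity = (λ { (a ⊹ b) → cong₂ _⊹_ (ℤ.+-identityˡ a) (ℤ.+-identityˡ b) })
                       , (λ { (a ⊹ b) → cong₂ _⊹_ (ℤ.+-identityʳ a) (ℤ.+-identityʳ b) }) }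
          ; inverse = (λ { (a ⊹ b) → cong₂ _⊹_ (ℤ.+-inverseˡ a) (ℤ.+-inverseˡ b) })
                    , (λ { (a ⊹ b) → cong₂ _⊹_ (ℤ.+-inverseʳ a) (ℤ.+-inverseʳ b) })
          ; ⁻¹-cong = λ { refl → refl } }
        ; comm = λ { (a ⊹ b) (c ⊹ d) → cong₂ _⊹_ (ℤ.+-comm a c) (ℤ.+-comm b d) } }
      ; *-cong = λ { refl refl → refl }
      ; *-assoc = λ { (a ⊹ b) (c ⊹ d) (e ⊹ f) → cong₂ _⊹_ (assoc-re a b c d e f) (assoc-im a b c d e f) }
      ; *-identity = (λ { (a ⊹ b) → cong₂ _⊹_ (idˡ-re a b) (idˡ-im a b) })
                   , (λ { (a ⊹ b) → cong₂ _⊹_ (idʳ-re a b) (idʳ-im a b) })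
      ; distrib = (λ { (a ⊹ b) (c ⊹ d) (e ⊹ f) → cong₂ _⊹_ (distˡ-re a b c d e f) (distˡ-im a b c d e f) })
                , (λ { (a ⊹ b) (c ⊹ d) (e ⊹ f) → cong₂ _⊹_ (distʳ-re a b c d e f) (distʳ-im a b c d e f) }) }
    ; *-comm = λ { (a ⊹ b) (c ⊹ d) → cong₂ _⊹_ (comm-re a b c d) (comm-im a b c d) } } }
  where
  assoc-re : ∀ a b c d e f → (a * c - b * d) * e - (a * d + b * c - b * d) * f
           ≡ a * (c * e - d * f) - b * (c * f + d * e - d * f)
  assoc-re = solve-∀
  assoc-im : ∀ a b c d e f → (a * c - b * d) * f + (a * d + b * c - b * d) * e - (a * d + b * c - b * d) * f
           ≡ a * (c * f + d * e - d * f) + b * (c * e - d * f) - b * (c * f + d * e - d * f)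
  assoc-im = solve-∀
  idˡ-re : ∀ a b → + 1 * a - + 0 * b ≡ a
  idˡ-re = solve-∀
  idˡ-im : ∀ a b → + 1 * b + + 0 * a - + 0 * b ≡ b
  idˡ-im = solve-∀
  idʳ-re : ∀ a b → a * + 1 - b * + 0 ≡ a
  idʳ-re = solve-∀
  idʳ-im : ∀ a b → a * + 0 + b * + 1 - b * + 0 ≡ b
  idʳ-im = solve-∀
  distˡ-re : ∀ a b c d e f → a * (c + e) - b * (d + f) ≡ (a * c - b * d) + (a * e - b * f)
  distˡ-re = solve-∀
  distˡ-im : ∀ a b c d e f → a * (d + f) + b * (c + e) - b * (d + f) ≡ (a * d + b * c - b * d) + (a * f + b * e - b * f)
  distˡ-im = solve-∀
  distʳ-re : ∀ a b c d e f → (c + e) * a - (d + f) * b ≡ (c * a - d * b) + (e * a - f * b)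
  distʳ-re = solve-∀
  distʳ-im : ∀ a b c d e f → (c + e) * b + (d + f) * a - (d + f) * b ≡ (c * b + d * a - d * b) + (e * b + f * a - f * b)
  distʳ-im = solve-∀
  comm-re : ∀ a b c d → a * c - b * d ≡ c * a - d * b
  comm-re = solve-∀
  comm-im : ∀ a b c d → a * d + b * c - b * d ≡ c * b + d * a - d * b
  comm-im = solve-∀

module E = CommutativeRing 𝔼-ring
open E using (0#; 1#)
open import Algebra.Properties.Semiring.Exp E.semiring using (_^_; ^-homo-*; ^-assocʳ)
open import Algebra.Properties.CommutativeSemiring.Exp E.commutativeSemiring using (^-distrib-*)
open import Algebra.Properties.Semiring.Sum E.semiring using (sum; sum-permute; sum-cong-≗; sum-replicate-zero; ∑-comm; ∑-distrib-+; *-distribˡ-sum; *-distribʳ-sum)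
open import Algebra.Properties.CommutativeSemigroup E.*-commutativeSemigroup using (interchange; x∙yz≈y∙xz)
open import Algebra.Properties.Semiring.Sum ℤ.+-*-semiring using () renaming (sum to sumℤ; sum-init-last to sumℤ-init-last; sum-cong-≗ to sumℤ-cong; ∑-distrib-+ to sumℤ-distrib-+; *-distribˡ-sum to *-distribˡ-sumℤ)

ω ω² : 𝔼
ω  = + 0 ⊹ + 1
ω² = ω *ᴱ ω

ι : ℤ → 𝔼
ι a = a ⊹ + 0

conj : 𝔼 → 𝔼
conj (a ⊹ b) = a - b ⊹ - b

norm : 𝔼 → ℤ
norm (a ⊹ b) = a * a - a * b + b * b

re-+ : ∀ x y → re (x +ᴱ y) ≡ re x + re y
re-+ (a ⊹ b) (c ⊹ d) = refl

im-+ : ∀ x y → im (x +ᴱ y) ≡ im x + im y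
im-+ (a ⊹ b) (c ⊹ d) = refl

ι-*-⊹ : ∀ a x → ι a *ᴱ x ≡ (a * re x ⊹ a * im x)
ι-*-⊹ a (c ⊹ d) = cong₂ _⊹_ (lem₁ a c d) (lem₂ a c d)
  where
  lem₁ : ∀ a c d → a * c - + 0 * d ≡ a * c
  lem₁ = solve-∀
  lem₂ : ∀ a c d → a * d + + 0 * c - + 0 * d ≡ a * d
  lem₂ = solve-∀

ι-* : ∀ a b → ι (a * b) ≡ ι a *ᴱ ι b
ι-* a b = ≡.sym (≡.trans (ι-*-⊹ a (ι b)) (cong (a * b ⊹_) (ℤ.*-zeroʳ a)))

ι-^ : ∀ a n → ι (a ℤ.^ n) ≡ ι a ^ n
ι-^ a zero    = refl
ι-^ a (suc n) = ≡.trans (ι-* a (a ℤ.^ n)) (cong (ι a *ᴱ_) (ι-^ a n))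

ι-cancel : ∀ m {x y} → m ≢ + 0 → ι m *ᴱ x ≡ ι m *ᴱ y → x ≡ y
ι-cancel m {a ⊹ b} {c ⊹ d} m≢0 eq = cong₂ _⊹_ (ℤ.*-cancelˡ-≡ m a c {{ℤ.≢-nonZero m≢0}} (cong re eq′))
    (ℤ.*-cancelˡ-≡ m b d {{ℤ.≢-nonZero m≢0}} (cong im eq′))
  where
  eq′ : (m * a ⊹ m * b) ≡ (m * c ⊹ m * d)
  eq′ = ≡.trans (≡.sym (ι-*-⊹ m (a ⊹ b))) (≡.trans eq (ι-*-⊹ m (c ⊹ d)))

conj-+ : ∀ x y → conj (x +ᴱ y) ≡ conj x +ᴱ conj y
conj-+ (a ⊹ b) (c ⊹ d) = cong₂ _⊹_ (lem₁ a b c d) (lem₂ b d)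
  where
  lem₁ : ∀ a b c d → (a + c) - (b + d) ≡ (a - b) + (c - d)
  lem₁ = solve-∀
  lem₂ : ∀ b d → - (b + d) ≡ - b + - d
  lem₂ = solve-∀

conj-* : ∀ x y → conj (x *ᴱ y) ≡ conj x *ᴱ conj y
conj-* (a ⊹ b) (c ⊹ d) = cong₂ _⊹_ (lem₁ a b c d) (lem₂ a b c d)
  where
  lem₁ : ∀ a b c d → (a * c - b * d) - (a * d + b * c - b * d) ≡ (a - b) * (c - d) - - b * - d
  lem₁ = solve-∀
  lem₂ : ∀ a b c d → - (a * d + b * c - b * d) ≡ (a - b) * - d + - b * (c - d) - - b * - d
  lem₂ = solve-∀

conj-^ : ∀ x n → conj (x ^ n) ≡ conj x ^ n
conj-^ x zero    = refl
conj-^ x (suc n) = ≡.trans (conj-* x (x ^ n)) (cong (conj x *ᴱ_) (conj-^ x n))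

conj-conj : ∀ x → conj (conj x) ≡ x
conj-conj (a ⊹ b) = cong₂ _⊹_ (lem a b) (ℤ.neg-involutive b)
  where
  lem : ∀ a b → (a - b) - (- b) ≡ a
  lem = solve-∀

conj-ι : ∀ a → conj (ι a) ≡ ι a
conj-ι a = cong (_⊹ + 0) (ℤ.+-identityʳ a)

*-conj : ∀ x → x *ᴱ conj x ≡ ι (norm x)
*-conj (a ⊹ b) = cong₂ _⊹_ (lem₁ a b) (lem₂ a b)
  where
  lem₁ : ∀ a b → a * (a - b) - b * - b ≡ a * a - a * b + b * b
  lem₁ = solve-∀
  lem₂ : ∀ a b → a * - b + b * (a - b) - b * - b ≡ + 0
  lem₂ = solve-∀

norm-* : ∀ x y → norm (x *ᴱ y) ≡ norm x * norm y
norm-* (a ⊹ b) (c ⊹ d) = lem a b c d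
  where
  lem : ∀ a b c d → (a * c - b * d) * (a * c - b * d) - (a * c - b * d) * (a * d + b * c - b * d)
      + (a * d + b * c - b * d) * (a * d + b * c - b * d) ≡ (a * a - a * b + b * b) * (c * c - c * d + d * d)
  lem = solve-∀

-- Rational primes and congruences of integers

euclidℤ : ∀ {q} → Prime q → ∀ a b → + q ∣ a * b → + q ∣ a ⊎ + q ∣ b
euclidℤ {q} pq a b q∣ab with euclidsLemma ℤ.∣ a ∣ ℤ.∣ b ∣ pq (subst (q ℕD.∣_) (ℤ.abs-* a b) (ℤD.∣⇒∣ᵤ q∣ab))
... | inj₁ d = inj₁ (ℤD.∣ᵤ⇒∣ d)
... | inj₂ d = inj₂ (ℤD.∣ᵤ⇒∣ d)

prime∤1 : ∀ {q} → Prime q → ¬ (+ q ∣ + 1)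
prime∤1 pq d = contradiction (ℕD.∣1⇒≡1 (ℤD.∣⇒∣ᵤ d)) (ℕ.nonTrivial⇒≢1 {{prime⇒nonTrivial pq}})

prime∤^ : ∀ {q} → Prime q → ∀ a n → ¬ (+ q ∣ a) → ¬ (+ q ∣ a ℤ.^ n)
prime∤^ pq a zero    q∤a d = prime∤1 pq d
prime∤^ pq a (suc n) q∤a d with euclidℤ pq a (a ℤ.^ n) d
... | inj₁ q∣a = q∤a q∣a
... | inj₂ q∣aⁿ = prime∤^ pq a n q∤a q∣aⁿ

prime[3] : Prime 3
prime[3] = from-yes (prime? 3)

primes-≡ : ∀ {q s} → Prime q → Prime s → + q ∣ + s → q ≡ s
primes-≡ pq ps d with prime⇒irreducible ps (ℤD.∣⇒∣ᵤ d)
... | inj₁ refl = contradiction ℤD.∣-refl (prime∤1 pq)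
... | inj₂ eq   = eq

module ModZ (q : ℕ) where
  open Quotient ℤ.+-*-commutativeRing (+ q) public
  open CommutativeRing commutativeRing public using (semiring; setoid) renaming (+-commutativeMonoid to +-monoid)
  private
    module Q = CommutativeRing commutativeRing
  open Q public using () renaming (refl to ≋-refl; sym to ≋-sym; trans to ≋-trans; +-cong to ≋-+; *-cong to ≋-*; -‿cong to ≋-neg)
  open import Algebra.Properties.Semiring.Mult semiring using () renaming (_×_ to _×′_)
  open import Algebra.Properties.Semiring.Exp semiring using () renaming (_^_ to _^′_)

  ×′≡* : ∀ n x → n ×′ x ≡ + n * x
  ×′≡* zero    x = ≡.sym (ℤ.*-zeroˡ x)
  ×′≡* (suc n) x = ≡.trans (cong (λ z → x + z) (×′≡* n x)) (lem x (+ n))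
    where
    lem : ∀ x n → x + n * x ≡ (+ 1 + n) * x
    lem = solve-∀

  ^′≡^ : ∀ x n → x ^′ n ≡ x ℤ.^ n
  ^′≡^ x zero    = refl
  ^′≡^ x (suc n) = cong (λ z → x * z) (^′≡^ x n)

  open Frobenius semiring using (HasChar; frobenius-+) public

  hasChar : HasChar q
  hasChar x = by x (≡.trans (×′≡* q x) (≡.sym (ℤ.+-identityˡ _)))

  ∣⇒≋ : ∀ {a b} → + q ∣ a - b → a ≋ b
  ∣⇒≋ {a} {b} (divides k e) = by k (≡.trans (lem a b) (cong (λ z → b + z) (≡.trans e (ℤ.*-comm k (+ q)))))
    where
    lem : ∀ a b → a ≡ b + (a - b)
    lem = solve-∀

  ≋⇒∣ : ∀ {a b} → a ≋ b → + q ∣ a - b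
  ≋⇒∣ {a} {b} (by k e) = divides k (≡.trans (cong (λ z → z - b) e) (lem b (+ q) k))
    where
    lem : ∀ b q k → (b + q * k) - b ≡ k * q
    lem = solve-∀

  ∣⇒≋0 : ∀ {a} → + q ∣ a → a ≋ + 0
  ∣⇒≋0 d = ∣⇒≋ (subst (+ q ∣_) (≡.sym (ℤ.+-identityʳ _)) d)

  ≋0⇒∣ : ∀ {a} → a ≋ + 0 → + q ∣ a
  ≋0⇒∣ e = subst (+ q ∣_) (ℤ.+-identityʳ _) (≋⇒∣ e)

  ≋-∣ : ∀ {a b} → a ≋ b → + q ∣ a → + q ∣ b
  ≋-∣ e d = ≋0⇒∣ (≋-trans (≋-sym e) (∣⇒≋0 d))

  ≋-^ : ∀ {a b} n → a ≋ b → a ℤ.^ n ≋ b ℤ.^ n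
  ≋-^ zero    e = ≋-refl
  ≋-^ (suc n) e = ≋-* e (≋-^ n e)

  module _ (pq : Prime q) where
    ≋-cancel : ∀ m {a b} → ¬ (+ q ∣ m) → m * a ≋ m * b → a ≋ b
    ≋-cancel m {a} {b} q∤m e with euclidℤ pq m (a - b) (subst (+ q ∣_) (lem m a b) (≋⇒∣ e))
      where
      lem : ∀ m a b → m * a - m * b ≡ m * (a - b)
      lem = solve-∀
    ... | inj₁ q∣m = contradiction q∣m q∤m
    ... | inj₂ d   = ∣⇒≋ d

    frobenius : ∀ a b → (a + b) ℤ.^ q ≋ a ℤ.^ q + b ℤ.^ q
    frobenius a b rewrite ≡.sym (^′≡^ (a + b) q) | ≡.sym (^′≡^ a q) | ≡.sym (^′≡^ b q) =
      frobenius-+ pq hasChar (≈⇒≋ (ℤ.*-comm a b))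

    0^q : (+ 0) ℤ.^ q ≡ + 0
    0^q = lem q pq
      where
      lem : ∀ q → Prime q → (+ 0) ℤ.^ q ≡ + 0
      lem zero    pq = contradiction pq λ ()
      lem (suc q) pq = refl

    fermat-+ : ∀ n → (+ n) ℤ.^ q ≋ + n
    fermat-+ zero    = ≈⇒≋ 0^q
    fermat-+ (suc n) = ≋-trans (frobenius (+ 1) (+ n)) (≋-+ (≈⇒≋ (ℤ.^-zeroˡ q)) (fermat-+ n))

    -- The parity of q never enters for negative a: with b = -a, Frobenius applied to a + b = 0
    -- gives a^q + b^q ≡ 0, and b is already covered.
    fermat : ∀ a → a ℤ.^ q ≋ a
    fermat (+ n)      = fermat-+ n
    fermat a@(-[1+ n ]) = ∣⇒≋ (subst (+ q ∣_) (lem (a ℤ.^ q) a (b ℤ.^ q) b (ℤ.+-inverseˡ b))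
        (ℤD.∣m∣n⇒∣m-n (≋⇒∣ sum≋0) (≋⇒∣ (fermat-+ (suc n)))))
      where
      b = + suc n
      sum≋0 : a ℤ.^ q + b ℤ.^ q ≋ + 0
      sum≋0 = ≋-trans (≋-sym (frobenius a b)) (≈⇒≋ (≡.trans (cong (ℤ._^ q) (ℤ.+-inverseˡ b)) 0^q))
      lem : ∀ A a B b → a + b ≡ + 0 → (A + B - + 0) - (B - b) ≡ A - a
      lem A a B b e = ≡.trans (lem′ A a B b) (≡.trans (cong (λ s → A - a + s) e) (ℤ.+-identityʳ _))
        where
        lem′ : ∀ A a B b → (A + B - + 0) - (B - b) ≡ A - a + (a + b)
        lem′ = solve-∀

abstract
  -- By Fermat the inverse is a^(q-2).
  inverse-mod : ∀ {q} → Prime q → let open ModZ q in ∀ a → ¬ (+ q ∣ a) → ∃ λ b → a * b ≋ + 1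
  inverse-mod {zero}        pq = contradiction pq λ ()
  inverse-mod {suc zero}    pq = contradiction pq λ ()
  inverse-mod {suc (suc n)} pq a q∤a = a ℤ.^ n , ≋-cancel pq a q∤a (≋-trans (fermat pq a) (≈⇒≋ (≡.sym (ℤ.*-identityʳ a))))
    where open ModZ (suc (suc n))

-- Congruences of Eisenstein integers

module ModE (q : ℕ) where
  open Quotient 𝔼-ring (ι (+ q)) public
  open CommutativeRing commutativeRing public using (semiring; setoid) renaming (+-commutativeMonoid to +-monoid)
  private
    module Q = CommutativeRing commutativeRing
    module Z = ModZ q
  open Q public using () renaming (refl to ≋-refl; sym to ≋-sym; trans to ≋-trans; +-cong to ≋-+; *-cong to ≋-*; -‿cong to ≋-neg)
  open import Algebra.Properties.Semiring.Mult semiring using () renaming (_×_ to _×′_)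
  open import Algebra.Properties.Semiring.Exp semiring using () renaming (_^_ to _^′_)

  ×′≡* : ∀ n x → n ×′ x ≡ ι (+ n) *ᴱ x
  ×′≡* zero    x = ≡.sym (E.zeroˡ x)
  ×′≡* (suc n) x = ≡.trans (cong₂ _+ᴱ_ (≡.sym (E.*-identityˡ x)) (×′≡* n x)) (≡.sym (E.distribʳ x 1# (ι (+ n))))

  ^′≡^ : ∀ x n → x ^′ n ≡ x ^ n
  ^′≡^ x zero    = refl
  ^′≡^ x (suc n) = cong (x *ᴱ_) (^′≡^ x n)

  open Frobenius semiring using (HasChar; frobenius-+) public

  hasChar : HasChar q
  hasChar x = by x (≡.trans (×′≡* q x) (≡.sym (E.+-identityˡ _)))

  ι-≋ : ∀ {a b} → a Z.≋ b → ι a ≋ ι b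
  ι-≋ {a} {b} (Z.by k e) = by (ι k) (≡.trans (cong ι e) (cong (λ z → ι b +ᴱ z) (ι-* (+ q) k)))

  re-≋ : ∀ {x y} → x ≋ y → re x Z.≋ re y
  re-≋ {x} {y} (by k e) = Z.by (re k) (≡.trans (cong re e) (≡.trans (re-+ y _) (cong (λ z → re y + re z) (ι-*-⊹ (+ q) k))))

  im-≋ : ∀ {x y} → x ≋ y → im x Z.≋ im y
  im-≋ {x} {y} (by k e) = Z.by (im k) (≡.trans (cong im e) (≡.trans (im-+ y _) (cong (λ z → im y + im z) (ι-*-⊹ (+ q) k))))

  ⊹-≋ : ∀ {x y} → re x Z.≋ re y → im x Z.≋ im y → x ≋ y
  ⊹-≋ {a ⊹ b} {y@(c ⊹ d)} (Z.by k e) (Z.by l e′) = by (k ⊹ l) (≡.trans (cong₂ _⊹_ e e′)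
      (cong (λ z → y +ᴱ z) (≡.sym (ι-*-⊹ (+ q) (k ⊹ l)))))

  ≋-^ : ∀ {x y} n → x ≋ y → x ^ n ≋ y ^ n
  ≋-^ zero    e = ≋-refl
  ≋-^ (suc n) e = ≋-* e (≋-^ n e)

  module _ (pq : Prime q) where
    ≋-cancel : ∀ m {x y} → ¬ (+ q ∣ m) → ι m *ᴱ x ≋ ι m *ᴱ y → x ≋ y
    ≋-cancel m {x} {y} q∤m e = ⊹-≋
      (Z.≋-cancel pq m q∤m (≡.subst₂ Z._≋_ (cong re (ι-*-⊹ m x)) (cong re (ι-*-⊹ m y)) (re-≋ e)))
      (Z.≋-cancel pq m q∤m (≡.subst₂ Z._≋_ (cong im (ι-*-⊹ m x)) (cong im (ι-*-⊹ m y)) (im-≋ e)))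

    -- Multiplication by the conjugate of z turns the factor z into its norm, a rational integer
    -- prime to q.
    ≋-cancel-norm : ∀ z {x y} → ¬ (+ q ∣ norm z) → z *ᴱ x ≋ z *ᴱ y → x ≋ y
    ≋-cancel-norm z {x} {y} q∤N e = ≋-cancel (norm z) q∤N
      (≡.subst₂ _≋_ (lem x) (lem y) (≋-* (≋-refl {conj z}) e))
      where
      lem : ∀ x → conj z *ᴱ (z *ᴱ x) ≡ ι (norm z) *ᴱ x
      lem x = ≡.trans (≡.sym (E.*-assoc (conj z) z x)) (cong (_*ᴱ x) (≡.trans (E.*-comm (conj z) z) (*-conj z)))

    -- Fermat fixes the rational coordinates, so only ω moves. The q-th power is therefore the
    -- identity for q ≡ 1 modulo 3 and conjugation for q ≡ 2; this difference is the origin of the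
    -- two forms of reciprocity below.
    frobenius-ω : ∀ x → x ^ q ≋ ι (re x) +ᴱ ι (im x) *ᴱ ω ^ q
    frobenius-ω x@(a ⊹ b) = ≋-trans (≈⇒≋ (cong (_^ q) (lem a b))) (≋-trans add
        (≋-+ fermat-ι (≋-trans (≈⇒≋ (^-distrib-* (ι b) ω q)) (≋-* fermat-ι ≋-refl))))
      where
      lem : ∀ a b → (a ⊹ b) ≡ ι a +ᴱ ι b *ᴱ ω
      lem a b = cong₂ _⊹_ (l₁ a b) (l₂ b)
        where
        l₁ : ∀ a b → a ≡ a + (b * + 0 - + 0 * + 1)
        l₁ = solve-∀
        l₂ : ∀ b → b ≡ + 0 + (b * + 1 + + 0 * + 0 - + 0 * + 1)
        l₂ = solve-∀
      fermat-ι : ∀ {a} → ι a ^ q ≋ ι a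
      fermat-ι {a} = ≋-trans (≈⇒≋ (≡.sym (ι-^ a q))) (ι-≋ (Z.fermat pq a))
      add : (ι a +ᴱ ι b *ᴱ ω) ^ q ≋ ι a ^ q +ᴱ (ι b *ᴱ ω) ^ q
      add rewrite ≡.sym (^′≡^ (ι a +ᴱ ι b *ᴱ ω) q) | ≡.sym (^′≡^ (ι a) q) | ≡.sym (^′≡^ (ι b *ᴱ ω) q) =
        frobenius-+ pq hasChar (≈⇒≋ (E.*-comm (ι a) (ι b *ᴱ ω)))

1^ : ∀ n → 1# ^ n ≡ 1#
1^ zero    = refl
1^ (suc n) = ≡.trans (E.*-identityˡ _) (1^ n)

ω^3k : ∀ k → ω ^ (3 ℕ.* k) ≡ 1#
ω^3k k = ≡.trans (≡.sym (^-assocʳ ω 3 k)) (1^ k)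

^-prime≡1 : ∀ k → (pq : Prime (1 ℕ.+ 3 ℕ.* k)) → let open ModE (1 ℕ.+ 3 ℕ.* k) in ∀ x → x ^ (1 ℕ.+ 3 ℕ.* k) ≋ x
^-prime≡1 k pq x@(a ⊹ b) = ≋-trans (frobenius-ω pq x) (≈⇒≋ (≡.trans (cong (λ z → ι a +ᴱ ι b *ᴱ (ω *ᴱ z)) (ω^3k k))
    (cong₂ _⊹_ (l₁ a b) (l₂ b))))
  where
  open ModE (1 ℕ.+ 3 ℕ.* k)
  l₁ : ∀ a b → a + (b * + 0 - + 0 * + 1) ≡ a
  l₁ = solve-∀
  l₂ : ∀ b → + 0 + (b * + 1 + + 0 * + 0 - + 0 * + 1) ≡ b
  l₂ = solve-∀

^-prime≡2 : ∀ k → (pq : Prime (2 ℕ.+ 3 ℕ.* k)) → let open ModE (2 ℕ.+ 3 ℕ.* k) in ∀ x → x ^ (2 ℕ.+ 3 ℕ.* k) ≋ conj x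
^-prime≡2 k pq x@(a ⊹ b) = ≋-trans (frobenius-ω pq x) (≈⇒≋ (≡.trans (cong (λ z → ι a +ᴱ ι b *ᴱ (ω *ᴱ (ω *ᴱ z))) (ω^3k k))
    (cong₂ _⊹_ (l₁ a b) (l₂ b))))
  where
  open ModE (2 ℕ.+ 3 ℕ.* k)
  l₁ : ∀ a b → a + (b * ℤ.-1ℤ - + 0 * ℤ.-1ℤ) ≡ a - b
  l₁ = solve-∀
  l₂ : ∀ b → + 0 + (b * ℤ.-1ℤ + + 0 * ℤ.-1ℤ - + 0 * ℤ.-1ℤ) ≡ - b
  l₂ = solve-∀

sumTo : ℕ → (ℕ → ℤ) → ℤ
sumTo n f = sumℤ {n} (f ∘ toℕ)

sumTo-last : ∀ n f → sumTo (suc n) f ≡ sumTo n f + f n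
sumTo-last n f = ≡.trans (sumℤ-init-last {n} (f ∘ toℕ))
  (cong₂ _+_ (sumℤ-cong {n} (cong f ∘ Fin.toℕ-inject₁)) (cong f (Fin.toℕ-fromℕ n)))

-- Power sums

module PowerSums {q : ℕ} (pq : Prime q) where
  private module Q = ModZ q
  open Endomorphisms (Pointwise.commutativeMonoid ℕ Q.+-monoid)
  private
    module S = Semiring semiring
  open import Algebra.Properties.Semiring.Exp semiring using () renaming (_^_ to _^ˢ_)
  open Frobenius semiring

  Δ : (ℕ → ℤ) → ℕ → ℤ
  Δ f n = f (suc n) - f n

  shiftᴱ Δᴱ : End
  shiftᴱ = record
    { apply = λ f n → f (suc n) ; a-cong = λ e n → e (suc n) ; a-⊕ = λ _ _ _ → Q.≋-refl ; a-0 = λ _ → Q.≋-refl }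
  Δᴱ = record
    { apply = Δ
    ; a-cong = λ e n → Q.≋-+ (e (suc n)) (Q.≋-neg (e n))
    ; a-⊕ = λ f g n → Q.≈⇒≋ (lem (f (suc n)) (g (suc n)) (f n) (g n))
    ; a-0 = λ _ → Q.≋-refl }
    where
    lem : ∀ a b c d → (a + b) - (c + d) ≡ (a - c) + (b - d)
    lem = solve-∀

  hasCharᴱ : HasChar q
  hasCharᴱ = End-hasChar {q} λ f n → Q.≋-trans (Q.≈⇒≋ (pointwise-× Q.+-monoid q f n)) (Q.hasChar (f n))

  shift^ : ∀ k f n → apply (shiftᴱ ^ˢ k) f n ≡ f (k ℕ.+ n)
  shift^ zero    f n = refl
  shift^ (suc k) f n = ≡.trans (shift^ k f (suc n)) (cong f (ℕ.+-suc k n))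

  1ˢ^ : ∀ k f n → apply (S.1# ^ˢ k) f n ≡ f n
  1ˢ^ zero    f n = refl
  1ˢ^ (suc k) f n = 1ˢ^ k f n

  shift≈1+Δ : shiftᴱ S.≈ S.1# S.+ Δᴱ
  shift≈1+Δ f n = Q.≈⇒≋ (lem (f (suc n)) (f n))
    where
    lem : ∀ a b → a ≡ b + (a - b)
    lem = solve-∀

  -- Shifting by q is (1 + Δ)^q ≡ 1 + Δ^q.
  shift-by-q : ∀ f n → f (q ℕ.+ n) Q.≋ f n + apply (Δᴱ ^ˢ q) f n
  shift-by-q f n = Q.≋-trans (Q.≈⇒≋ (≡.sym (shift^ q f n)))
    (Q.≋-trans (^-congˡ q {shiftᴱ} {S.1# S.+ Δᴱ} shift≈1+Δ f n)
    (Q.≋-trans (frobenius-+ pq hasCharᴱ {S.1#} {Δᴱ} (λ _ _ → Q.≋-refl) f n)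
    (Q.≋-+ (Q.≈⇒≋ (1ˢ^ q f n)) Q.≋-refl)))
    where open import Algebra.Properties.Semiring.Exp semiring using (^-congˡ)

  -- Deg m f: f is a polynomial function of degree less than m.
  Deg : ℕ → (ℕ → ℤ) → Set
  Deg zero    f = ∀ n → f n ≡ + 0
  Deg (suc m) f = Deg m (Δ f)

  Deg-ext : ∀ m {f g} → (∀ n → f n ≡ g n) → Deg m f → Deg m g
  Deg-ext zero    e d n = ≡.trans (≡.sym (e n)) (d n)
  Deg-ext (suc m) e d = Deg-ext m (λ n → cong₂ _-_ (e (suc n)) (e n)) d

  Deg-+ : ∀ m {f g} → Deg m f → Deg m g → Deg m (λ n → f n + g n)
  Deg-+ zero    d d′ n = cong₂ _+_ (d n) (d′ n)
  Deg-+ (suc m) {f} {g} d d′ = Deg-ext m (λ n → lem (f (suc n)) (g (suc n)) (f n) (g n)) (Deg-+ m d d′)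
    where
    lem : ∀ a b c d → (a - c) + (b - d) ≡ (a + b) - (c + d)
    lem = solve-∀

  Deg-scale : ∀ m c {f} → Deg m f → Deg m (λ n → c * f n)
  Deg-scale zero    c d n = ≡.trans (cong (c *_) (d n)) (ℤ.*-zeroʳ c)
  Deg-scale (suc m) c {f} d = Deg-ext m (λ n → lem c (f (suc n)) (f n)) (Deg-scale m c d)
    where
    lem : ∀ c a b → c * (a - b) ≡ c * a - c * b
    lem = solve-∀

  Deg-shift : ∀ m {f} → Deg m f → Deg m (f ∘ suc)
  Deg-shift zero    d n = d (suc n)
  Deg-shift (suc m) d = Deg-shift m d

  -- The product rule of differences: Δ((αn + β)f(n)) = (αn + β)Δf(n) + αf(n + 1).
  Deg-linear* : ∀ m α β {f} → Deg m f → Deg (suc m) (λ n → (α * + n + β) * f n)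
  Deg-linear* zero α β {f} d n rewrite d n | d (suc n) = lem (α * + suc n + β) (α * + n + β)
    where
    lem : ∀ x y → x * + 0 - y * + 0 ≡ + 0
    lem = solve-∀
  Deg-linear* (suc m) α β {f} d = Deg-ext (suc m) (λ n → lem α β (+ n) (f (suc n)) (f n))
      (Deg-+ (suc m) {λ n → (α * + n + β) * Δ f n} {λ n → α * f (suc n)}
        (Deg-linear* m α β d) (Deg-scale (suc m) α {f ∘ suc} (Deg-shift (suc m) {f} d)))
    where
    lem : ∀ α β n a b → (α * n + β) * (a - b) + α * a ≡ (α * (+ 1 + n) + β) * a - (α * n + β) * b
    lem = solve-∀

  Deg-linear^* : ∀ m α β e {f} → Deg m f → Deg (e ℕ.+ m) (λ n → (α * + n + β) ℤ.^ e * f n)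
  Deg-linear^* m α β zero    {f} d = Deg-ext m (λ n → ≡.sym (ℤ.*-identityˡ (f n))) d
  Deg-linear^* m α β (suc e) {f} d = Deg-ext (suc (e ℕ.+ m)) (λ n → ≡.sym (ℤ.*-assoc (α * + n + β) _ (f n)))
    (Deg-linear* (e ℕ.+ m) α β (Deg-linear^* m α β e d))

  Deg-mono : ∀ {m m′ f} → m ℕ.≤ m′ → Deg m f → Deg m′ f
  Deg-mono {zero} {zero}   m≤ d = d
  Deg-mono {zero} {suc m′} m≤ d = Deg-mono {zero} {m′} ℕ.z≤n (λ n → cong₂ _-_ (d (suc n)) (d n))
  Deg-mono {suc m} (ℕ.s≤s m≤) d = Deg-mono m≤ d

  Deg⇒Δ^≋0 : ∀ m {f} → Deg m f → ∀ n → apply (Δᴱ ^ˢ m) f n Q.≋ + 0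
  Deg⇒Δ^≋0 zero    d n = Q.≈⇒≋ (d n)
  Deg⇒Δ^≋0 (suc m) {f} d n = Q.≋-trans (swap m f n) (Deg⇒Δ^≋0 m d n)
    where
    -- `Deg` takes differences from the inside, operator powers from the outside.
    swap : ∀ m f n → apply (Δᴱ ^ˢ suc m) f n Q.≋ apply (Δᴱ ^ˢ m) (Δ f) n
    swap zero    f n = Q.≋-refl
    swap (suc m) f n = a-cong Δᴱ (swap m f) n

  Δ-sumTo : ∀ f n → Δ (λ m → sumTo m f) n ≡ f n
  Δ-sumTo f n = ≡.trans (cong (_- sumTo n f) (sumTo-last n f)) (lem (sumTo n f) (f n))
    where
    lem : ∀ a b → (a + b) - a ≡ b
    lem = solve-∀

  -- The partial sums F satisfy ΔF = f, so F has degree less than m + 1 ≤ q and Δ^q F vanishes.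
  -- Shifting by q then does not change F modulo q, whence F(q) ≡ F(0) = 0.
  sum-Deg≋0 : ∀ {m f} → Deg m f → m ℕ.< q → sumTo q f Q.≋ + 0
  sum-Deg≋0 {m} {f} d m<q = Q.≋-trans (Q.≈⇒≋ (cong F (≡.sym (ℕ.+-identityʳ q))))
    (Q.≋-trans (shift-by-q F 0) (Q.≋-+ (Q.≋-refl {+ 0})
      (Deg⇒Δ^≋0 q {F} (Deg-mono {f = F} m<q (Deg-ext m (≡.sym ∘ Δ-sumTo f) d)) 0)))
    where
    F : ℕ → ℤ
    F n = sumTo n f

-- Reindexing sums over residue classes

module Residues (q : ℕ) .{{_ : ℕ.NonZero q}} where
  open ModZ q

  residue : ℤ → Fin q
  residue a = fromℕ< (n%ℕd<d a q)

  residue-≋ : ∀ a → + toℕ (residue a) ≋ a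
  residue-≋ a = ≋-sym (by (a /ℕ q) (≡.trans (a≡a%ℕn+[a/ℕn]*n a q)
    (cong₂ _+_ (cong +_ (≡.sym (Fin.toℕ-fromℕ< _))) (ℤ.*-comm (a /ℕ q) (+ q)))))

  toℕ-≋-injective : ∀ (i j : Fin q) → + toℕ i ≋ + toℕ j → i ≡ j
  toℕ-≋-injective i j e = Fin.toℕ-injective (ℤ.+-injective (ℤ.i-j≡0⇒i≡j _ _ (ℤ.∣i∣≡0⇒i≡0
    (divisible⇒0 (subst (ℕ._< q) (cong ℤ.∣_∣ (≡.sym (ℤ.m-n≡m⊖n (toℕ i) (toℕ j))))
        (ℕ.≤-<-trans (ℤ.∣m⊝n∣≤m⊔n (toℕ i) (toℕ j)) (ℕ.⊔-pres-<m (Fin.toℕ<n i) (Fin.toℕ<n j))))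
      (ℤD.∣⇒∣ᵤ (≋⇒∣ e))))))
    where
    divisible⇒0 : ∀ {n} → n ℕ.< q → q ℕD.∣ n → n ≡ 0
    divisible⇒0 {zero}  n<q d = refl
    divisible⇒0 {suc n} n<q d = contradiction (ℕD.∣⇒≤ d) (ℕ.<⇒≱ n<q)

  Periodic : ∀ {A : Set} → (ℤ → A) → Set
  Periodic f = ∀ {a b} → a ≋ b → f a ≡ f b

  ∑ : (ℤ → 𝔼) → 𝔼
  ∑ f = sum (λ (i : Fin q) → f (+ toℕ i))

  -- The affine map a ↦ ga + c permutes the residues, with inverse a ↦ h(a - c). Shifts, reflections
  -- and scalings of sums are all instances.
  ∑-reindex : ∀ {f} → Periodic f → ∀ g h c → g * h ≋ + 1 → ∑ (λ a → f (g * a + c)) ≡ ∑ f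
  ∑-reindex {f} per g h c gh = ≡.sym (≡.trans (sum-permute _ π) (sum-cong-≗ {q} λ i → per (residue-≋ (g * + toℕ i + c))))
    where
    to from : Fin q → Fin q
    to   i = residue (g * + toℕ i + c)
    from i = residue (h * (+ toℕ i - c))
    to-from : ∀ i → to (from i) ≡ i
    to-from i = toℕ-≋-injective _ _ (≋-trans (residue-≋ _)
        (≋-trans (≋-+ (≋-* (≋-refl {g}) (residue-≋ _)) (≋-refl {c}))
        (≋-trans (≈⇒≋ (lem g h c (+ toℕ i))) (≋-trans (≋-+ (≋-* gh (≋-refl {+ toℕ i - c})) (≋-refl {c}))
            (≈⇒≋ (lem′ (+ toℕ i) c))))))
      where
      lem : ∀ g h c i → g * (h * (i - c)) + c ≡ (g * h) * (i - c) + c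
      lem = solve-∀
      lem′ : ∀ i c → + 1 * (i - c) + c ≡ i
      lem′ = solve-∀
    from-to : ∀ i → from (to i) ≡ i
    from-to i = toℕ-≋-injective _ _ (≋-trans (residue-≋ _)
        (≋-trans (≋-* (≋-refl {h}) (≋-+ (residue-≋ (g * + toℕ i + c)) (≋-refl { - c})))
        (≋-trans (≈⇒≋ (lem g h c (+ toℕ i))) (≋-trans (≋-* gh (≋-refl {+ toℕ i})) (≈⇒≋ (ℤ.*-identityˡ _))))))
      where
      lem : ∀ g h c i → h * ((g * i + c) - c) ≡ (g * h) * i
      lem = solve-∀
    π = permutation to from to-from from-to

-- Cubic characters of prime modulus

data CubicValue : 𝔼 → Set where
  c0  : CubicValue 0#
  c1  : CubicValue 1#
  cω  : CubicValue ω
  cω² : CubicValue ω²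

CubicValue-* : ∀ {x y} → CubicValue x → CubicValue y → CubicValue (x *ᴱ y)
CubicValue-* {y = y} c0 _ = subst CubicValue (≡.sym (E.zeroˡ y)) c0
CubicValue-* c1  c = subst CubicValue (≡.sym (E.*-identityˡ _)) c
CubicValue-* cω  c0  = c0
CubicValue-* cω  c1  = cω
CubicValue-* cω  cω  = cω²
CubicValue-* cω  cω² = c1
CubicValue-* cω² c0  = c0
CubicValue-* cω² c1  = cω²
CubicValue-* cω² cω  = c1
CubicValue-* cω² cω² = cω

square≡conj : ∀ {x} → CubicValue x → x *ᴱ x ≡ conj x
square≡conj c0  = refl
square≡conj c1  = refl
square≡conj cω  = refl
square≡conj cω² = refl

*-conj-unit : ∀ {x} → CubicValue x → x ≢ 0# → x *ᴱ conj x ≡ 1#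
*-conj-unit c0  x≢0 = contradiction refl x≢0
*-conj-unit c1  x≢0 = refl
*-conj-unit cω  x≢0 = refl
*-conj-unit cω² x≢0 = refl

square≡1⇒≡1 : ∀ {x} → CubicValue x → x *ᴱ x ≡ 1# → x ≡ 1#
square≡1⇒≡1 c1 _ = refl
square≡1⇒≡1 c0 ()
square≡1⇒≡1 cω ()
square≡1⇒≡1 cω² ()

_≟1 : ∀ {x} → CubicValue x → Dec (x ≡ 1#)
c0  ≟1 = no λ ()
c1  ≟1 = yes refl
cω  ≟1 = no λ ()
cω² ≟1 = no λ ()

ω*-fixed : ∀ s → ω *ᴱ s ≡ s → s ≡ 0#
ω*-fixed (a ⊹ b) e = cong₂ _⊹_ a≡0 b≡0
  where
  lem-re : + 0 * a - + 1 * b ≡ a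
  lem-re = cong re e
  lem-im : + 0 * b + + 1 * a - + 1 * b ≡ b
  lem-im = cong im e
  a≡-b : a ≡ - b
  a≡-b = ≡.trans (≡.sym lem-re) (l a b)
    where
    l : ∀ a b → + 0 * a - + 1 * b ≡ - b
    l = solve-∀
  3b≡0 : + 3 * b ≡ + 0
  3b≡0 = ≡.trans (l a b) (≡.trans (cong₂ (λ u v → v - u + (a + b)) lem-im (≡.refl {x = b}))
      (≡.trans (l₂ b (a + b)) (≡.trans (cong (_+ b) a≡-b) (ℤ.+-inverseˡ b))))
    where
    l : ∀ a b → + 3 * b ≡ b - (+ 0 * b + + 1 * a - + 1 * b) + (a + b)
    l = solve-∀
    l₂ : ∀ b c → b - b + c ≡ c
    l₂ = solve-∀
  b≡0 : b ≡ + 0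
  b≡0 with ℤ.i*j≡0⇒i≡0∨j≡0 (+ 3) 3b≡0
  ... | inj₂ b≡0 = b≡0
  a≡0 : a ≡ + 0
  a≡0 = ≡.trans a≡-b (cong -_ b≡0)

-- A sum that is reproduced when multiplied by a value x ≠ 1 must vanish, since 1 - x is not a zero
-- divisor. This gives the orthogonality relation for χ.
*-fixed⇒0 : ∀ {x} → CubicValue x → x ≢ 1# → ∀ s → x *ᴱ s ≡ s → s ≡ 0#
*-fixed⇒0 c0  x≢1 s e = ≡.trans (≡.sym e) (E.zeroˡ s)
*-fixed⇒0 c1  x≢1 s e = contradiction refl x≢1
*-fixed⇒0 cω  x≢1 s e = ω*-fixed s e
*-fixed⇒0 cω² x≢1 s e = ω*-fixed s (≡.trans (cong (ω *ᴱ_) (≡.sym e)) (≡.trans (≡.sym (E.*-assoc ω ω² s)) (E.*-identityˡ s)))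

sum-conj : ∀ {n} (t : Vector 𝔼 n) → conj (sum t) ≡ sum (conj ∘ t)
sum-conj {zero}  t = refl
sum-conj {suc n} t = ≡.trans (conj-+ (t Fin.zero) _) (cong (λ z → conj (t Fin.zero) +ᴱ z) (sum-conj (t ∘ Fin.suc)))

sum-const-1 : ∀ n → sum {n} (λ _ → 1#) ≡ ι (+ n)
sum-const-1 zero    = refl
sum-const-1 (suc n) = cong (λ z → 1# +ᴱ z) (sum-const-1 n)

-- Here e = (ℓ - 1)/3, and r is a primitive cube root of unity modulo ℓ. The choice of r is the
-- choice of one of the two primes of ℤ[ω] above ℓ.
module Character (e : ℕ) (pℓ : Prime (1 ℕ.+ 3 ℕ.* e)) (r : ℤ) (root : + (1 ℕ.+ 3 ℕ.* e) ∣ r * r + r + + 1) where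
  ℓ : ℕ
  ℓ = 1 ℕ.+ 3 ℕ.* e

  open ModZ ℓ
  open Residues ℓ
  open PowerSums pℓ using (Deg; Deg-linear^*; sum-Deg≋0; Deg-ext)

  ℓ∤3 : ¬ (+ ℓ ∣ + 3)
  ℓ∤3 d with ℕD.∣⇒≤ (ℤD.∣⇒∣ᵤ d)
  ... | ℓ≤3 = no-e e pℓ ℓ≤3
    where
    no-e : ∀ e → Prime (1 ℕ.+ 3 ℕ.* e) → ¬ (1 ℕ.+ 3 ℕ.* e ℕ.≤ 3)
    no-e zero    p1 _ = contradiction p1 λ ()
    no-e (suc e) _ ≤3 = contradiction (ℕ.≤-trans (ℕ.s≤s (ℕ.*-monoʳ-≤ 3 (ℕ.s≤s (ℕ.z≤n {e})))) ≤3) λ { (ℕ.s≤s (ℕ.s≤s (ℕ.s≤s ()))) }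

  e>0 : 0 ℕ.< e
  e>0 = lem e pℓ
    where
    lem : ∀ e → Prime (1 ℕ.+ 3 ℕ.* e) → 0 ℕ.< e
    lem zero    p1 = contradiction p1 λ ()
    lem (suc e) _ = ℕ.z<s

  abstract
    multiple? : ∀ a → Dec (+ ℓ ∣ a)
    multiple? a = + ℓ ℤD.∣? a

  -- Reduction modulo the chosen prime above ℓ, which sends ω to r. It is a ring homomorphism only
  -- modulo ℓ.
  ρ : 𝔼 → ℤ
  ρ x = re x + im x * r

  ρ-+ : ∀ x y → ρ (x +ᴱ y) ≡ ρ x + ρ y
  ρ-+ (a ⊹ b) (c ⊹ d) = lem a b c d r
    where
    lem : ∀ a b c d r → (a + c) + (b + d) * r ≡ (a + b * r) + (c + d * r)
    lem = solve-∀

  ρ-* : ∀ x y → ρ (x *ᴱ y) ≋ ρ x * ρ y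
  ρ-* (a ⊹ b) (c ⊹ d) = ∣⇒≋ (subst (+ ℓ ∣_) (lem a b c d r) (ℤD.∣n⇒∣m*n (- (b * d)) root))
    where
    lem : ∀ a b c d r → - (b * d) * (r * r + r + + 1)
        ≡ (a * c - b * d + (a * d + b * c - b * d) * r) - (a + b * r) * (c + d * r)
    lem = solve-∀

  ρ-sum : ∀ {n} (t : Vector 𝔼 n) → ρ (sum t) ≡ sumℤ (ρ ∘ t)
  ρ-sum {zero}  t = refl
  ρ-sum {suc n} t = ≡.trans (ρ-+ (t Fin.zero) _) (cong (λ z → ρ (t Fin.zero) + z) (ρ-sum (t ∘ Fin.suc)))

  sumℤ-≋ : ∀ {n} (s t : Vector ℤ n) → (∀ i → s i ≋ t i) → sumℤ s ≋ sumℤ t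
  sumℤ-≋ {zero}  s t eq = ≋-refl
  sumℤ-≋ {suc n} s t eq = ≋-+ (eq Fin.zero) (sumℤ-≋ (s ∘ Fin.suc) (t ∘ Fin.suc) (eq ∘ Fin.suc))

  private
    -- Each difference of two distinct values of ρ divides 1 or 3 modulo ℓ.
    divides-unit : ∀ {x} y c → + ℓ ∣ x → x * y + c * (r * r + r + + 1) ≡ + 1 → ∀ {A : Set} → A
    divides-unit {x} y c d eq = contradiction (subst (+ ℓ ∣_) eq (ℤD.∣m∣n⇒∣m+n (ℤD.∣m⇒∣m*n y d) (ℤD.∣n⇒∣m*n c root))) (prime∤1 pℓ)

    divides-3 : ∀ {x} y c → + ℓ ∣ x → x * y + c * (r * r + r + + 1) ≡ + 3 → ∀ {A : Set} → A
    divides-3 {x} y c d eq = contradiction (subst (+ ℓ ∣_) eq (ℤD.∣m∣n⇒∣m+n (ℤD.∣m⇒∣m*n y d) (ℤD.∣n⇒∣m*n c root))) ℓ∤3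

    0≠1 : ∀ r → ((+ 0 + + 0 * r) - (+ 1 + + 0 * r)) * -[1+ 0 ] + + 0 * (r * r + r + + 1) ≡ + 1
    0≠1 = solve-∀
    0≠ω : ∀ r → ((+ 0 + + 0 * r) - (+ 0 + + 1 * r)) * (r + + 1) + + 1 * (r * r + r + + 1) ≡ + 1
    0≠ω = solve-∀
    0≠ω² : ∀ r → ((+ 0 + + 0 * r) - (-[1+ 0 ] + -[1+ 0 ] * r)) * - r + + 1 * (r * r + r + + 1) ≡ + 1
    0≠ω² = solve-∀
    1≠ω : ∀ r → ((+ 1 + + 0 * r) - (+ 0 + + 1 * r)) * (r + + 2) + + 1 * (r * r + r + + 1) ≡ + 3
    1≠ω = solve-∀
    1≠ω² : ∀ r → ((+ 1 + + 0 * r) - (-[1+ 0 ] + -[1+ 0 ] * r)) * (+ 1 - r) + + 1 * (r * r + r + + 1) ≡ + 3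
    1≠ω² = solve-∀
    ω≠ω² : ∀ r → ((+ 0 + + 1 * r) - (-[1+ 0 ] + -[1+ 0 ] * r)) * (- (+ 2 * r + + 1)) + + 4 * (r * r + r + + 1) ≡ + 3
    ω≠ω² = solve-∀

  ρ-injective : ∀ {x y} → CubicValue x → CubicValue y → ρ x ≋ ρ y → x ≡ y
  ρ-injective c0  c0  _ = refl
  ρ-injective c1  c1  _ = refl
  ρ-injective cω  cω  _ = refl
  ρ-injective cω² cω² _ = refl
  ρ-injective c0  c1  e = divides-unit -[1+ 0 ] (+ 0) (≋⇒∣ e) (0≠1 r)
  ρ-injective c1  c0  e = divides-unit -[1+ 0 ] (+ 0) (≋⇒∣ (≋-sym e)) (0≠1 r)
  ρ-injective c0  cω  e = divides-unit (r + + 1) (+ 1) (≋⇒∣ e) (0≠ω r)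
  ρ-injective cω  c0  e = divides-unit (r + + 1) (+ 1) (≋⇒∣ (≋-sym e)) (0≠ω r)
  ρ-injective c0  cω² e = divides-unit (- r) (+ 1) (≋⇒∣ e) (0≠ω² r)
  ρ-injective cω² c0  e = divides-unit (- r) (+ 1) (≋⇒∣ (≋-sym e)) (0≠ω² r)
  ρ-injective c1  cω  e = divides-3 (r + + 2) (+ 1) (≋⇒∣ e) (1≠ω r)
  ρ-injective cω  c1  e = divides-3 (r + + 2) (+ 1) (≋⇒∣ (≋-sym e)) (1≠ω r)
  ρ-injective c1  cω² e = divides-3 (+ 1 - r) (+ 1) (≋⇒∣ e) (1≠ω² r)
  ρ-injective cω² c1  e = divides-3 (+ 1 - r) (+ 1) (≋⇒∣ (≋-sym e)) (1≠ω² r)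
  ρ-injective cω  cω² e = divides-3 (- (+ 2 * r + + 1)) (+ 4) (≋⇒∣ e) (ω≠ω² r)
  ρ-injective cω² cω  e = divides-3 (- (+ 2 * r + + 1)) (+ 4) (≋⇒∣ (≋-sym e)) (ω≠ω² r)

  ^3e : ∀ a → ¬ (+ ℓ ∣ a) → a ℤ.^ (3 ℕ.* e) ≋ + 1
  ^3e a ℓ∤a = ≋-cancel pℓ a ℓ∤a (≋-trans (fermat pℓ a) (≈⇒≋ (≡.sym (ℤ.*-identityʳ a))))

  0^e : ∀ {a} → + ℓ ∣ a → a ℤ.^ e ≋ + 0
  0^e {a} d = lem e e>0
    where
    lem : ∀ e → 0 ℕ.< e → a ℤ.^ e ≋ + 0
    lem (suc e) _ = ∣⇒≋0 (ℤD.∣m⇒∣m*n (a ℤ.^ e) d)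

  -- Modulo ℓ the polynomial t³ - 1 is (t - 1)(t - r)(t + 1 + r), and its roots are the images of 1,
  -- ω and ω² under `ρ`.
  cubicResidue-unit : ∀ t → t ℤ.^ 3 ≋ + 1 → ∃ λ x → CubicValue x × ρ x ≋ t
  cubicResidue-unit t t³ = [ is-1 , (λ d → [ is-ω , is-ω² ]′ (euclidℤ pℓ (t - r) (t + + 1 + r) d)) ]′
      (euclidℤ pℓ (t - + 1) ((t - r) * (t + + 1 + r)) factored)
    where
    factored : + ℓ ∣ (t - + 1) * ((t - r) * (t + + 1 + r))
    factored = subst (+ ℓ ∣_) (lem t r) (ℤD.∣m∣n⇒∣m+n (≋⇒∣ t³) (ℤD.∣n⇒∣m*n (+ 1 - t) root))
      where
      lem : ∀ t r → (t * (t * (t * + 1)) - + 1) + (+ 1 - t) * (r * r + r + + 1)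
          ≡ (t - + 1) * ((t - r) * (t + + 1 + r))
      lem = solve-∀
    is-1 : + ℓ ∣ t - + 1 → ∃ λ x → CubicValue x × ρ x ≋ t
    is-1 d = 1# , c1 , ≋-sym (∣⇒≋ (subst (+ ℓ ∣_) (lem t r) d))
      where
      lem : ∀ t r → t - + 1 ≡ t - (+ 1 + + 0 * r)
      lem = solve-∀
    is-ω : + ℓ ∣ t - r → ∃ λ x → CubicValue x × ρ x ≋ t
    is-ω d = ω , cω , ≋-sym (∣⇒≋ (subst (+ ℓ ∣_) (lem t r) d))
      where
      lem : ∀ t r → t - r ≡ t - (+ 0 + + 1 * r)
      lem = solve-∀
    is-ω² : + ℓ ∣ t + + 1 + r → ∃ λ x → CubicValue x × ρ x ≋ t
    is-ω² d = ω² , cω² , ≋-sym (∣⇒≋ (subst (+ ℓ ∣_) (lem t r) d))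
      where
      lem : ∀ t r → t + + 1 + r ≡ t - (-[1+ 0 ] + -[1+ 0 ] * r)
      lem = solve-∀

  cubicResidue : ∀ a → ∃ λ x → CubicValue x × ρ x ≋ a ℤ.^ e
  cubicResidue a with multiple? a
  ... | yes d = 0# , c0 , ≋-sym (0^e d)
  ... | no  n = cubicResidue-unit (a ℤ.^ e)
    (≋-trans (≈⇒≋ (≡.trans (ℤ.^-*-assoc a e 3) (cong (a ℤ.^_) (ℕ.*-comm e 3)))) (^3e a n))

  abstract
    -- The cubic residue character. Being abstract, it is known only through its range and Euler's
    -- criterion `ρ-χ`.
    χ : ℤ → 𝔼
    χ a = proj₁ (cubicResidue a)

    χ-value : ∀ a → CubicValue (χ a)
    χ-value a = proj₁ (proj₂ (cubicResidue a))

    ρ-χ : ∀ a → ρ (χ a) ≋ a ℤ.^ e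
    ρ-χ a = proj₂ (proj₂ (cubicResidue a))

  -- Injectivity of `ρ` on cubic values lets every property of χ be checked on the powers a^e.
  χ-unique : ∀ {a x} → CubicValue x → a ℤ.^ e ≋ ρ x → χ a ≡ x
  χ-unique {a} c eq = ρ-injective (χ-value a) c (≋-trans (ρ-χ a) eq)

  χ-periodic : Periodic χ
  χ-periodic {a} {b} eq = χ-unique (χ-value b) (≋-trans (≋-^ e eq) (≋-sym (ρ-χ b)))

  *-^ : ∀ a b n → (a * b) ℤ.^ n ≡ a ℤ.^ n * b ℤ.^ n
  *-^ a b zero    = refl
  *-^ a b (suc n) = ≡.trans (cong ((a * b) *_) (*-^ a b n)) (lem a b (a ℤ.^ n) (b ℤ.^ n))
    where
    lem : ∀ a b c d → (a * b) * (c * d) ≡ (a * c) * (b * d)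
    lem = solve-∀

  χ-* : ∀ a b → χ (a * b) ≡ χ a *ᴱ χ b
  χ-* a b = χ-unique (CubicValue-* (χ-value a) (χ-value b))
    (≋-trans (≈⇒≋ (*-^ a b e)) (≋-trans (≋-* (≋-sym (ρ-χ a)) (≋-sym (ρ-χ b))) (≋-sym (ρ-* (χ a) (χ b)))))

  χ-multiple : ∀ {a} → + ℓ ∣ a → χ a ≡ 0#
  χ-multiple d = χ-unique c0 (0^e d)

  χ≡0⇒∣ : ∀ {a} → χ a ≡ 0# → + ℓ ∣ a
  χ≡0⇒∣ {a} eq with multiple? a
  ... | yes d = d
  ... | no  n = contradiction (≋0⇒∣ (≋-trans (≋-sym (ρ-χ a)) (≈⇒≋ (cong ρ eq)))) (prime∤^ pℓ a e n)

  χ≢0 : ∀ {a} → ¬ (+ ℓ ∣ a) → χ a ≢ 0#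
  χ≢0 n eq = n (χ≡0⇒∣ eq)

  χ-1 : χ (+ 1) ≡ 1#
  χ-1 = χ-unique c1 (≈⇒≋ (ℤ.^-zeroˡ e))

  χ-neg1 : χ -[1+ 0 ] ≡ 1#
  χ-neg1 = square≡1⇒≡1 (χ-value _) (≡.trans (≡.sym (χ-* -[1+ 0 ] -[1+ 0 ])) χ-1)

  -- The summand is a polynomial of degree at most 2e, and 2e < 3e = ℓ - 1 because e is positive.
  powerSum : ∀ a b c d → sumℤ {ℓ} (λ i → (a * + toℕ i + b) ℤ.^ e * (c * + toℕ i + d) ℤ.^ e) ≋ + 0
  powerSum a b c d = sum-Deg≋0 {e ℕ.+ (e ℕ.+ 1)} {λ n → (a * + n + b) ℤ.^ e * (c * + n + d) ℤ.^ e}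
      (Deg-linear^* (e ℕ.+ 1) a b e {λ n → (c * + n + d) ℤ.^ e}
        (Deg-ext (e ℕ.+ 1) (λ n → ℤ.*-identityʳ _) (Deg-linear^* 1 c d e {λ _ → + 1} (λ _ → refl))))
      (ℕ.s≤s (subst (ℕ._≤ 3 ℕ.* e) (ℕ.+-assoc e e 1) (subst ((e ℕ.+ e) ℕ.+ 1 ℕ.≤_) (lem e) (ℕ.+-monoʳ-≤ (e ℕ.+ e) e>0))))
    where
    lem : ∀ e → e ℕ.+ e ℕ.+ e ≡ 3 ℕ.* e
    lem = solveℕ-∀

  J : 𝔼
  J = ∑ λ a → χ a *ᴱ χ (+ 1 - a)

  -- By Euler's criterion the Jacobi sum reduces to a power sum of degree 2e. So J lies in the very
  -- prime that defines χ and not merely in one of the two above ℓ; the splitting of A depends on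
  -- this.
  ρ-J : ρ J ≋ + 0
  ρ-J = ≋-trans (≈⇒≋ (ρ-sum {ℓ} (λ i → χ (+ toℕ i) *ᴱ χ (+ 1 - + toℕ i)))) (≋-trans
      (sumℤ-≋ {ℓ} (λ i → ρ (χ (+ toℕ i) *ᴱ χ (+ 1 - + toℕ i)))
                  (λ i → (+ 1 * + toℕ i + + 0) ℤ.^ e * (-[1+ 0 ] * + toℕ i + + 1) ℤ.^ e)
                  (λ i → term (+ toℕ i)))
      (powerSum (+ 1) (+ 0) -[1+ 0 ] (+ 1)))
    where
    lem₁ : ∀ i → i ≡ + 1 * i + + 0
    lem₁ = solve-∀
    lem₂ : ∀ i → + 1 - i ≡ -[1+ 0 ] * i + + 1
    lem₂ = solve-∀
    term : ∀ a → ρ (χ a *ᴱ χ (+ 1 - a)) ≋ (+ 1 * a + + 0) ℤ.^ e * (-[1+ 0 ] * a + + 1) ℤ.^ e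
    term a = ≋-trans (ρ-* (χ a) (χ (+ 1 - a))) (≋-trans (≋-* (ρ-χ a) (ρ-χ (+ 1 - a)))
      (≈⇒≋ (cong₂ (λ u v → u ℤ.^ e * v ℤ.^ e) (lem₁ a) (lem₂ a))))

  nonzero : ∀ (i : Fin (3 ℕ.* e)) → ¬ (+ ℓ ∣ + suc (toℕ i))
  nonzero i d = contradiction (ℕD.∣⇒≤ (ℤD.∣⇒∣ᵤ d)) (ℕ.<⇒≱ (ℕ.s<s (Fin.toℕ<n i)))

  abstract
    -- This avoids primitive roots. If χ were 1 on all of 1, ..., ℓ - 1, its sum would be 3e, while
    -- Euler's criterion makes the sum a power sum, hence 0 modulo ℓ. Then ℓ would divide both 3e
    -- and 1 + 3e.
    nontrivial : ∃ λ a → χ a ≢ 1# × ¬ (+ ℓ ∣ a)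
    nontrivial with Fin.all? {n = 3 ℕ.* e} (λ i → χ-value (+ suc (toℕ i)) ≟1)
    ... | no ¬all with Fin.¬∀⟶∃¬ _ _ (λ i → χ-value (+ suc (toℕ i)) ≟1) ¬all
    ...   | i , χ≢1 = + suc (toℕ i) , χ≢1 , nonzero i
    nontrivial | yes all = contradiction
        (subst (+ ℓ ∣_) (lem (+ (3 ℕ.* e))) (ℤD.∣m∣n⇒∣m-n ∣-refl (≋0⇒∣ (≋-trans (≈⇒≋ count) total))))
        (prime∤1 pℓ)
      where
      ∣-refl : + ℓ ∣ + ℓ
      ∣-refl = ℤD.∣-refl
      lem : ∀ n → (+ 1 + n) - n ≡ + 1
      lem = solve-∀
      s : 𝔼
      s = ∑ χ
      count : + (3 ℕ.* e) ≡ ρ s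
      count = ≡.sym (≡.trans (cong ρ (≡.trans (cong₂ _+ᴱ_ (χ-multiple (divides (+ 0) refl))
          (≡.trans (sum-cong-≗ all) (sum-const-1 (3 ℕ.* e)))) (E.+-identityˡ (ι (+ (3 ℕ.* e)))))) (ℤ.+-identityʳ (+ (3 ℕ.* e))))
      total : ρ s ≋ + 0
      total = ≋-trans (≈⇒≋ (ρ-sum {ℓ} (λ i → χ (+ toℕ i)))) (≋-trans
          (sumℤ-≋ {ℓ} (λ i → ρ (χ (+ toℕ i)))
                      -- The second linear form is the constant 1, which makes the sum of a^e an
                      -- instance of `powerSum`.
                      (λ i → (+ 1 * + toℕ i + + 0) ℤ.^ e * (+ 0 * + toℕ i + + 1) ℤ.^ e)
                      (λ i → term (+ toℕ i)))
          (powerSum (+ 1) (+ 0) (+ 0) (+ 1)))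
        where
        lem₁ : ∀ i → i ≡ + 1 * i + + 0
        lem₁ = solve-∀
        lem₂ : ∀ i → + 0 * i + + 1 ≡ + 1
        lem₂ = solve-∀
        term : ∀ a → ρ (χ a) ≋ (+ 1 * a + + 0) ℤ.^ e * (+ 0 * a + + 1) ℤ.^ e
        term a = ≋-trans (ρ-χ a) (≈⇒≋ (≡.trans (cong (ℤ._^ e) (lem₁ a)) (≡.sym (≡.trans
          (cong ((+ 1 * a + + 0) ℤ.^ e *_) (≡.trans (cong (ℤ._^ e) (lem₂ a)) (ℤ.^-zeroˡ e))) (ℤ.*-identityʳ _)))))

-- Gauss and Jacobi sums through convolution

module GaussSum (e : ℕ) (pℓ : Prime (1 ℕ.+ 3 ℕ.* e)) (r : ℤ) (root : + (1 ℕ.+ 3 ℕ.* e) ∣ r * r + r + + 1) where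
  open Character e pℓ r root
  open ModZ ℓ
  open Residues ℓ
  open ≡.≡-Reasoning

  χ̄ : ℤ → 𝔼
  χ̄ a = conj (χ a)

  χ̄-periodic : Periodic χ̄
  χ̄-periodic eq = cong conj (χ-periodic eq)

  χ̄-* : ∀ a b → χ̄ (a * b) ≡ χ̄ a *ᴱ χ̄ b
  χ̄-* a b = ≡.trans (cong conj (χ-* a b)) (conj-* (χ a) (χ b))

  ∑-cong : ∀ {f g : ℤ → 𝔼} → (∀ a → f a ≡ g a) → ∑ f ≡ ∑ g
  ∑-cong eq = sum-cong-≗ {ℓ} λ i → eq (+ toℕ i)

  ∑-*ˡ : ∀ c f → ∑ (λ a → c *ᴱ f a) ≡ c *ᴱ ∑ f
  ∑-*ˡ c f = ≡.sym (*-distribˡ-sum {ℓ} c (λ i → f (+ toℕ i)))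

  -- Multiplying the argument by g permutes the residues and multiplies the sum by χ(g) ≠ 1.
  ∑χ≡0 : ∑ χ ≡ 0#
  ∑χ≡0 with nontrivial
  ... | g , χg≢1 , ℓ∤g with inverse-mod pℓ g ℓ∤g
  ...   | h , gh = *-fixed⇒0 (χ-value g) χg≢1 (∑ χ) (begin
    χ g *ᴱ ∑ χ                 ≡⟨ ∑-*ˡ (χ g) χ ⟨
    ∑ (λ a → χ g *ᴱ χ a)       ≡⟨ ∑-cong (λ a → ≡.trans (≡.sym (χ-* g a)) (cong χ (≡.sym (ℤ.+-identityʳ _)))) ⟩
    ∑ (λ a → χ (g * a + + 0))  ≡⟨ ∑-reindex χ-periodic g h (+ 0) gh ⟩
    ∑ χ                        ∎)

  ∑χ̄≡0 : ∑ χ̄ ≡ 0#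
  ∑χ̄≡0 = ≡.trans (≡.sym (sum-conj {ℓ} (λ i → χ (+ toℕ i)))) (cong conj ∑χ≡0)

  -- The unit of convolution on functions of period ℓ; applying powers of T to it stands for forming
  -- powers of the Gauss sum.
  δ : ℤ → 𝔼
  δ x with multiple? x
  ... | yes _ = 1#
  ... | no  _ = 0#

  δ-∣ : ∀ {x} → + ℓ ∣ x → δ x ≡ 1#
  δ-∣ {x} d with multiple? x
  ... | yes _ = refl
  ... | no  n = contradiction d n

  δ-∤ : ∀ {x} → ¬ (+ ℓ ∣ x) → δ x ≡ 0#
  δ-∤ {x} n with multiple? x
  ... | yes d = contradiction d n
  ... | no  _ = refl

  δ-periodic : Periodic δ
  δ-periodic {a} {b} eq with multiple? a
  ... | yes d = ≡.sym (δ-∣ (≋-∣ eq d))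
  ... | no  n = ≡.sym (δ-∤ (λ d → n (≋-∣ (≋-sym eq) d)))

  -- Convolution with χ, that is, multiplication by the Gauss sum of χ; its cube multiplies χ by ℓJ.
  T : (ℤ → 𝔼) → ℤ → 𝔼
  T f x = ∑ λ a → χ a *ᴱ f (x - a)

  T-cong : ∀ {f g} → (∀ x → f x ≡ g x) → ∀ x → T f x ≡ T g x
  T-cong eq x = ∑-cong λ a → cong (χ a *ᴱ_) (eq (x - a))

  T-scale : ∀ c f x → T (λ y → c *ᴱ f y) x ≡ c *ᴱ T f x
  T-scale c f x = ≡.trans (∑-cong (λ a → x∙yz≈y∙xz (χ a) c (f (x - a)))) (∑-*ˡ c (λ a → χ a *ᴱ f (x - a)))

  T-+ : ∀ f g x → T (λ y → f y +ᴱ g y) x ≡ T f x +ᴱ T g x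
  T-+ f g x = ≡.trans (∑-cong (λ a → E.distribˡ (χ a) (f (x - a)) (g (x - a))))
    (∑-distrib-+ {ℓ} (λ i → χ (+ toℕ i) *ᴱ f (x - + toℕ i)) (λ i → χ (+ toℕ i) *ᴱ g (x - + toℕ i)))

  T-const : ∀ c x → T (λ _ → c) x ≡ 0#
  T-const c x = ≡.trans (≡.sym (*-distribʳ-sum {ℓ} c (λ i → χ (+ toℕ i)))) (≡.trans (cong (_*ᴱ c) ∑χ≡0) (E.zeroˡ c))

  -- The scaling g is 1 when T is applied to δ, and the prime q when the sum comes from Frobenius.
  ∑-δ : ∀ g (f : ℤ → 𝔼) → ¬ (+ ℓ ∣ g) → ∑ (λ a → f a *ᴱ δ (g * a)) ≡ f (+ 0)
  ∑-δ g f ℓ∤g = begin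
    f (+ 0) *ᴱ δ (g * + 0) +ᴱ sum rest  ≡⟨ cong₂ _+ᴱ_ (cong (f (+ 0) *ᴱ_) (δ-∣ (divides (+ 0) (ℤ.*-zeroʳ g)))) rest≡0 ⟩
    f (+ 0) *ᴱ 1# +ᴱ 0#                 ≡⟨ ≡.trans (E.+-identityʳ _) (E.*-identityʳ _) ⟩
    f (+ 0)                             ∎
    where
    rest : Fin (3 ℕ.* e) → 𝔼
    rest i = f (+ suc (toℕ i)) *ᴱ δ (g * + suc (toℕ i))
    not-multiple : ∀ i → ¬ (+ ℓ ∣ g * + suc (toℕ i))
    not-multiple i d with euclidℤ pℓ g (+ suc (toℕ i)) d
    ... | inj₁ d₁ = ℓ∤g d₁
    ... | inj₂ d₂ = nonzero i d₂
    rest≡0 : sum rest ≡ 0#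
    rest≡0 = ≡.trans (sum-cong-≗ {3 ℕ.* e} (λ i → ≡.trans (cong (f (+ suc (toℕ i)) *ᴱ_) (δ-∤ (not-multiple i))) (E.zeroʳ _)))
      (sum-replicate-zero (3 ℕ.* e))

  T-δ : ∀ x → T δ x ≡ χ x
  T-δ x = begin
    ∑ (λ a → χ a *ᴱ δ (x - a))                     ≡⟨ ∑-reindex per -[1+ 0 ] -[1+ 0 ] x ≋-refl ⟨
    ∑ (λ a → f (-[1+ 0 ] * a + x))                 ≡⟨ ∑-cong (λ a → cong (λ z → χ (-[1+ 0 ] * a + x) *ᴱ δ z) (lem a x)) ⟩
    ∑ (λ a → χ (-[1+ 0 ] * a + x) *ᴱ δ (+ 1 * a))  ≡⟨ ∑-δ (+ 1) (λ a → χ (-[1+ 0 ] * a + x)) (prime∤1 pℓ) ⟩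
    χ (+ 0 + x)                                    ≡⟨ cong χ (ℤ.+-identityˡ x) ⟩
    χ x                                            ∎
    where
    f : ℤ → 𝔼
    f a = χ a *ᴱ δ (x - a)
    per : Periodic f
    per eq = cong₂ _*ᴱ_ (χ-periodic eq) (δ-periodic (≋-+ (≋-refl {x}) (≋-neg eq)))
    lem : ∀ a x → x - (-[1+ 0 ] * a + x) ≡ + 1 * a
    lem = solve-∀

  module _ {ψ : ℤ → 𝔼} (ψ-periodic : Periodic ψ) (ψ-* : ∀ a b → ψ (a * b) ≡ ψ a *ᴱ ψ b) where
    -- The substitution a ↦ xa pulls χ(x)ψ(x) out of the sum; ψ will be χ or its conjugate.
    T-nonmultiple : ∀ x → ¬ (+ ℓ ∣ x) → T ψ x ≡ (χ x *ᴱ ψ x) *ᴱ T ψ (+ 1)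
    T-nonmultiple x ℓ∤x with inverse-mod pℓ x ℓ∤x
    ... | y , xy = begin
      ∑ f                                             ≡⟨ ∑-reindex per x y (+ 0) xy ⟨
      ∑ (λ a → f (x * a + + 0))                       ≡⟨ ∑-cong term ⟩
      ∑ (λ a → (χ x *ᴱ ψ x) *ᴱ (χ a *ᴱ ψ (+ 1 - a)))  ≡⟨ ∑-*ˡ (χ x *ᴱ ψ x) (λ a → χ a *ᴱ ψ (+ 1 - a)) ⟩
      (χ x *ᴱ ψ x) *ᴱ ∑ (λ a → χ a *ᴱ ψ (+ 1 - a))    ∎
      where
      f : ℤ → 𝔼
      f a = χ a *ᴱ ψ (x - a)
      per : Periodic f
      per eq = cong₂ _*ᴱ_ (χ-periodic eq) (ψ-periodic (≋-+ (≋-refl {x}) (≋-neg eq)))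
      lem₂ : ∀ x a → x - (x * a + + 0) ≡ x * (+ 1 - a)
      lem₂ = solve-∀
      term : ∀ a → f (x * a + + 0) ≡ (χ x *ᴱ ψ x) *ᴱ (χ a *ᴱ ψ (+ 1 - a))
      term a = ≡.trans (cong₂ _*ᴱ_ (≡.trans (cong χ (ℤ.+-identityʳ (x * a))) (χ-* x a))
          (≡.trans (cong ψ (lem₂ x a)) (ψ-* x (+ 1 - a))))
        (interchange (χ x) (χ a) (ψ x) (ψ (+ 1 - a)))

    T-multiple : ψ -[1+ 0 ] ≡ 1# → ∀ x → + ℓ ∣ x → T ψ x ≡ ∑ (λ a → χ a *ᴱ ψ a)
    T-multiple ψ-neg1 x d = ∑-cong λ a → cong (χ a *ᴱ_) (begin
      ψ (x - a)          ≡⟨ ψ-periodic (≋-+ (∣⇒≋0 d) (≋-refl { - a})) ⟩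
      ψ (+ 0 - a)        ≡⟨ cong ψ (lem a) ⟩
      ψ (-[1+ 0 ] * a)   ≡⟨ ψ-* -[1+ 0 ] a ⟩
      ψ -[1+ 0 ] *ᴱ ψ a  ≡⟨ cong (_*ᴱ ψ a) ψ-neg1 ⟩
      1# *ᴱ ψ a          ≡⟨ E.*-identityˡ (ψ a) ⟩
      ψ a                ∎)
      where
      lem : ∀ a → + 0 - a ≡ -[1+ 0 ] * a
      lem = solve-∀

  -- In terms of Gauss sums, g(χ)² = J g(χ̄). Off the multiples of ℓ it is homogeneity together with
  -- χ² = χ̄; on them both sides vanish by orthogonality.
  T-χ : ∀ x → T χ x ≡ J *ᴱ χ̄ x
  T-χ x with multiple? x
  ... | no ℓ∤x = ≡.trans (T-nonmultiple χ-periodic χ-* x ℓ∤x) (≡.trans (cong (_*ᴱ J) (square≡conj (χ-value x))) (E.*-comm (χ̄ x) J))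
  ... | yes ℓ∣x = begin
    T χ x                 ≡⟨ T-multiple χ-periodic χ-* χ-neg1 x ℓ∣x ⟩
    ∑ (λ a → χ a *ᴱ χ a)  ≡⟨ ∑-cong (λ a → square≡conj (χ-value a)) ⟩
    ∑ χ̄                  ≡⟨ ∑χ̄≡0 ⟩
    0#                    ≡⟨ E.zeroʳ J ⟨
    J *ᴱ 0#               ≡⟨ cong (λ z → J *ᴱ conj z) (χ-multiple ℓ∣x) ⟨
    J *ᴱ χ̄ x             ∎

  T-χ̄-multiple : ∀ x → + ℓ ∣ x → T χ̄ x ≡ ι (+ (3 ℕ.* e))
  T-χ̄-multiple x ℓ∣x = begin
    T χ̄ x  ≡⟨ T-multiple χ̄-periodic χ̄-* (cong conj χ-neg1) x ℓ∣x ⟩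
    χ (+ 0) *ᴱ χ̄ (+ 0) +ᴱ sum (λ (i : Fin (3 ℕ.* e)) → χ (+ suc (toℕ i)) *ᴱ χ̄ (+ suc (toℕ i)))
      ≡⟨ cong₂ _+ᴱ_ (cong (_*ᴱ χ̄ (+ 0)) (χ-multiple (divides (+ 0) refl)))
                   (≡.trans (sum-cong-≗ {3 ℕ.* e} (λ i → *-conj-unit (χ-value (+ suc (toℕ i))) (χ≢0 (nonzero i))))
                       (sum-const-1 (3 ℕ.* e))) ⟩
    0# *ᴱ χ̄ (+ 0) +ᴱ ι (+ (3 ℕ.* e))  ≡⟨ ≡.trans (cong (_+ᴱ ι (+ (3 ℕ.* e))) (E.zeroˡ (χ̄ (+ 0)))) (E.+-identityˡ _) ⟩
    ι (+ (3 ℕ.* e))                    ∎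

  T-χ̄-nonmultiple : ∀ x → ¬ (+ ℓ ∣ x) → T χ̄ x ≡ T χ̄ (+ 1)
  T-χ̄-nonmultiple x ℓ∤x = ≡.trans (T-nonmultiple χ̄-periodic χ̄-* x ℓ∤x)
    (≡.trans (cong (_*ᴱ T χ̄ (+ 1)) (*-conj-unit (χ-value x) (χ≢0 ℓ∤x))) (E.*-identityˡ _))

  ∑-T-χ̄ : ∑ (T χ̄) ≡ 0#
  ∑-T-χ̄ = begin
    ∑ (λ x → ∑ λ a → χ a *ᴱ χ̄ (x - a))  ≡⟨ ∑-comm {ℓ} {ℓ} (λ i j → χ (+ toℕ j) *ᴱ χ̄ (+ toℕ i - + toℕ j)) ⟩
    ∑ (λ a → ∑ λ x → χ a *ᴱ χ̄ (x - a))  ≡⟨ ∑-cong inner ⟩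
    ∑ (λ _ → 0#)                         ≡⟨ sum-replicate-zero ℓ ⟩
    0#                                   ∎
    where
    inner : ∀ a → ∑ (λ x → χ a *ᴱ χ̄ (x - a)) ≡ 0#
    inner a = begin
      ∑ (λ x → χ a *ᴱ χ̄ (x - a))        ≡⟨ ∑-*ˡ (χ a) (λ x → χ̄ (x - a)) ⟩
      χ a *ᴱ ∑ (λ x → χ̄ (x - a))        ≡⟨ cong (χ a *ᴱ_) (∑-cong λ x → cong (λ z → χ̄ (z - a)) (≡.sym (ℤ.*-identityˡ x))) ⟩
      χ a *ᴱ ∑ (λ x → χ̄ (+ 1 * x - a))  ≡⟨ cong (χ a *ᴱ_) (∑-reindex χ̄-periodic (+ 1) (+ 1) (- a) ≋-refl) ⟩
      χ a *ᴱ ∑ χ̄                        ≡⟨ ≡.trans (cong (χ a *ᴱ_) ∑χ̄≡0) (E.zeroʳ (χ a)) ⟩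
      0#                                 ∎

  -- The function T χ̄ has total 0, the value ℓ - 1 at 0 and a constant value K elsewhere, so (ℓ -
  -- 1)(1 + K) = 0.
  T-χ̄-1 : T χ̄ (+ 1) ≡ -ᴱ 1#
  T-χ̄-1 = inverseʳ-unique 1# K (ι-cancel (+ (3 ℕ.* e)) nonzero-3e (begin
      ι (+ (3 ℕ.* e)) *ᴱ (1# +ᴱ K)                   ≡⟨ E.distribˡ (ι (+ (3 ℕ.* e))) 1# K ⟩
      ι (+ (3 ℕ.* e)) *ᴱ 1# +ᴱ ι (+ (3 ℕ.* e)) *ᴱ K  ≡⟨ cong₂ _+ᴱ_ (≡.sym (E.*-identityʳ (ι (+ (3 ℕ.* e))))) tail ⟨
      ι (+ (3 ℕ.* e)) +ᴱ sum (λ (i : Fin (3 ℕ.* e)) → T χ̄ (+ suc (toℕ i)))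
        ≡⟨ cong (_+ᴱ sum (λ (i : Fin (3 ℕ.* e)) → T χ̄ (+ suc (toℕ i)))) (T-χ̄-multiple (+ 0) (divides (+ 0) refl)) ⟨
      ∑ (T χ̄)               ≡⟨ ∑-T-χ̄ ⟩
      0#                     ≡⟨ E.zeroʳ (ι (+ (3 ℕ.* e))) ⟨
      ι (+ (3 ℕ.* e)) *ᴱ 0#  ∎))
    where
    open import Algebra.Properties.Group E.+-group using (inverseʳ-unique)
    K = T χ̄ (+ 1)
    tail : sum (λ (i : Fin (3 ℕ.* e)) → T χ̄ (+ suc (toℕ i))) ≡ ι (+ (3 ℕ.* e)) *ᴱ K
    tail = ≡.trans (sum-cong-≗ {3 ℕ.* e} (λ i → ≡.trans (T-χ̄-nonmultiple _ (nonzero i)) (≡.sym (E.*-identityˡ K))))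
      (≡.trans (≡.sym (*-distribʳ-sum {3 ℕ.* e} K (λ _ → 1#))) (cong (_*ᴱ K) (sum-const-1 (3 ℕ.* e))))
    nonzero-3e : + (3 ℕ.* e) ≢ + 0
    nonzero-3e eq = contradiction (ℕ.≤-trans e>0 (ℕ.m≤m+n e _)) (λ lt → ℕ.<⇒≢ lt (≡.sym (ℤ.+-injective eq)))

  -- The analogue of g(χ)g(χ̄) = ℓ. The extra constant -1 is harmless, since T annihilates
  -- constants.
  T-χ̄ : ∀ x → T χ̄ x ≡ ι (+ ℓ) *ᴱ δ x +ᴱ -ᴱ 1#
  T-χ̄ x with multiple? x
  ... | yes ℓ∣x = ≡.trans (T-χ̄-multiple x ℓ∣x) (≡.sym (cong (_+ᴱ -ᴱ 1#) (E.*-identityʳ (ι (+ ℓ)))))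
  ... | no  ℓ∤x = ≡.trans (T-χ̄-nonmultiple x ℓ∤x) (≡.trans T-χ̄-1 (≡.sym (≡.trans (cong (_+ᴱ -ᴱ 1#) (E.zeroʳ (ι (+ ℓ)))) refl)))

  T-spike : ∀ x → T (λ y → ι (+ ℓ) *ᴱ δ y +ᴱ -ᴱ 1#) x ≡ ι (+ ℓ) *ᴱ χ x
  T-spike x = begin
    T (λ y → ι (+ ℓ) *ᴱ δ y +ᴱ -ᴱ 1#) x              ≡⟨ T-+ (λ y → ι (+ ℓ) *ᴱ δ y) (λ _ → -ᴱ 1#) x ⟩
    T (λ y → ι (+ ℓ) *ᴱ δ y) x +ᴱ T (λ _ → -ᴱ 1#) x  ≡⟨ cong₂ _+ᴱ_ (T-scale (ι (+ ℓ)) δ x) (T-const (-ᴱ 1#) x) ⟩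
    ι (+ ℓ) *ᴱ T δ x +ᴱ 0#                           ≡⟨ E.+-identityʳ _ ⟩
    ι (+ ℓ) *ᴱ T δ x                                 ≡⟨ cong (ι (+ ℓ) *ᴱ_) (T-δ x) ⟩
    ι (+ ℓ) *ᴱ χ x                                   ∎

  Jℓ : 𝔼
  Jℓ = J *ᴱ ι (+ ℓ)

  T³-χ : ∀ x → T (T (T χ)) x ≡ Jℓ *ᴱ χ x
  T³-χ x = begin
    T (T (T χ)) x              ≡⟨ T-cong (T-cong T-χ) x ⟩
    T (T (λ y → J *ᴱ χ̄ y)) x  ≡⟨ T-cong (T-scale J χ̄) x ⟩
    T (λ y → J *ᴱ T χ̄ y) x    ≡⟨ T-scale J (T χ̄) x ⟩
    J *ᴱ T (T χ̄) x            ≡⟨ cong (J *ᴱ_) (≡.trans (T-cong T-χ̄ x) (T-spike x)) ⟩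
    J *ᴱ (ι (+ ℓ) *ᴱ χ x)      ≡⟨ E.*-assoc J (ι (+ ℓ)) (χ x) ⟨
    Jℓ *ᴱ χ x                  ∎

  T̄ : (ℤ → 𝔼) → ℤ → 𝔼
  T̄ f x = ∑ λ a → χ̄ a *ᴱ f (x - a)

  T̄-conj : ∀ f x → T̄ (λ y → conj (f y)) x ≡ conj (T f x)
  T̄-conj f x = ≡.trans (∑-cong λ a → ≡.sym (conj-* (χ a) (f (x - a))))
      (≡.sym (sum-conj {ℓ} (λ i → χ (+ toℕ i) *ᴱ f (x - + toℕ i))))

  T-T̄-comm : ∀ f x → T (T̄ f) x ≡ T̄ (T f) x
  T-T̄-comm f x = begin
    ∑ (λ a → χ a *ᴱ ∑ (λ b → χ̄ b *ᴱ f (x - a - b)))  ≡⟨ ∑-cong (λ a → ≡.sym (∑-*ˡ (χ a) (λ b → χ̄ b *ᴱ f (x - a - b)))) ⟩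
    ∑ (λ a → ∑ (λ b → χ a *ᴱ (χ̄ b *ᴱ f (x - a - b))))
      ≡⟨ ∑-comm {ℓ} {ℓ} (λ i j → χ (+ toℕ i) *ᴱ (χ̄ (+ toℕ j) *ᴱ f (x - + toℕ i - + toℕ j))) ⟩
    ∑ (λ b → ∑ (λ a → χ a *ᴱ (χ̄ b *ᴱ f (x - a - b))))
      ≡⟨ ∑-cong (λ b → ∑-cong λ a → ≡.trans (x∙yz≈y∙xz (χ a) (χ̄ b) _) (cong (λ z → χ̄ b *ᴱ (χ a *ᴱ f z)) (lem x a b))) ⟩
    ∑ (λ b → ∑ (λ a → χ̄ b *ᴱ (χ a *ᴱ f (x - b - a))))  ≡⟨ ∑-cong (λ b → ∑-*ˡ (χ̄ b) (λ a → χ a *ᴱ f (x - b - a))) ⟩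
    ∑ (λ b → χ̄ b *ᴱ ∑ (λ a → χ a *ᴱ f (x - b - a)))    ∎
    where
    lem : ∀ x a b → x - a - b ≡ x - b - a
    lem = solve-∀

  -- Convolve χ with both χ and χ̄ and evaluate at 1. Taking χ̄ first gives ℓδ - 1 and then ℓ;
  -- taking χ first gives Jχ̄ and then J times its conjugate.
  J*J̄ : J *ᴱ conj J ≡ ι (+ ℓ)
  J*J̄ = ≡.sym (begin
    ι (+ ℓ)                                  ≡⟨ E.*-identityʳ _ ⟨
    ι (+ ℓ) *ᴱ 1#                            ≡⟨ cong (ι (+ ℓ) *ᴱ_) χ-1 ⟨
    ι (+ ℓ) *ᴱ χ (+ 1)                       ≡⟨ T-spike (+ 1) ⟨
    T (λ y → ι (+ ℓ) *ᴱ δ y +ᴱ -ᴱ 1#) (+ 1)  ≡⟨ T-cong T̄χ (+ 1) ⟨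
    T (T̄ χ) (+ 1)                           ≡⟨ T-T̄-comm χ (+ 1) ⟩
    T̄ (T χ) (+ 1)                           ≡⟨ ∑-cong (λ a → cong (χ̄ a *ᴱ_) (T-χ (+ 1 - a))) ⟩
    ∑ (λ a → χ̄ a *ᴱ (J *ᴱ χ̄ (+ 1 - a)))    ≡⟨ ∑-cong (λ a → x∙yz≈y∙xz (χ̄ a) J (χ̄ (+ 1 - a))) ⟩
    ∑ (λ a → J *ᴱ (χ̄ a *ᴱ χ̄ (+ 1 - a)))    ≡⟨ ∑-*ˡ J (λ a → χ̄ a *ᴱ χ̄ (+ 1 - a)) ⟩
    J *ᴱ T̄ χ̄ (+ 1)                         ≡⟨ cong (J *ᴱ_) (T̄-conj χ (+ 1)) ⟩
    J *ᴱ conj J                              ∎)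
    where
    conj-δ : ∀ y → conj (δ y) ≡ δ y
    conj-δ y with multiple? y
    ... | yes _ = refl
    ... | no  _ = refl
    T̄χ : ∀ y → T̄ χ y ≡ ι (+ ℓ) *ᴱ δ y +ᴱ -ᴱ 1#
    T̄χ y = begin
      T̄ χ y                                 ≡⟨ ∑-cong (λ a → cong (χ̄ a *ᴱ_) (≡.sym (conj-conj (χ (y - a))))) ⟩
      T̄ (λ z → conj (χ̄ z)) y               ≡⟨ T̄-conj χ̄ y ⟩
      conj (T χ̄ y)                          ≡⟨ cong conj (T-χ̄ y) ⟩
      conj (ι (+ ℓ) *ᴱ δ y +ᴱ -ᴱ 1#)         ≡⟨ conj-+ (ι (+ ℓ) *ᴱ δ y) (-ᴱ 1#) ⟩
      conj (ι (+ ℓ) *ᴱ δ y) +ᴱ -ᴱ 1#         ≡⟨ cong (_+ᴱ -ᴱ 1#) (conj-* (ι (+ ℓ)) (δ y)) ⟩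
      conj (ι (+ ℓ)) *ᴱ conj (δ y) +ᴱ -ᴱ 1#  ≡⟨ cong₂ (λ u v → u *ᴱ v +ᴱ -ᴱ 1#) (conj-ι (+ ℓ)) (conj-δ y) ⟩
      ι (+ ℓ) *ᴱ δ y +ᴱ -ᴱ 1#                ∎

  iterate : ℕ → (ℤ → 𝔼) → ℤ → 𝔼
  iterate zero    f = f
  iterate (suc n) f = T (iterate n f)

  -- T³ is multiplication by `Jℓ` on χ = Tδ but not on δ, so the exponents counted are those of the
  -- form 1 + 3k.
  iterate-δ : ∀ k x → iterate (1 ℕ.+ 3 ℕ.* k) δ x ≡ Jℓ ^ k *ᴱ χ x
  iterate-δ zero    x = ≡.trans (T-δ x) (≡.sym (E.*-identityˡ (χ x)))
  iterate-δ (suc k) x = begin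
    iterate (1 ℕ.+ 3 ℕ.* suc k) δ x          ≡⟨ cong (λ n → iterate (1 ℕ.+ n) δ x) (ℕ.*-suc 3 k) ⟩
    T (T (T (iterate (1 ℕ.+ 3 ℕ.* k) δ))) x  ≡⟨ T-cong (T-cong (T-cong (iterate-δ k))) x ⟩
    T (T (T (λ y → Jℓ ^ k *ᴱ χ y))) x        ≡⟨ T-cong (T-cong (T-scale (Jℓ ^ k) χ)) x ⟩
    T (T (λ y → Jℓ ^ k *ᴱ T χ y)) x          ≡⟨ T-cong (T-scale (Jℓ ^ k) (T χ)) x ⟩
    T (λ y → Jℓ ^ k *ᴱ T (T χ) y) x          ≡⟨ T-scale (Jℓ ^ k) (T (T χ)) x ⟩
    Jℓ ^ k *ᴱ T (T (T χ)) x                  ≡⟨ cong (Jℓ ^ k *ᴱ_) (T³-χ x) ⟩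
    Jℓ ^ k *ᴱ (Jℓ *ᴱ χ x)                    ≡⟨ ≡.trans (x∙yz≈y∙xz (Jℓ ^ k) Jℓ (χ x)) (≡.sym (E.*-assoc Jℓ (Jℓ ^ k) (χ x))) ⟩
    Jℓ ^ suc k *ᴱ χ x                        ∎

  iterate-δ′ : ∀ k x → iterate (2 ℕ.+ 3 ℕ.* k) δ x ≡ Jℓ ^ k *ᴱ (J *ᴱ χ̄ x)
  iterate-δ′ k x = ≡.trans (T-cong (iterate-δ k) x) (≡.trans (T-scale (Jℓ ^ k) χ x) (cong (Jℓ ^ k *ᴱ_) (T-χ x)))

-- Cubic reciprocity for Jacobi sums

module CubicReciprocity (e : ℕ) (pℓ : Prime (1 ℕ.+ 3 ℕ.* e)) (r : ℤ) (root : + (1 ℕ.+ 3 ℕ.* e) ∣ r * r + r + + 1) where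
  open Character e pℓ r root
  open GaussSum e pℓ r root
  open Residues ℓ
  private module Zℓ = ModZ ℓ

  module _ {q : ℕ} (pq : Prime q) where
    private module Q = ModE q
    open Endomorphisms (Pointwise.commutativeMonoid ℤ Q.+-monoid)
    open import Algebra.Properties.Semiring.Exp semiring using () renaming (_^_ to _^ˢ_)
    open import Algebra.Properties.Semiring.Sum semiring using () renaming (sum to sumˢ)
    open Frobenius semiring

    -- One summand χ(a)ζ^a of the Gauss sum, with translation by a in the role of ζ^a. These
    -- operators commute, and their sum over residues is T.
    shift : ℤ → End
    shift a = record
      { apply = λ f x → χ a *ᴱ f (x - a)
      ; a-cong = λ eq x → Q.≋-* (Q.≋-refl {χ a}) (eq (x - a))
      ; a-⊕ = λ f g x → Q.≈⇒≋ (E.distribˡ (χ a) (f (x - a)) (g (x - a)))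
      ; a-0 = λ x → Q.≈⇒≋ (E.zeroʳ (χ a)) }

    shift-comm : ∀ a b (f : ℤ → 𝔼) x → χ a *ᴱ (χ b *ᴱ f (x - a - b)) ≡ χ b *ᴱ (χ a *ᴱ f (x - b - a))
    shift-comm a b f x = ≡.trans (x∙yz≈y∙xz (χ a) (χ b) _) (cong (λ z → χ b *ᴱ (χ a *ᴱ f z)) (lem x a b))
      where
      lem : ∀ x a b → x - a - b ≡ x - b - a
      lem = solve-∀

    shift^ : ∀ a n f x → apply (shift a ^ˢ n) f x ≡ χ a ^ n *ᴱ f (x - + n * a)
    shift^ a zero    f x = ≡.trans (cong f (lem x a)) (≡.sym (E.*-identityˡ _))
      where
      lem : ∀ x a → x ≡ x - + 0 * a
      lem = solve-∀
    shift^ a (suc n) f x = ≡.trans (cong (χ a *ᴱ_) (≡.trans (shift^ a n f (x - a)) (cong (λ z → χ a ^ n *ᴱ f z) (lem x a (+ n)))))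
      (≡.sym (E.*-assoc (χ a) (χ a ^ n) _))
      where
      lem : ∀ x a n → x - a - n * a ≡ x - (+ 1 + n) * a
      lem = solve-∀

    shifts : Vector End ℓ
    shifts i = shift (+ toℕ i)

    apply-shifts : ∀ f x → apply (sumˢ shifts) f x Q.≋ T f x
    apply-shifts f x = Q.≋-trans (apply-sum shifts f x) (Q.≈⇒≋ (pointwise-sum Q.+-monoid (λ i → apply (shifts i) f) x))

    apply-^ : ∀ (u : End) → (∀ f x → apply u f x Q.≋ T f x) → ∀ n f x → apply (u ^ˢ n) f x Q.≋ iterate n f x
    apply-^ u u≋T zero    f x = Q.≋-refl
    apply-^ u u≋T (suc n) f x = Q.≋-trans (a-cong u (apply-^ u u≋T n f) x) (u≋T (iterate n f) x)

    -- The operator form of g^q ≡ ∑ χ(a)^q ζ^(qa) modulo q: the q-th power of a sum of commuting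
    -- operators is the sum of their q-th powers.
    iterate-prime : ∀ f x → iterate q f x Q.≋ ∑ λ a → χ a ^ q *ᴱ f (x - + q * a)
    iterate-prime f x = Q.≋-trans (Q.≋-sym (apply-^ (sumˢ shifts) apply-shifts q f x))
      (Q.≋-trans (frobenius-sum pq hasCharᴱ shifts (λ i j g y → Q.≈⇒≋ (shift-comm (+ toℕ i) (+ toℕ j) g y)) f x)
      (Q.≋-trans (apply-sum (λ i → shifts i ^ˢ q) f x)
      (Q.≈⇒≋ (≡.trans (pointwise-sum Q.+-monoid (λ i → apply (shifts i ^ˢ q) f) x) (sum-cong-≗ {ℓ} λ i → shift^ (+ toℕ i) q f x)))))
      where
      hasCharᴱ : HasChar q
      hasCharᴱ = End-hasChar {q} λ f x → Q.≋-trans (Q.≈⇒≋ (pointwise-× Q.+-monoid q f x)) (Q.hasChar (f x))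

    -- Only a ≡ 1 contributes to the sum at x = q.
    iterate-δ-prime : ¬ (+ ℓ ∣ + q) → iterate q δ (+ q) Q.≋ 1#
    iterate-δ-prime ℓ∤q = Q.≋-trans (iterate-prime δ (+ q)) (Q.≈⇒≋ (begin
      ∑ f  ≡⟨ ∑-reindex per -[1+ 0 ] -[1+ 0 ] (+ 1) Zℓ.≋-refl ⟨
      ∑ (λ a → f (-[1+ 0 ] * a + + 1))
        ≡⟨ ∑-cong (λ a → cong (λ z → χ (-[1+ 0 ] * a + + 1) ^ q *ᴱ δ z) (lem (+ q) a)) ⟩
      ∑ (λ a → χ (-[1+ 0 ] * a + + 1) ^ q *ᴱ δ (+ q * a))  ≡⟨ ∑-δ (+ q) (λ a → χ (-[1+ 0 ] * a + + 1) ^ q) ℓ∤q ⟩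
      χ (+ 1) ^ q                                          ≡⟨ cong (_^ q) χ-1 ⟩
      1# ^ q                                               ≡⟨ 1^ q ⟩
      1#                                                   ∎))
      where
      open ≡.≡-Reasoning
      f : ℤ → 𝔼
      f a = χ a ^ q *ᴱ δ (+ q - + q * a)
      per : Periodic f
      per {a} {b} eq = cong₂ _*ᴱ_ (cong (_^ q) (χ-periodic eq)) (δ-periodic
          (Zℓ.≋-+ (Zℓ.≋-refl {+ q}) (Zℓ.≋-neg (Zℓ.≋-* (Zℓ.≋-refl {+ q}) eq))))
      lem : ∀ q a → q - q * (-[1+ 0 ] * a + + 1) ≡ q * a
      lem = solve-∀

  norm-J : norm J ≡ + ℓ
  norm-J = cong re (≡.trans (≡.sym (*-conj J)) J*J̄)

  -- This is Frobenius at q = 3. At 3 the function T³δ = J(ℓδ - 1) takes the value -J because ℓ does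
  -- not divide 3, and Frobenius says that this value is 1 modulo 3.
  J≋-1-mod3 : let open ModE 3 in J ≋ -ᴱ 1#
  J≋-1-mod3 = ≋-trans (≈⇒≋ (≡.sym (⁻¹-involutive J))) (≋-neg (≋-trans (≈⇒≋ (≡.sym T³δ)) (iterate-δ-prime prime[3] ℓ∤3)))
    where
    open ModE 3
    open import Algebra.Properties.Group E.+-group using (⁻¹-involutive)
    open import Algebra.Properties.Ring E.ring using (-1*x≈-x)
    open ≡.≡-Reasoning
    T³δ : iterate 3 δ (+ 3) ≡ -ᴱ J
    T³δ = begin
      T (T (T δ)) (+ 3)                   ≡⟨ T-cong (T-cong T-δ) (+ 3) ⟩
      T (T χ) (+ 3)                       ≡⟨ T-cong T-χ (+ 3) ⟩
      T (λ y → J *ᴱ χ̄ y) (+ 3)           ≡⟨ T-scale J χ̄ (+ 3) ⟩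
      J *ᴱ T χ̄ (+ 3)                     ≡⟨ cong (J *ᴱ_) (T-χ̄ (+ 3)) ⟩
      J *ᴱ (ι (+ ℓ) *ᴱ δ (+ 3) +ᴱ -ᴱ 1#)  ≡⟨ cong (λ z → J *ᴱ (ι (+ ℓ) *ᴱ z +ᴱ -ᴱ 1#)) (δ-∤ ℓ∤3) ⟩
      J *ᴱ (ι (+ ℓ) *ᴱ 0# +ᴱ -ᴱ 1#)       ≡⟨ cong (λ z → J *ᴱ (z +ᴱ -ᴱ 1#)) (E.zeroʳ (ι (+ ℓ))) ⟩
      J *ᴱ (-ᴱ 1#)                        ≡⟨ E.*-comm J (-ᴱ 1#) ⟩
      (-ᴱ 1#) *ᴱ J                        ≡⟨ -1*x≈-x J ⟩
      -ᴱ J                                ∎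

  ℓ∤prime : ∀ {q} → Prime q → ¬ (+ q ∣ + ℓ) → ¬ (+ ℓ ∣ + q)
  ℓ∤prime pq q∤ℓ d = q∤ℓ (subst (λ z → + z ∣ + ℓ) (primes-≡ pℓ pq d) ℤD.∣-refl)

  Jℓ^ : ∀ k → Jℓ ^ k ≡ J ^ k *ᴱ (J ^ k *ᴱ conj J ^ k)
  Jℓ^ k = ≡.trans (cong (λ z → (J *ᴱ z) ^ k) (≡.sym J*J̄))
    (≡.trans (^-distrib-* J (J *ᴱ conj J) k) (cong (J ^ k *ᴱ_) (^-distrib-* J (conj J) k)))

  J^3k : ∀ k → J ^ (3 ℕ.* k) ≡ J ^ k *ᴱ (J ^ k *ᴱ J ^ k)
  J^3k k = ≡.trans (cong (λ z → J ^ (k ℕ.+ (k ℕ.+ z))) (ℕ.+-identityʳ k))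
    (≡.trans (^-homo-* J k (k ℕ.+ k)) (cong (J ^ k *ᴱ_) (^-homo-* J k k)))

  -- The value of T^q δ at q is `Jℓ ^ k` times χ(q), and it is 1 modulo q. Since ℓ = JJ̄,
  -- multiplying by J^(k+1) produces J^(3k+1) = J^q ≡ J, and one factor J cancels because q does not
  -- divide its norm ℓ.
  reciprocity₁ : ∀ k → Prime (1 ℕ.+ 3 ℕ.* k) → ¬ (+ (1 ℕ.+ 3 ℕ.* k) ∣ + ℓ) →
    let open ModE (1 ℕ.+ 3 ℕ.* k) in J ^ k ≋ χ (+ (1 ℕ.+ 3 ℕ.* k)) *ᴱ conj J ^ k
  reciprocity₁ k pq q∤ℓ = ≋-cancel-norm pq J (subst (λ z → ¬ (+ q ∣ z)) (≡.sym norm-J) q∤ℓ) (begin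
      J *ᴱ J ^ k                   ≈⟨ ≈⇒≋ (≡.sym (E.*-identityʳ _)) ⟩
      J *ᴱ J ^ k *ᴱ 1#             ≈⟨ ≋-* ≋-refl (≋-sym main) ⟩
      J *ᴱ J ^ k *ᴱ (Jℓ ^ k *ᴱ c)  ≈⟨ ≈⇒≋ rearrange ⟩
      J ^ q *ᴱ (c *ᴱ conj J ^ k)   ≈⟨ ≋-* (^-prime≡1 k pq J) ≋-refl ⟩
      J *ᴱ (c *ᴱ conj J ^ k)       ∎)
    where
    q = 1 ℕ.+ 3 ℕ.* k
    c = χ (+ q)
    open ModE q
    open import Relation.Binary.Reasoning.Setoid setoid
    main : Jℓ ^ k *ᴱ c ≋ 1#
    main = ≋-trans (≈⇒≋ (≡.sym (iterate-δ k (+ q)))) (iterate-δ-prime pq (ℓ∤prime pq q∤ℓ))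
    rearrange : J *ᴱ J ^ k *ᴱ (Jℓ ^ k *ᴱ c) ≡ J ^ q *ᴱ (c *ᴱ conj J ^ k)
    rearrange = ≡.trans (cong (λ z → J *ᴱ J ^ k *ᴱ (z *ᴱ c)) (Jℓ^ k)) (≡.trans
      (solve 4 (λ a b d f → (a ⊕ b) ⊕ ((b ⊕ (b ⊕ d)) ⊕ f) ⊜ (a ⊕ (b ⊕ (b ⊕ b))) ⊕ (f ⊕ d)) refl J (J ^ k) (conj J ^ k) c)
      (cong (λ z → J *ᴱ z *ᴱ (c *ᴱ conj J ^ k)) (≡.sym (J^3k k))))
      where open import Algebra.Solver.CommutativeMonoid E.*-commutativeMonoid

  -- As before, but the exponent 2 + 3k leaves Jχ̄(q) instead of χ(q), and J^q is now the conjugate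
  -- of J, so nothing has to be cancelled.
  reciprocity₂ : ∀ k → Prime (2 ℕ.+ 3 ℕ.* k) → ¬ (+ (2 ℕ.+ 3 ℕ.* k) ∣ + ℓ) →
    let open ModE (2 ℕ.+ 3 ℕ.* k) in J ^ suc k *ᴱ χ (+ (2 ℕ.+ 3 ℕ.* k)) ≋ conj J ^ suc k
  reciprocity₂ k pq q∤ℓ = begin
      J ^ suc k *ᴱ c                               ≈⟨ ≈⇒≋ (≡.sym (E.*-identityʳ _)) ⟩
      J ^ suc k *ᴱ c *ᴱ 1#                         ≈⟨ ≋-* ≋-refl (≋-sym main) ⟩
      J ^ suc k *ᴱ c *ᴱ (Jℓ ^ k *ᴱ (J *ᴱ conj c))  ≈⟨ ≈⇒≋ rearrange ⟩
      J ^ q *ᴱ (c *ᴱ conj c) *ᴱ conj J ^ k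
        ≈⟨ ≋-* (≋-* (^-prime≡2 k pq J) (≈⇒≋ (*-conj-unit (χ-value (+ q)) (χ≢0 ℓ∤q)))) ≋-refl ⟩
      conj J *ᴱ 1# *ᴱ conj J ^ k  ≈⟨ ≋-* (≈⇒≋ (E.*-identityʳ (conj J))) ≋-refl ⟩
      conj J ^ suc k              ∎
    where
    q = 2 ℕ.+ 3 ℕ.* k
    c = χ (+ q)
    open ModE q
    open import Relation.Binary.Reasoning.Setoid setoid
    ℓ∤q : ¬ (+ ℓ ∣ + q)
    ℓ∤q = ℓ∤prime pq q∤ℓ
    main : Jℓ ^ k *ᴱ (J *ᴱ conj c) ≋ 1#
    main = ≋-trans (≈⇒≋ (≡.sym (iterate-δ′ k (+ q)))) (iterate-δ-prime pq ℓ∤q)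
    rearrange : J ^ suc k *ᴱ c *ᴱ (Jℓ ^ k *ᴱ (J *ᴱ conj c)) ≡ J ^ q *ᴱ (c *ᴱ conj c) *ᴱ conj J ^ k
    rearrange = ≡.trans (cong (λ z → J ^ suc k *ᴱ c *ᴱ (z *ᴱ (J *ᴱ conj c))) (Jℓ^ k)) (≡.trans
      (solve 5 (λ a b d f g → ((a ⊕ b) ⊕ f) ⊕ ((b ⊕ (b ⊕ d)) ⊕ (a ⊕ g)) ⊜ ((a ⊕ (a ⊕ (b ⊕ (b ⊕ b)))) ⊕ (f ⊕ g)) ⊕ d) refl
        J (J ^ k) (conj J ^ k) c (conj c))
      (cong (λ z → J *ᴱ (J *ᴱ z) *ᴱ (c *ᴱ conj c) *ᴱ conj J ^ k) (≡.sym (J^3k k))))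
      where open import Algebra.Solver.CommutativeMonoid E.*-commutativeMonoid

-- The cubic symbol of a composite modulus

Primitive : 𝔼 → Set
Primitive A = ∀ {q} → Prime q → + q ∣ re A → ¬ (+ q ∣ im A)

-- The symbol modulo A, on rational integers only. Reciprocity is stated as a congruence between
-- powers of A and Ā; in this form it is multiplicative in A and passes from the factors to the
-- product.
record CubicSymbol (A : 𝔼) : Set where
  field
    χ            : ℤ → 𝔼
    χ-value      : ∀ a → CubicValue (χ a)
    χ-*          : ∀ a b → χ (a * b) ≡ χ a *ᴱ χ b
    χ-periodic   : ∀ {a b} → norm A ∣ a - b → χ a ≡ χ b
    χ≢0          : ∀ {a} → (∀ {q} → Prime q → + q ∣ norm A → ¬ (+ q ∣ a)) → χ a ≢ 0#
    reciprocity₁ : ∀ k → Prime (1 ℕ.+ 3 ℕ.* k) → ¬ (+ (1 ℕ.+ 3 ℕ.* k) ∣ norm A) →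
                   let open ModE (1 ℕ.+ 3 ℕ.* k) in A ^ k ≋ χ (+ (1 ℕ.+ 3 ℕ.* k)) *ᴱ conj A ^ k
    reciprocity₂ : ∀ k → Prime (2 ℕ.+ 3 ℕ.* k) → ¬ (+ (2 ℕ.+ 3 ℕ.* k) ∣ norm A) →
                   let open ModE (2 ℕ.+ 3 ℕ.* k) in A ^ suc k *ᴱ χ (+ (2 ℕ.+ 3 ℕ.* k)) ≋ conj A ^ suc k

-- The trivial character works because a rational number is its own conjugate. It starts the
-- induction at A = ±1.
rationalSymbol : ∀ a → CubicSymbol (ι a)
rationalSymbol a = record
  { χ = λ _ → 1#
  ; χ-value = λ _ → c1
  ; χ-* = λ _ _ → refl
  ; χ-periodic = λ _ → refl
  ; χ≢0 = λ _ ()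
  ; reciprocity₁ = λ k _ _ → let open ModE (1 ℕ.+ 3 ℕ.* k) in
      ≈⇒≋ (≡.sym (≡.trans (E.*-identityˡ _) (cong (_^ k) (conj-ι a))))
  ; reciprocity₂ = λ k _ _ → let open ModE (2 ℕ.+ 3 ℕ.* k) in
      ≈⇒≋ (≡.trans (E.*-identityʳ (ι a ^ suc k)) (cong (_^ suc k) (≡.sym (conj-ι a)))) }

nonzero-value-* : ∀ {x y} → CubicValue x → CubicValue y → x ≢ 0# → y ≢ 0# → x *ᴱ y ≢ 0#
nonzero-value-* {x} {y} c d x≢0 y≢0 xy≡0 = y≢0 (begin
  y                   ≡⟨ E.*-identityˡ y ⟨
  1# *ᴱ y             ≡⟨ cong (_*ᴱ y) (*-conj-unit c x≢0) ⟨
  x *ᴱ conj x *ᴱ y    ≡⟨ cong (_*ᴱ y) (E.*-comm x (conj x)) ⟩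
  conj x *ᴱ x *ᴱ y    ≡⟨ E.*-assoc (conj x) x y ⟩
  conj x *ᴱ (x *ᴱ y)  ≡⟨ cong (conj x *ᴱ_) xy≡0 ⟩
  conj x *ᴱ 0#        ≡⟨ E.zeroʳ (conj x) ⟩
  0#                  ∎)
  where open ≡.≡-Reasoning

productSymbol : ∀ {A B} → CubicSymbol A → CubicSymbol B → CubicSymbol (A *ᴱ B)
productSymbol {A} {B} SA SB = record
  { χ = λ a → SA.χ a *ᴱ SB.χ a
  ; χ-value = λ a → CubicValue-* (SA.χ-value a) (SB.χ-value a)
  ; χ-* = λ a b → ≡.trans (cong₂ _*ᴱ_ (SA.χ-* a b) (SB.χ-* a b)) (interchange (SA.χ a) (SA.χ b) (SB.χ a) (SB.χ b))
  ; χ-periodic = λ d → cong₂ _*ᴱ_ (SA.χ-periodic (ℤD.∣-trans A∣AB d)) (SB.χ-periodic (ℤD.∣-trans B∣AB d))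
  ; χ≢0 = λ {a} coprime → nonzero-value-* (SA.χ-value a) (SB.χ-value a)
      (SA.χ≢0 λ pq d → coprime pq (ℤD.∣-trans d A∣AB)) (SB.χ≢0 λ pq d → coprime pq (ℤD.∣-trans d B∣AB))
  ; reciprocity₁ = λ k pq q∤ → rec₁ k (SA.reciprocity₁ k pq (λ d → q∤ (ℤD.∣-trans d A∣AB)))
      (SB.reciprocity₁ k pq (λ d → q∤ (ℤD.∣-trans d B∣AB)))
  ; reciprocity₂ = λ k pq q∤ → rec₂ k (SA.reciprocity₂ k pq (λ d → q∤ (ℤD.∣-trans d A∣AB)))
      (SB.reciprocity₂ k pq (λ d → q∤ (ℤD.∣-trans d B∣AB))) }
  where
  module SA = CubicSymbol SA
  module SB = CubicSymbol SB
  A∣AB : norm A ∣ norm (A *ᴱ B)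
  A∣AB = divides (norm B) (≡.trans (norm-* A B) (ℤ.*-comm (norm A) (norm B)))
  B∣AB : norm B ∣ norm (A *ᴱ B)
  B∣AB = divides (norm A) (norm-* A B)
  conj-^-* : ∀ n → conj (A *ᴱ B) ^ n ≡ conj A ^ n *ᴱ conj B ^ n
  conj-^-* n = ≡.trans (cong (_^ n) (conj-* A B)) (^-distrib-* (conj A) (conj B) n)
  rec₁ : ∀ k → let open ModE (1 ℕ.+ 3 ℕ.* k); q = + (1 ℕ.+ 3 ℕ.* k) in
    A ^ k ≋ SA.χ q *ᴱ conj A ^ k → B ^ k ≋ SB.χ q *ᴱ conj B ^ k → (A *ᴱ B) ^ k ≋ SA.χ q *ᴱ SB.χ q *ᴱ conj (A *ᴱ B) ^ k
  rec₁ k eA eB = ≋-trans (≈⇒≋ (^-distrib-* A B k)) (≋-trans (≋-* eA eB)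
      (≈⇒≋ (≡.trans (interchange (SA.χ q) (conj A ^ k) (SB.χ q) (conj B ^ k)) (cong (SA.χ q *ᴱ SB.χ q *ᴱ_) (≡.sym (conj-^-* k))))))
    where
    open ModE (1 ℕ.+ 3 ℕ.* k)
    q = + (1 ℕ.+ 3 ℕ.* k)
  rec₂ : ∀ k → let open ModE (2 ℕ.+ 3 ℕ.* k); q = + (2 ℕ.+ 3 ℕ.* k) in
    A ^ suc k *ᴱ SA.χ q ≋ conj A ^ suc k → B ^ suc k *ᴱ SB.χ q ≋ conj B ^ suc k → (A *ᴱ B) ^ suc k *ᴱ (SA.χ q *ᴱ SB.χ q) ≋ conj
        (A *ᴱ B) ^ suc k
  rec₂ k eA eB = ≋-trans (≈⇒≋ (≡.trans (cong (_*ᴱ (SA.χ q *ᴱ SB.χ q)) (^-distrib-* A B (suc k)))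
      (interchange (A ^ suc k) (B ^ suc k) (SA.χ q) (SB.χ q))))
      (≋-trans (≋-* eA eB) (≈⇒≋ (≡.sym (conj-^-* (suc k)))))
    where
    open ModE (2 ℕ.+ 3 ℕ.* k)
    q = + (2 ℕ.+ 3 ℕ.* k)

square-+ : ∀ a → a * a ≡ + (ℤ.∣ a ∣ ℕ.* ℤ.∣ a ∣)
square-+ (+ n)    = ≡.sym (ℤ.pos-* n n)
square-+ -[1+ n ] = refl

norm-+ : ∀ x → ∃ λ n → norm x ≡ + n
norm-+ (a ⊹ b) with norm (a ⊹ b) in eq
... | + n      = n , refl
... | -[1+ n ] = contradiction (begin
  + (ℤ.∣ s ∣ ℕ.* ℤ.∣ s ∣ ℕ.+ 3 ℕ.* (ℤ.∣ b ∣ ℕ.* ℤ.∣ b ∣))  ≡⟨ ℤ.pos-+ (ℤ.∣ s ∣ ℕ.* ℤ.∣ s ∣) _ ⟩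
  + (ℤ.∣ s ∣ ℕ.* ℤ.∣ s ∣) + + (3 ℕ.* (ℤ.∣ b ∣ ℕ.* ℤ.∣ b ∣))
    ≡⟨ cong (λ z → + (ℤ.∣ s ∣ ℕ.* ℤ.∣ s ∣) + z) (ℤ.pos-* 3 (ℤ.∣ b ∣ ℕ.* ℤ.∣ b ∣)) ⟩
  + (ℤ.∣ s ∣ ℕ.* ℤ.∣ s ∣) + + 3 * + (ℤ.∣ b ∣ ℕ.* ℤ.∣ b ∣)  ≡⟨ cong₂ (λ u v → u + + 3 * v) (square-+ s) (square-+ b) ⟨
  s * s + + 3 * (b * b)                                    ≡⟨ lem a b ⟩
  + 4 * norm (a ⊹ b)                                       ≡⟨ cong (+ 4 *_) eq ⟩
  + 4 * -[1+ n ]                                           ∎) λ ()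
  where
  open ≡.≡-Reasoning
  s = + 2 * a - b
  lem : ∀ a b → (+ 2 * a - b) * (+ 2 * a - b) + + 3 * (b * b) ≡ + 4 * (a * a - a * b + b * b)
  lem = solve-∀

-- With b = 3w one has 4N = (2a - 3w)² + 27w², and 4 < 27. The condition modulo 3 thus rules out the
-- units ±ω and ±ω².
norm≡1⇒rational : ∀ a b → norm (a ⊹ b) ≡ + 1 → + 3 ∣ b → b ≡ + 0
norm≡1⇒rational a b N≡1 (divides w refl) = w≡0 (ℤ.∣ s ∣ ℕ.* ℤ.∣ s ∣) ℤ.∣ w ∣ refl (ℤ.+-injective (begin
  + (ℤ.∣ s ∣ ℕ.* ℤ.∣ s ∣ ℕ.+ 27 ℕ.* (ℤ.∣ w ∣ ℕ.* ℤ.∣ w ∣))  ≡⟨ ℤ.pos-+ (ℤ.∣ s ∣ ℕ.* ℤ.∣ s ∣) _ ⟩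
  + (ℤ.∣ s ∣ ℕ.* ℤ.∣ s ∣) + + (27 ℕ.* (ℤ.∣ w ∣ ℕ.* ℤ.∣ w ∣))
    ≡⟨ cong (λ z → + (ℤ.∣ s ∣ ℕ.* ℤ.∣ s ∣) + z) (ℤ.pos-* 27 (ℤ.∣ w ∣ ℕ.* ℤ.∣ w ∣)) ⟩
  + (ℤ.∣ s ∣ ℕ.* ℤ.∣ s ∣) + + 27 * + (ℤ.∣ w ∣ ℕ.* ℤ.∣ w ∣)  ≡⟨ cong₂ (λ u v → u + + 27 * v) (square-+ s) (square-+ w) ⟨
  s * s + + 27 * (w * w)                                    ≡⟨ lem a w ⟩
  + 4 * norm (a ⊹ w * + 3)                                  ≡⟨ cong (+ 4 *_) N≡1 ⟩
  + 4                                                       ∎))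
  where
  open ≡.≡-Reasoning
  s = + 2 * a - w * + 3
  lem : ∀ a w → (+ 2 * a - w * + 3) * (+ 2 * a - w * + 3) + + 27 * (w * w)
      ≡ + 4 * (a * a - a * (w * + 3) + (w * + 3) * (w * + 3))
  lem = solve-∀
  w≡0 : ∀ t m → ℤ.∣ w ∣ ≡ m → t ℕ.+ 27 ℕ.* (ℤ.∣ w ∣ ℕ.* ℤ.∣ w ∣) ≡ 4 → w * + 3 ≡ + 0
  w≡0 t zero    ∣w∣≡0 _ = cong (_* + 3) {w} {+ 0} (ℤ.∣i∣≡0⇒i≡0 ∣w∣≡0)
  w≡0 t (suc m) ∣w∣≡m eq rewrite ∣w∣≡m = contradiction
    (ℕ.≤-trans (ℕ.*-monoʳ-≤ 27 (ℕ.s≤s (ℕ.z≤n {m ℕ.+ m ℕ.* suc m}))) (ℕ.≤-trans (ℕ.m≤n+m _ t) (ℕ.≤-reflexive eq)))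
    (λ { (ℕ.s≤s (ℕ.s≤s (ℕ.s≤s (ℕ.s≤s ())))) })

primeDivisor : ∀ n → 1 ℕ.< n → ∃ λ q → Prime q × q ℕD.∣ n
primeDivisor n@(suc _) 1<n with factorise n
... | record { factors = [] ; isFactorisation = n≡1 } = contradiction (≡.sym n≡1) (ℕ.<⇒≢ 1<n)
... | record { factors = q ∷ qs ; isFactorisation = n≡ ; factorsPrime = pq ∷ _ } = q , pq , subst (q ℕD.∣_) (≡.sym n≡) (ℕD.m∣m*n _)

mod3 : ∀ n → (∃ λ k → n ≡ 3 ℕ.* k) ⊎ (∃ λ k → n ≡ 1 ℕ.+ 3 ℕ.* k) ⊎ (∃ λ k → n ≡ 2 ℕ.+ 3 ℕ.* k)
mod3 n with n % 3 | m≡m%n+[m/n]*n n 3 | m%n<n n 3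
... | 0 | eq | _ = inj₁ (n / 3 , ≡.trans eq (ℕ.*-comm (n / 3) 3))
... | 1 | eq | _ = inj₂ (inj₁ (n / 3 , ≡.trans eq (cong (1 ℕ.+_) (ℕ.*-comm (n / 3) 3))))
... | 2 | eq | _ = inj₂ (inj₂ (n / 3 , ≡.trans eq (cong (2 ℕ.+_) (ℕ.*-comm (n / 3) 3))))
... | suc (suc (suc _)) | _ | ℕ.s≤s (ℕ.s≤s (ℕ.s≤s ()))

prime-mod3 : ∀ {q} → Prime q → q ≢ 3 → (∃ λ k → q ≡ 1 ℕ.+ 3 ℕ.* k) ⊎ (∃ λ k → q ≡ 2 ℕ.+ 3 ℕ.* k)
prime-mod3 {q} pq q≢3 = [ (λ (k , q≡3k) → contradiction (≡.sym (primes-≡ prime[3] pq (3∣q k q≡3k))) q≢3) , (λ r → r) ]′ (mod3 q)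
  where
  3∣q : ∀ k → q ≡ 3 ℕ.* k → + 3 ∣ + q
  3∣q k q≡3k = divides (+ k) (≡.trans (cong +_ (≡.trans q≡3k (ℕ.*-comm 3 k))) (ℤ.pos-* k 3))

-- If q were 2 + 3k, then r³ ≡ 1 would give r^q ≡ r², so r² ≡ r by Fermat; with r² + r + 1 ≡ 0 this
-- forces q to divide 3. The prime 3 itself has the root r = 1.
cubeRoot⇒q≡1 : ∀ {q} → Prime q → q ≢ 3 → ∀ r → + q ∣ r * r + r + + 1 → ∃ λ k → q ≡ 1 ℕ.+ 3 ℕ.* k
cubeRoot⇒q≡1 {q} pq q≢3 r root with prime-mod3 pq q≢3
... | inj₁ q≡1 = q≡1
... | inj₂ (k , refl) = contradiction (primes-≡ pq prime[3] (subst (+ (2 ℕ.+ 3 ℕ.* k) ∣_) (lem r) q∣3)) q≢3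
  where
  open ModZ (2 ℕ.+ 3 ℕ.* k)
  r³≋1 : r ℤ.^ 3 ≋ + 1
  r³≋1 = ∣⇒≋ (subst (+ (2 ℕ.+ 3 ℕ.* k) ∣_) (lem₃ r) (ℤD.∣n⇒∣m*n (r - + 1) root))
    where
    lem₃ : ∀ r → (r - + 1) * (r * r + r + + 1) ≡ r * (r * (r * + 1)) - + 1
    lem₃ = solve-∀
  r²≋r : r * r ≋ r
  r²≋r = ≋-trans (≋-sym (≋-trans (≈⇒≋ (≡.sym (ℤ.*-assoc r r _))) (≋-trans (≋-* (≋-refl {r * r})
    (≋-trans (≈⇒≋ (≡.sym (ℤ.^-*-assoc r 3 k))) (≋-trans (≋-^ k r³≋1) (≈⇒≋ (ℤ.^-zeroˡ k))))) (≈⇒≋ (ℤ.*-identityʳ _))))) (fermat pq r)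
  -- The cofactors come from eliminating r between r² - r and r² + r + 1, whose resultant is 3.
  q∣3 : + (2 ℕ.+ 3 ℕ.* k) ∣ (r * r - r) * (+ 1 + + 2 * r) + (r * r + r + + 1) * (+ 3 - + 2 * r)
  q∣3 = ℤD.∣m∣n⇒∣m+n (ℤD.∣m⇒∣m*n (+ 1 + + 2 * r) (≋⇒∣ r²≋r)) (ℤD.∣m⇒∣m*n (+ 3 - + 2 * r) root)
  lem : ∀ r → (r * r - r) * (+ 1 + + 2 * r) + (r * r + r + + 1) * (+ 3 - + 2 * r) ≡ + 3
  lem = solve-∀

∣square⇒∣ : ∀ {q} → Prime q → ∀ a → + q ∣ a * a → + q ∣ a
∣square⇒∣ pq a d = [ (λ x → x) , (λ x → x) ]′ (euclidℤ pq a a d)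

∣norm∧∣im⇒∣re : ∀ {q} → Prime q → ∀ A → + q ∣ norm A → + q ∣ im A → + q ∣ re A
∣norm∧∣im⇒∣re {q} pq (a ⊹ b) dN db = ∣square⇒∣ pq a (subst (+ q ∣_) (lem a b) (ℤD.∣m∣n⇒∣m+n dN (ℤD.∣m⇒∣m*n (a - b) db)))
  where
  lem : ∀ a b → (a * a - a * b + b * b) + b * (a - b) ≡ a * a
  lem = solve-∀

jacobiSymbol : ∀ e (pℓ : Prime (1 ℕ.+ 3 ℕ.* e)) r (root : + (1 ℕ.+ 3 ℕ.* e) ∣ r * r + r + + 1) → CubicSymbol
    (Character.J e pℓ r root)
jacobiSymbol e pℓ r root = record
  { χ = χ
  ; χ-value = χ-value
  ; χ-* = χ-*
  ; χ-periodic = λ {a} {b} d → χ-periodic (ModZ.∣⇒≋ ℓ (subst (_∣ a - b) norm-J d))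
  ; χ≢0 = λ coprime → χ≢0 (coprime pℓ (subst (+ ℓ ∣_) (≡.sym norm-J) ℤD.∣-refl))
  ; reciprocity₁ = λ k pq q∤ → reciprocity₁ k pq (subst (λ z → ¬ (+ (1 ℕ.+ 3 ℕ.* k) ∣ z)) norm-J q∤)
  ; reciprocity₂ = λ k pq q∤ → reciprocity₂ k pq (subst (λ z → ¬ (+ (2 ℕ.+ 3 ℕ.* k) ∣ z)) norm-J q∤) }
  where
  open Character e pℓ r root
  open CubicReciprocity e pℓ r root

-- The root is r = -u/v, which makes u + vω vanish under ω ↦ r; the norm is then v²(r² + r + 1)
-- modulo q.
∃-root : ∀ {q} → Prime q → ∀ u v → + q ∣ norm (u ⊹ v) → ¬ (+ q ∣ v) → ∃ λ r → + q ∣ u + v * r × + q ∣ r * r + r + + 1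
∃-root {q} pq u v q∣N q∤v = with-inverse (inverse-mod pq v q∤v)
  where
  open ModZ q
  with-inverse : (∃ λ w → v * w ≋ + 1) → ∃ λ r → + q ∣ u + v * r × + q ∣ r * r + r + + 1
  with-inverse (w , vw≋1) = - (u * w) ,
    subst (+ q ∣_) (lem u v w) (ℤD.∣n⇒∣m*n (- u) (≋⇒∣ vw≋1)) ,
    subst (+ q ∣_) (lem′ u v w) (ℤD.∣m∣n⇒∣m+n (ℤD.∣m⇒∣m*n (w * w) q∣N) (ℤD.∣m⇒∣m*n (u * w - v * w - + 1) (≋⇒∣ vw≋1)))
    where
    lem : ∀ u v w → - u * (v * w - + 1) ≡ u + v * - (u * w)
    lem = solve-∀
    lem′ : ∀ u v w → (u * u - u * v + v * v) * (w * w) + (v * w - + 1) * (u * w - v * w - + 1)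
         ≡ - (u * w) * - (u * w) + - (u * w) + + 1
    lem′ = solve-∀

-- Both A and J vanish under ω ↦ r modulo q, so q divides A J̄.
divide-by : ∀ {q} → Prime q → ∀ {r} → + q ∣ r * r + r + + 1 → ∀ A J →
  + q ∣ re A + im A * r → + q ∣ re J + im J * r → norm J ≡ + q → ∃ λ B → A ≡ J *ᴱ B
divide-by {q} pq {r} root A@(u ⊹ v) J@(j₀ ⊹ j₁) dA dJ norm-J with re∣ | im∣
  where
  re∣ : + q ∣ u * (j₀ - j₁) - v * - j₁
  re∣ = subst (+ q ∣_) (lem u v j₀ j₁ r)
    (ℤD.∣m∣n⇒∣m+n (ℤD.∣m∣n⇒∣m+n (ℤD.∣n⇒∣m*n (j₀ - j₁) dA) (ℤD.∣n⇒∣m*n (- (v * r)) dJ)) (ℤD.∣n⇒∣m*n (v * j₁) root))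
    where
    lem : ∀ u v j₀ j₁ r → (j₀ - j₁) * (u + v * r) + - (v * r) * (j₀ + j₁ * r) + v * j₁ * (r * r + r + + 1)
        ≡ u * (j₀ - j₁) - v * - j₁
    lem = solve-∀
  im∣ : + q ∣ u * - j₁ + v * (j₀ - j₁) - v * - j₁
  im∣ = subst (+ q ∣_) (lem u v j₀ j₁ r) (ℤD.∣m∣n⇒∣m+n (ℤD.∣n⇒∣m*n (- j₁) dA) (ℤD.∣n⇒∣m*n v dJ))
    where
    lem : ∀ u v j₀ j₁ r → - j₁ * (u + v * r) + v * (j₀ + j₁ * r) ≡ u * - j₁ + v * (j₀ - j₁) - v * - j₁
    lem = solve-∀
... | divides b₀ e₀ | divides b₁ e₁ = B , ι-cancel (+ q) (λ { refl → contradiction pq λ () }) (begin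
    ι (+ q) *ᴱ A         ≡⟨ cong (λ z → ι z *ᴱ A) norm-J ⟨
    ι (norm J) *ᴱ A      ≡⟨ cong (_*ᴱ A) (*-conj J) ⟨
    J *ᴱ conj J *ᴱ A     ≡⟨ E.*-assoc J (conj J) A ⟩
    J *ᴱ (conj J *ᴱ A)   ≡⟨ cong (J *ᴱ_) (E.*-comm (conj J) A) ⟩
    J *ᴱ (A *ᴱ conj J)   ≡⟨ cong (J *ᴱ_) AJ̄ ⟩
    J *ᴱ (ι (+ q) *ᴱ B)  ≡⟨ x∙yz≈y∙xz J (ι (+ q)) B ⟩
    ι (+ q) *ᴱ (J *ᴱ B)  ∎)
  where
  open ≡.≡-Reasoning
  B = b₀ ⊹ b₁
  AJ̄ : A *ᴱ conj J ≡ ι (+ q) *ᴱ B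
  AJ̄ = ≡.trans (cong₂ _⊹_ (≡.trans e₀ (ℤ.*-comm b₀ (+ q))) (≡.trans e₁ (ℤ.*-comm b₁ (+ q)))) (≡.sym (ι-*-⊹ (+ q) B))

JacobiFactor : ℕ → 𝔼 → Set
JacobiFactor q A = ∃ λ J → ∃ λ B → CubicSymbol J × norm J ≡ + q × (let open ModE 3 in J ≋ -ᴱ 1#) × A ≡ J *ᴱ B

-- The root r is read off from A itself, so that A and the Jacobi sum formed with r vanish under the
-- same reduction. This selects J rather than its conjugate as a divisor. Primitivity keeps q from
-- dividing the ω-coordinate of A.
jacobiFactor : ∀ A → Primitive A → ¬ (+ 3 ∣ norm A) → ∀ {q} → Prime q → + q ∣ norm A → JacobiFactor q A
jacobiFactor A@(u ⊹ v) prim 3∤N {q} pq q∣N = with-root (∃-root pq u v q∣N λ q∣v → prim pq (∣norm∧∣im⇒∣re pq A q∣N q∣v) q∣v)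
  where
  with-J : ∀ {r} → + q ∣ u + v * r → + q ∣ r * r + r + + 1 → ∀ J → CubicSymbol J → norm J ≡ + q →
    (let open ModE 3 in J ≋ -ᴱ 1#) → + q ∣ re J + im J * r → JacobiFactor q A
  with-J dA root J SJ NJ J≋-1 dJ = with-B (divide-by pq root A J dA dJ NJ)
    where
    with-B : (∃ λ B → A ≡ J *ᴱ B) → JacobiFactor q A
    with-B (B , A≡JB) = J , B , SJ , NJ , J≋-1 , A≡JB
  with-e : ∀ {r} → + q ∣ u + v * r → + q ∣ r * r + r + + 1 → (∃ λ e → q ≡ 1 ℕ.+ 3 ℕ.* e) → JacobiFactor q A
  with-e {r} dA root (e , refl) = with-J {r} dA root (Character.J e pq r root) (jacobiSymbol e pq r root)
    (CubicReciprocity.norm-J e pq r root) (CubicReciprocity.J≋-1-mod3 e pq r root)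
    (ModZ.≋0⇒∣ (1 ℕ.+ 3 ℕ.* e) (Character.ρ-J e pq r root))
  with-root : (∃ λ r → + q ∣ u + v * r × + q ∣ r * r + r + + 1) → JacobiFactor q A
  with-root (r , dA , root) = with-e {r} dA root (cubeRoot⇒q≡1 pq (λ { refl → 3∤N q∣N }) r root)

3∤norm : ∀ A → + 3 ∣ im A → ¬ (+ 3 ∣ re A) → ¬ (+ 3 ∣ norm A)
3∤norm A 3∣im 3∤re d = 3∤re (∣norm∧∣im⇒∣re prime[3] A d 3∣im)

-- Induction on the norm. Since J ≡ -1 modulo 3, the cofactor B is -A modulo 3 and inherits both
-- conditions at 3; at norm 1 they leave only rational units.
cubicSymbol : ∀ A → Primitive A → + 3 ∣ im A → ¬ (+ 3 ∣ re A) → CubicSymbol A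
cubicSymbol A prim 3∣im 3∤re = <-rec P step (proj₁ (norm-+ A)) A (proj₂ (norm-+ A)) prim 3∣im 3∤re
  where
  P : ℕ → Set
  P n = ∀ A → norm A ≡ + n → Primitive A → + 3 ∣ im A → ¬ (+ 3 ∣ re A) → CubicSymbol A
  step : ∀ n → (∀ {m} → m ℕ.< n → P m) → P n
  step zero    _ A N≡0 prim 3∣im 3∤re = contradiction (subst (+ 3 ∣_) (≡.sym N≡0) (divides (+ 0) refl)) (3∤norm A 3∣im 3∤re)
  step (suc zero) _ (a ⊹ b) N≡1 prim 3∣im 3∤re with norm≡1⇒rational a b N≡1 3∣im
  ... | refl = rationalSymbol a
  step n@(suc (suc _)) IH A N≡n prim 3∣im 3∤re = result (primeDivisor n (ℕ.s≤s (ℕ.s≤s ℕ.z≤n)))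
    where
    result : (∃ λ q → Prime q × q ℕD.∣ n) → CubicSymbol A
    result (q , pq , q∣n@(ℕD.divides m n≡mq)) = result′ (jacobiFactor A prim (3∤norm A 3∣im 3∤re) pq
        (subst (+ q ∣_) (≡.sym N≡n) (ℤD.∣ᵤ⇒∣ q∣n)))
      where
      result′ : JacobiFactor q A → CubicSymbol A
      result′ (J , B , SJ , NJ , J≋-1 , A≡JB) = subst CubicSymbol (≡.sym A≡JB) (productSymbol SJ (IH m<n B NB prim-B 3∣im-B 3∤re-B))
        where
        open ModE 3
        module Z = ModZ 3
        q>1 : 1 ℕ.< q
        q>1 = ℕ.nonTrivial⇒n>1 q {{prime⇒nonTrivial pq}}
        NB : norm B ≡ + m
        NB = ℤ.*-cancelˡ-≡ (+ q) (norm B) (+ m) {{ℤ.≢-nonZero {+ q} λ { refl → contradiction q>1 λ () }}}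
          (≡.trans (cong (_* norm B) (≡.sym NJ)) (≡.trans (≡.sym (norm-* J B)) (≡.trans (cong norm (≡.sym A≡JB))
          (≡.trans N≡n (≡.trans (cong +_ (≡.trans n≡mq (ℕ.*-comm m q))) (ℤ.pos-* q m))))))
        m<n : m ℕ.< n
        m<n = lem m n≡mq
          where
          lem : ∀ m → n ≡ m ℕ.* q → m ℕ.< n
          lem zero    ()
          lem (suc m) eq = subst (suc m ℕ.<_) (≡.sym eq) (ℕ.m<m*n (suc m) q q>1)
        A≋-B : A ≋ -ᴱ B
        A≋-B = ≋-trans (≈⇒≋ A≡JB) (≋-trans (≋-* J≋-1 (≋-refl {B})) (≈⇒≋ (-1*x≈-x B)))
          where open import Algebra.Properties.Ring E.ring using (-1*x≈-x)
        re-neg : ∀ x → re (-ᴱ x) ≡ - re x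
        re-neg (a ⊹ b) = refl
        im-neg : ∀ x → im (-ᴱ x) ≡ - im x
        im-neg (a ⊹ b) = refl
        ∣-neg : ∀ {a} → + 3 ∣ - a → + 3 ∣ a
        ∣-neg {a} d = subst (+ 3 ∣_) (ℤ.neg-involutive a) (ℤD.∣m⇒∣-m d)
        3∣im-B : + 3 ∣ im B
        3∣im-B = ∣-neg (subst (+ 3 ∣_) (im-neg B) (Z.≋-∣ (im-≋ A≋-B) 3∣im))
        3∤re-B : ¬ (+ 3 ∣ re B)
        3∤re-B d = 3∤re (Z.≋-∣ (Z.≋-sym (re-≋ A≋-B)) (subst (+ 3 ∣_) (≡.sym (re-neg B)) (ℤD.∣m⇒∣-m d)))
        divides-product : ∀ {s} J B → + s ∣ re B → + s ∣ im B → (+ s ∣ re (J *ᴱ B)) × (+ s ∣ im (J *ᴱ B))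
        divides-product (a ⊹ b) (c ⊹ d) dc dd =
          ℤD.∣m∣n⇒∣m-n (ℤD.∣n⇒∣m*n a dc) (ℤD.∣n⇒∣m*n b dd) ,
          ℤD.∣m∣n⇒∣m-n (ℤD.∣m∣n⇒∣m+n (ℤD.∣n⇒∣m*n a dd) (ℤD.∣n⇒∣m*n b dc)) (ℤD.∣n⇒∣m*n b dd)
        prim-B : Primitive B
        prim-B {s} ps dre dim = prim ps (subst (λ z → + s ∣ re z) (≡.sym A≡JB) (proj₁ (divides-product J B dre dim)))
          (subst (λ z → + s ∣ im z) (≡.sym A≡JB) (proj₂ (divides-product J B dre dim)))

-- The binomial sum as a Morgan-Voyce number

foldr-applyUpTo : ∀ (f : ℕ → ℤ) (h : ℕ → ℕ) n → foldr _+_ (+ 0) (map f (applyUpTo h n)) ≡ sumTo n (f ∘ h)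
foldr-applyUpTo f h zero    = refl
foldr-applyUpTo f h (suc n) = cong (λ z → f (h 0) + z) (foldr-applyUpTo f (h ∘ suc) n)

-- The Morgan-Voyce polynomials B_n(z) = Σ C(n+k,2k) z^k and b_n(z) = Σ C(n+k+1,2k+1) z^k at z = 27.
even-term odd-term : ℕ → ℕ → ℤ
even-term n k = + ((n ℕ.+ k) C (k ℕ.+ k)) * (+ 27) ℤ.^ k
odd-term  n k = + (suc (n ℕ.+ k) C suc (k ℕ.+ k)) * (+ 27) ℤ.^ k

even-sum odd-sum : ℕ → ℤ
even-sum n = sumTo (suc n) (even-term n)
odd-sum  n = sumTo (suc n) (odd-term n)

pascal : ∀ n k → + (suc n C suc k) ≡ + (n C k) + + (n C suc k)
pascal n k = ≡.trans (cong +_ (≡.sym (nCk+nC[k+1]≡[n+1]C[k+1] n k))) (ℤ.pos-+ (n C k) (n C suc k))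

odd-term-suc : ∀ n k → odd-term (suc n) k ≡ even-term (suc n) k + odd-term n k
odd-term-suc n k = ≡.trans (cong (_* (+ 27) ℤ.^ k) (pascal (suc n ℕ.+ k) (k ℕ.+ k)))
    (ℤ.*-distribʳ-+ ((+ 27) ℤ.^ k) (+ ((suc n ℕ.+ k) C (k ℕ.+ k))) (+ ((suc n ℕ.+ k) C suc (k ℕ.+ k))))

even-term-suc : ∀ n k → even-term (suc n) (suc k) ≡ + 27 * odd-term n k + even-term n (suc k)
even-term-suc n k = begin
  + (suc (n ℕ.+ suc k) C suc (k ℕ.+ suc k)) * (+ 27 * z)  ≡⟨ cong (_* (+ 27 * z)) (pascal (n ℕ.+ suc k) (k ℕ.+ suc k)) ⟩
  (+ ((n ℕ.+ suc k) C (k ℕ.+ suc k)) + y) * (+ 27 * z)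
    ≡⟨ cong₂ (λ i j → (+ (i C j) + y) * (+ 27 * z)) (ℕ.+-suc n k) (ℕ.+-suc k k) ⟩
  (x + y) * (+ 27 * z)             ≡⟨ lem x y z ⟩
  + 27 * (x * z) + y * (+ 27 * z)  ∎
  where
  open ≡.≡-Reasoning
  z = (+ 27) ℤ.^ k
  x = + (suc (n ℕ.+ k) C suc (k ℕ.+ k))
  y = + ((n ℕ.+ suc k) C suc (k ℕ.+ suc k))
  lem : ∀ x y z → (x + y) * (+ 27 * z) ≡ + 27 * (x * z) + y * (+ 27 * z)
  lem = solve-∀

even-term-zero : ∀ n → even-term n (suc n) ≡ + 0
even-term-zero n = cong (λ i → + i * (+ 27) ℤ.^ suc n) (k>n⇒nCk≡0 {n ℕ.+ suc n} {suc n ℕ.+ suc n} (ℕ.n<1+n _))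

odd-term-zero : ∀ n → odd-term n (suc n) ≡ + 0
odd-term-zero n = cong (λ i → + i * (+ 27) ℤ.^ suc n) (k>n⇒nCk≡0 {suc (n ℕ.+ suc n)} {suc (suc n ℕ.+ suc n)} (ℕ.n<1+n _))

drop-last : ∀ n f → f n ≡ + 0 → sumTo (suc n) f ≡ sumTo n f
drop-last n f fn≡0 = ≡.trans (sumTo-last n f) (≡.trans (cong (λ z → sumTo n f + z) fn≡0) (ℤ.+-identityʳ _))

odd-sum-suc : ∀ n → odd-sum (suc n) ≡ even-sum (suc n) + odd-sum n
odd-sum-suc n = begin
  sumTo (2 ℕ.+ n) (odd-term (suc n))  ≡⟨ sumℤ-cong {2 ℕ.+ n} (odd-term-suc n ∘ toℕ) ⟩
  sumTo (2 ℕ.+ n) (λ k → even-term (suc n) k + odd-term n k)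
    ≡⟨ sumℤ-distrib-+ {2 ℕ.+ n} (even-term (suc n) ∘ toℕ) (odd-term n ∘ toℕ) ⟩
  even-sum (suc n) + sumTo (2 ℕ.+ n) (odd-term n)
    ≡⟨ cong (λ z → even-sum (suc n) + z) (drop-last (suc n) (odd-term n) (odd-term-zero n)) ⟩
  even-sum (suc n) + odd-sum n  ∎
  where open ≡.≡-Reasoning

even-sum-suc : ∀ n → even-sum (suc n) ≡ + 27 * odd-sum n + even-sum n
even-sum-suc n = begin
  + 1 + sumTo (suc n) (even-term (suc n) ∘ suc)
    ≡⟨ cong (λ z → + 1 + z) (sumℤ-cong {suc n} (even-term-suc n ∘ toℕ)) ⟩
  + 1 + sumTo (suc n) (λ k → + 27 * odd-term n k + even-term n (suc k))
    ≡⟨ cong (λ z → + 1 + z) (sumℤ-distrib-+ {suc n} (λ i → + 27 * odd-term n (toℕ i)) (λ i → even-term n (suc (toℕ i)))) ⟩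
  + 1 + (sumTo (suc n) (λ k → + 27 * odd-term n k) + sumTo (suc n) (even-term n ∘ suc))
    ≡⟨ cong (λ z → + 1 + (z + sumTo (suc n) (even-term n ∘ suc))) (≡.sym (*-distribˡ-sumℤ {suc n} (+ 27) (odd-term n ∘ toℕ))) ⟩
  + 1 + (+ 27 * odd-sum n + sumTo (suc n) (even-term n ∘ suc))  ≡⟨ lem (+ 27 * odd-sum n) (sumTo (suc n) (even-term n ∘ suc)) ⟩
  + 27 * odd-sum n + (+ 1 + sumTo (suc n) (even-term n ∘ suc))
    ≡⟨ cong (λ z → + 27 * odd-sum n + z) (drop-last (suc n) (even-term n) (even-term-zero n)) ⟩
  + 27 * odd-sum n + even-sum n  ∎
  where
  open ≡.≡-Reasoning
  lem : ∀ x y → + 1 + (x + y) ≡ x + (+ 1 + y)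
  lem = solve-∀

-- The characteristic polynomial t² - 29t + 1, with 29 = 27 + 2, has the roots ε and 1/ε.
even-sum-rec : ∀ n → even-sum (2 ℕ.+ n) ≡ + 29 * even-sum (suc n) - even-sum n
even-sum-rec n = begin
  even-sum (2 ℕ.+ n)            ≡⟨ even-sum-suc (suc n) ⟩
  + 27 * odd-sum (suc n) + b₁   ≡⟨ cong (λ z → + 27 * z + b₁) (odd-sum-suc n) ⟩
  + 27 * (b₁ + odd-sum n) + b₁  ≡⟨ lem₁ b₁ (odd-sum n) (even-sum n) ⟩
  + 28 * b₁ + (+ 27 * odd-sum n + even-sum n) - even-sum n
    ≡⟨ cong (λ z → + 28 * b₁ + z - even-sum n) (≡.sym (even-sum-suc n)) ⟩
  + 28 * b₁ + b₁ - even-sum n  ≡⟨ lem₂ b₁ (even-sum n) ⟩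
  + 29 * b₁ - even-sum n       ∎
  where
  open ≡.≡-Reasoning
  b₁ = even-sum (suc n)
  lem₁ : ∀ b c d → + 27 * (b + c) + b ≡ + 28 * b + (+ 27 * c + d) - d
  lem₁ = solve-∀
  lem₂ : ∀ b d → + 28 * b + b - d ≡ + 29 * b - d
  lem₂ = solve-∀

-- After multiplication by k!(2k)! both sides are (3k + 3)!.
C-3k-step : ∀ k → (suc k ℕ.* ((2 ℕ.* k ℕ.+ 2) ℕ.* (2 ℕ.* k ℕ.+ 1))) ℕ.* ((3 ℕ.* suc k) C suc k)
          ≡ ((3 ℕ.* k ℕ.+ 3) ℕ.* ((3 ℕ.* k ℕ.+ 2) ℕ.* (3 ℕ.* k ℕ.+ 1))) ℕ.* ((3 ℕ.* k) C k)
C-3k-step k = ℕ.*-cancelʳ-≡ _ _ (k ! ℕ.* (k ℕ.+ k) !) {{k ℕ.!* (k ℕ.+ k) !≢0}} (begin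
  (suc k ℕ.* ((2 ℕ.* k ℕ.+ 2) ℕ.* (2 ℕ.* k ℕ.+ 1))) ℕ.* ((3 ℕ.* suc k) C suc k) ℕ.* (k ! ℕ.* (k ℕ.+ k) !)
    ≡⟨ lem₁ k ((3 ℕ.* suc k) C suc k) (k !) ((k ℕ.+ k) !) ⟩
  ((3 ℕ.* suc k) C suc k) ℕ.* (suc k ! ℕ.* (suc (suc (k ℕ.+ k))) !)
    ≡⟨ cong₂ (λ i j → (i C suc k) ℕ.* (suc k ! ℕ.* j !)) (lem₃ k) (cong suc (≡.sym (ℕ.+-suc k k))) ⟩
  (((suc k ℕ.+ suc k) ℕ.+ suc k) C suc k) ℕ.* (suc k ! ℕ.* (suc k ℕ.+ suc k) !)
    ≡⟨ C-factorials (suc k ℕ.+ suc k) (suc k) ⟩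
  ((suc k ℕ.+ suc k) ℕ.+ suc k) !
    ≡⟨ cong _! (lem₄ k) ⟩
  (3 ℕ.+ ((k ℕ.+ k) ℕ.+ k)) !
    ≡⟨ cong (λ z → (3 ℕ.+ m) ℕ.* ((2 ℕ.+ m) ℕ.* ((1 ℕ.+ m) ℕ.* z))) (≡.sym (C-factorials (k ℕ.+ k) k)) ⟩
  (3 ℕ.+ m) ℕ.* ((2 ℕ.+ m) ℕ.* ((1 ℕ.+ m) ℕ.* ((m C k) ℕ.* (k ! ℕ.* (k ℕ.+ k) !))))
    ≡⟨ lem₂ k (m C k) (k !) ((k ℕ.+ k) !) ⟩
  ((3 ℕ.* k ℕ.+ 3) ℕ.* ((3 ℕ.* k ℕ.+ 2) ℕ.* (3 ℕ.* k ℕ.+ 1))) ℕ.* (m C k) ℕ.* (k ! ℕ.* (k ℕ.+ k) !)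
    ≡⟨ cong (λ i → ((3 ℕ.* k ℕ.+ 3) ℕ.* ((3 ℕ.* k ℕ.+ 2) ℕ.* (3 ℕ.* k ℕ.+ 1))) ℕ.* (i C k) ℕ.* (k ! ℕ.* (k ℕ.+ k) !)) (lem₅ k) ⟩
  ((3 ℕ.* k ℕ.+ 3) ℕ.* ((3 ℕ.* k ℕ.+ 2) ℕ.* (3 ℕ.* k ℕ.+ 1))) ℕ.* ((3 ℕ.* k) C k) ℕ.* (k ! ℕ.* (k ℕ.+ k) !)  ∎)
  where
  open ≡.≡-Reasoning
  m = k ℕ.+ k ℕ.+ k
  lem₁ : ∀ k c f g → (suc k ℕ.* ((2 ℕ.* k ℕ.+ 2) ℕ.* (2 ℕ.* k ℕ.+ 1))) ℕ.* c ℕ.* (f ℕ.* g)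
       ≡ c ℕ.* (suc k ℕ.* f ℕ.* (suc (suc (k ℕ.+ k)) ℕ.* (suc (k ℕ.+ k) ℕ.* g)))
  lem₁ = solveℕ-∀
  lem₂ : ∀ k c f g → (3 ℕ.+ (k ℕ.+ k ℕ.+ k)) ℕ.* ((2 ℕ.+ (k ℕ.+ k ℕ.+ k)) ℕ.* ((1 ℕ.+ (k ℕ.+ k ℕ.+ k)) ℕ.* (c ℕ.* (f ℕ.* g))))
       ≡ ((3 ℕ.* k ℕ.+ 3) ℕ.* ((3 ℕ.* k ℕ.+ 2) ℕ.* (3 ℕ.* k ℕ.+ 1))) ℕ.* c ℕ.* (f ℕ.* g)
  lem₂ = solveℕ-∀
  lem₃ : ∀ k → 3 ℕ.* suc k ≡ (suc k ℕ.+ suc k) ℕ.+ suc k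
  lem₃ = solveℕ-∀
  lem₄ : ∀ k → (suc k ℕ.+ suc k) ℕ.+ suc k ≡ 3 ℕ.+ ((k ℕ.+ k) ℕ.+ k)
  lem₄ = solveℕ-∀
  lem₅ : ∀ k → (k ℕ.+ k) ℕ.+ k ≡ 3 ℕ.* k
  lem₅ = solveℕ-∀

-- Here d = n - k - 1. After multiplication by (2k)!d! both sides are (n + k + 1)!.
C-n+k-step : ∀ d k → let n = suc d ℕ.+ k in
  ((2 ℕ.* k ℕ.+ 2) ℕ.* (2 ℕ.* k ℕ.+ 1)) ℕ.* ((n ℕ.+ suc k) C (suc k ℕ.+ suc k)) ≡ (suc (n ℕ.+ k) ℕ.* suc d) ℕ.*
      ((n ℕ.+ k) C (k ℕ.+ k))
C-n+k-step d k = ℕ.*-cancelʳ-≡ _ _ ((k ℕ.+ k) ! ℕ.* d !) {{(k ℕ.+ k) ℕ.!* d !≢0}} (begin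
  ((2 ℕ.* k ℕ.+ 2) ℕ.* (2 ℕ.* k ℕ.+ 1)) ℕ.* ((n ℕ.+ suc k) C (suc k ℕ.+ suc k)) ℕ.* ((k ℕ.+ k) ! ℕ.* d !)
    ≡⟨ lem₁ k ((n ℕ.+ suc k) C (suc k ℕ.+ suc k)) ((k ℕ.+ k) !) (d !) ⟩
  ((n ℕ.+ suc k) C (suc k ℕ.+ suc k)) ℕ.* (suc (suc (k ℕ.+ k)) ! ℕ.* d !)
    ≡⟨ cong₂ (λ i j → (i C (suc k ℕ.+ suc k)) ℕ.* (j ! ℕ.* d !)) (lem₃ d k) (cong suc (≡.sym (ℕ.+-suc k k))) ⟩
  ((d ℕ.+ (suc k ℕ.+ suc k)) C (suc k ℕ.+ suc k)) ℕ.* ((suc k ℕ.+ suc k) ! ℕ.* d !)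
    ≡⟨ C-factorials d (suc k ℕ.+ suc k) ⟩
  (d ℕ.+ (suc k ℕ.+ suc k)) !
    ≡⟨ cong _! (lem₄ d k) ⟩
  suc (n ℕ.+ k) !
    ≡⟨ cong (λ i → suc (n ℕ.+ k) ℕ.* i !) (lem₅ d k) ⟩
  suc (n ℕ.+ k) ℕ.* (suc d ℕ.+ (k ℕ.+ k)) !
    ≡⟨ cong (suc (n ℕ.+ k) ℕ.*_) (≡.sym (C-factorials (suc d) (k ℕ.+ k))) ⟩
  suc (n ℕ.+ k) ℕ.* (((suc d ℕ.+ (k ℕ.+ k)) C (k ℕ.+ k)) ℕ.* ((k ℕ.+ k) ! ℕ.* suc d !))
    ≡⟨ cong (λ i → suc (n ℕ.+ k) ℕ.* ((i C (k ℕ.+ k)) ℕ.* ((k ℕ.+ k) ! ℕ.* suc d !))) (≡.sym (lem₅ d k)) ⟩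
  suc (n ℕ.+ k) ℕ.* (((n ℕ.+ k) C (k ℕ.+ k)) ℕ.* ((k ℕ.+ k) ! ℕ.* suc d !))
    ≡⟨ lem₂ (suc (n ℕ.+ k)) ((n ℕ.+ k) C (k ℕ.+ k)) ((k ℕ.+ k) !) (suc d) (d !) ⟩
  (suc (n ℕ.+ k) ℕ.* suc d) ℕ.* ((n ℕ.+ k) C (k ℕ.+ k)) ℕ.* ((k ℕ.+ k) ! ℕ.* d !)  ∎)
  where
  open ≡.≡-Reasoning
  n = suc d ℕ.+ k
  lem₁ : ∀ k c f g → ((2 ℕ.* k ℕ.+ 2) ℕ.* (2 ℕ.* k ℕ.+ 1)) ℕ.* c ℕ.* (f ℕ.* g) ≡ c ℕ.*
      (suc (suc (k ℕ.+ k)) ℕ.* (suc (k ℕ.+ k) ℕ.* f) ℕ.* g)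
  lem₁ = solveℕ-∀
  lem₂ : ∀ a c f e g → a ℕ.* (c ℕ.* (f ℕ.* (e ℕ.* g))) ≡ (a ℕ.* e) ℕ.* c ℕ.* (f ℕ.* g)
  lem₂ = solveℕ-∀
  lem₃ : ∀ d k → (suc d ℕ.+ k) ℕ.+ suc k ≡ d ℕ.+ (suc k ℕ.+ suc k)
  lem₃ = solveℕ-∀
  lem₄ : ∀ d k → d ℕ.+ (suc k ℕ.+ suc k) ≡ suc ((suc d ℕ.+ k) ℕ.+ k)
  lem₄ = solveℕ-∀
  lem₅ : ∀ d k → (suc d ℕ.+ k) ℕ.+ k ≡ suc d ℕ.+ (k ℕ.+ k)
  lem₅ = solveℕ-∀

S-term : ℕ → ℤ
S-term k = (+ ((3 ℕ.* k) C k)) * (ℤ.-1ℤ ℤ.^ k)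

pos-product : ∀ a b c → + (a ℕ.* (b ℕ.* c)) ≡ + a * (+ b * + c)
pos-product a b c = ≡.trans (ℤ.pos-* a (b ℕ.* c)) (cong (λ z → + a * z) (ℤ.pos-* b c))

module _ (n : ℕ) {p : ℕ} (pp : Prime p) (p≡ : p ≡ 1 ℕ.+ 3 ℕ.* n ⊎ p ≡ 2 ℕ.+ 3 ℕ.* n) where
  open ModZ p

  -- With n ≡ −1/3 or n ≡ −2/3 modulo p.
  9[n+k+1][n-k] : ∀ d k → n ≡ suc d ℕ.+ k →
    + p ∣ + 9 * + (suc (n ℕ.+ k) ℕ.* suc d) + (+ 3 * + k + + 1) * (+ 3 * + k + + 2)
  9[n+k+1][n-k] d k refl = subst (+ p ∣_) (cong (λ z → + 9 * z + (+ 3 * + k + + 1) * (+ 3 * + k + + 2))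
      (≡.sym (ℤ.pos-* (suc (n ℕ.+ k)) (suc d))))
    ([ case₁ , case₂ ]′ p≡)
    where
    target = + 9 * (+ suc (n ℕ.+ k) * + suc d) + (+ 3 * + k + + 1) * (+ 3 * + k + + 2)
    +n : ∀ c → + (c ℕ.+ 3 ℕ.* n) ≡ + c + + 3 * (+ 1 + + d + + k)
    +n c = cong (λ z → + c + z) (ℤ.pos-* 3 n)
    case₁ : p ≡ 1 ℕ.+ 3 ℕ.* n → + p ∣ target
    case₁ refl = divides (+ 2 + + 3 * (+ 1 + + d + + k)) (≡.trans (lem (+ d) (+ k))
        (cong (λ z → (+ 2 + + 3 * (+ 1 + + d + + k)) * z) (≡.sym (+n 1))))
      where
      lem : ∀ d k → + 9 * ((+ 1 + (+ 1 + d + k + k)) * (+ 1 + d)) + (+ 3 * k + + 1) * (+ 3 * k + + 2)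
          ≡ (+ 2 + + 3 * (+ 1 + d + k)) * (+ 1 + + 3 * (+ 1 + d + k))
      lem = solve-∀
    case₂ : p ≡ 2 ℕ.+ 3 ℕ.* n → + p ∣ target
    case₂ refl = divides (+ 1 + + 3 * (+ 1 + + d + + k)) (≡.trans (lem (+ d) (+ k))
        (cong (λ z → (+ 1 + + 3 * (+ 1 + + d + + k)) * z) (≡.sym (+n 2))))
      where
      lem : ∀ d k → + 9 * ((+ 1 + (+ 1 + d + k + k)) * (+ 1 + d)) + (+ 3 * k + + 1) * (+ 3 * k + + 2)
          ≡ (+ 1 + + 3 * (+ 1 + d + k)) * (+ 2 + + 3 * (+ 1 + d + k))
      lem = solve-∀

  -- Every factor is at most 2k + 2 ≤ 2n < p.
  ratio-nonzero : ∀ k → k ℕ.< n → ¬ (+ p ∣ + (suc k ℕ.* ((2 ℕ.* k ℕ.+ 2) ℕ.* (2 ℕ.* k ℕ.+ 1))))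
  ratio-nonzero k k<n d = [ small (suc k) ℕ.z<s (ℕ.s≤s (ℕ.≤-trans (ℕ.m≤m+n k (k ℕ.+ 0))
      (ℕ.≤-trans (ℕ.m≤m+n (2 ℕ.* k) 1) (ℕ.≤-reflexive refl))))
      , (λ d′ → [ small (2 ℕ.* k ℕ.+ 2) (ℕ.≤-trans (ℕ.s≤s ℕ.z≤n) (ℕ.m≤n+m 2 (2 ℕ.* k))) (ℕ.≤-reflexive (ℕ.+-suc (2 ℕ.* k) 1))
                , small (2 ℕ.* k ℕ.+ 1) (ℕ.m≤n+m 1 (2 ℕ.* k)) (ℕ.n≤1+n _) ]′
          (euclidℤ pp (+ (2 ℕ.* k ℕ.+ 2)) (+ (2 ℕ.* k ℕ.+ 1)) d′)) ]′
      (euclidℤ pp (+ suc k) (+ (2 ℕ.* k ℕ.+ 2) * + (2 ℕ.* k ℕ.+ 1)) (subst (+ p ∣_)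
          (pos-product (suc k) (2 ℕ.* k ℕ.+ 2) (2 ℕ.* k ℕ.+ 1)) d))
    where
    2k+2<p : suc (2 ℕ.* k ℕ.+ 1) ℕ.< p
    2k+2<p = ℕ.<-≤-trans (ℕ.s≤s (ℕ.≤-trans (ℕ.≤-reflexive (lem k)) (ℕ.≤-trans (ℕ.*-monoʳ-≤ 2 k<n)
        (ℕ.*-monoˡ-≤ n (ℕ.s≤s (ℕ.s≤s (ℕ.z≤n {1})))))))
        ([ (λ { refl → ℕ.≤-refl }) , (λ { refl → ℕ.n≤1+n _ }) ]′ p≡)
      where
      lem : ∀ k → suc (2 ℕ.* k ℕ.+ 1) ≡ 2 ℕ.* suc k
      lem = solveℕ-∀
    small : ∀ m → 0 ℕ.< m → m ℕ.≤ suc (2 ℕ.* k ℕ.+ 1) → ¬ (+ p ∣ + m)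
    small (suc m) _ m≤ d = contradiction (ℕD.∣⇒≤ (ℤD.∣⇒∣ᵤ d)) (ℕ.<⇒≱ (ℕ.≤-<-trans m≤ 2k+2<p))

  -- Both sequences start at 1 and have the same ratios modulo p. Apart from the denominator (2k +
  -- 1)(2k + 2), these are -3(3k + 1)(3k + 2) and 27(n + k + 1)(n - k), and (3k + 1)(3k + 2) ≡ -9(n
  -- + k + 1)(n - k).
  terms-≋ : ∀ k → k ℕ.≤ n → S-term k ≋ even-term n k
  terms-≋ zero    _   = ≋-refl
  terms-≋ (suc k) k<n = ≋-cancel pp (+ D) (ratio-nonzero k k<n) (begin
      + D * S-term (suc k)       ≈⟨ ≈⇒≋ step₁ ⟩
      - (+ R * S-term k)         ≈⟨ ≋-neg (≋-* (≋-refl {+ R}) (terms-≋ k (ℕ.<⇒≤ k<n))) ⟩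
      - (+ R * even-term n k)    ≈⟨ step₂ ⟩
      + D * even-term n (suc k)  ∎)
    where
    open import Relation.Binary.Reasoning.Setoid setoid
    D = suc k ℕ.* ((2 ℕ.* k ℕ.+ 2) ℕ.* (2 ℕ.* k ℕ.+ 1))
    R = (3 ℕ.* k ℕ.+ 3) ℕ.* ((3 ℕ.* k ℕ.+ 2) ℕ.* (3 ℕ.* k ℕ.+ 1))
    c = + ((3 ℕ.* suc k) C suc k)
    c′ = + ((3 ℕ.* k) C k)
    step₁ : + D * S-term (suc k) ≡ - (+ R * S-term k)
    step₁ = ≡.trans (lem (+ D) c (ℤ.-1ℤ ℤ.^ k))
      (≡.trans (cong (λ z → - (z * ℤ.-1ℤ ℤ.^ k)) (≡.trans (≡.sym (ℤ.pos-* D _)) (≡.trans (cong +_ (C-3k-step k)) (ℤ.pos-* R _))))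
      (cong -_ (ℤ.*-assoc (+ R) c′ (ℤ.-1ℤ ℤ.^ k))))
      where
      lem : ∀ D c e → D * (c * (-[1+ 0 ] * e)) ≡ - ((D * c) * e)
      lem = solve-∀
    d = n ℕ.∸ suc k
    n≡ : n ≡ suc d ℕ.+ k
    n≡ = ≡.sym (≡.trans (≡.sym (ℕ.+-suc d k)) (ℕ.m∸n+n≡m k<n))
    M = suc (n ℕ.+ k) ℕ.* suc d
    t = + ((n ℕ.+ k) C (k ℕ.+ k))
    t′ = + ((n ℕ.+ suc k) C (suc k ℕ.+ suc k))
    C-step : + ((2 ℕ.* k ℕ.+ 2) ℕ.* (2 ℕ.* k ℕ.+ 1)) * t′ ≡ + M * t
    C-step = ≡.trans (≡.sym (ℤ.pos-* ((2 ℕ.* k ℕ.+ 2) ℕ.* (2 ℕ.* k ℕ.+ 1)) _)) (≡.trans (cong +_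
      (subst (λ i → ((2 ℕ.* k ℕ.+ 2) ℕ.* (2 ℕ.* k ℕ.+ 1)) ℕ.* ((i ℕ.+ suc k) C (suc k ℕ.+ suc k)) ≡ (suc (i ℕ.+ k) ℕ.* suc d)
          ℕ.* ((i ℕ.+ k) C (k ℕ.+ k)))
        (≡.sym n≡) (C-n+k-step d k))) (ℤ.pos-* M _))
    +3k+ : ∀ j → + (3 ℕ.* k ℕ.+ j) ≡ + 3 * + k + + j
    +3k+ j = ≡.trans (ℤ.pos-+ (3 ℕ.* k) j) (cong (_+ + j) (ℤ.pos-* 3 k))
    step₂ : - (+ R * even-term n k) ≋ + D * even-term n (suc k)
    step₂ = ≋-sym (∣⇒≋ (subst (+ p ∣_) (≡.sym (≡.trans (cong₂ (λ D R → D * (t′ * (+ 27 * z)) - - (R * (t * z))) D≡ R≡)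
        (≡.trans (lem (+ k) (+ ((2 ℕ.* k ℕ.+ 2) ℕ.* (2 ℕ.* k ℕ.+ 1))) t′ z t)
            (≡.trans (cong (λ w → + 27 * (+ 1 + + k) * z * w + rest) C-step) (lem′ (+ k) (+ M) t z)))))
        (ℤD.∣n⇒∣m*n (+ 3 * (+ 1 + + k) * z * t) (9[n+k+1][n-k] d k n≡))))
      where
      z = (+ 27) ℤ.^ k
      rest = (+ 3 * + k + + 3) * ((+ 3 * + k + + 2) * (+ 3 * + k + + 1)) * (t * z)
      D≡ : + D ≡ (+ 1 + + k) * + ((2 ℕ.* k ℕ.+ 2) ℕ.* (2 ℕ.* k ℕ.+ 1))
      D≡ = ℤ.pos-* (suc k) _
      R≡ : + R ≡ (+ 3 * + k + + 3) * ((+ 3 * + k + + 2) * (+ 3 * + k + + 1))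
      R≡ = ≡.trans (pos-product (3 ℕ.* k ℕ.+ 3) (3 ℕ.* k ℕ.+ 2) (3 ℕ.* k ℕ.+ 1)) (cong₂ _*_ (+3k+ 3) (cong₂ _*_ (+3k+ 2) (+3k+ 1)))
      lem : ∀ k D t′ z t → (+ 1 + k) * D * (t′ * (+ 27 * z)) - - ((+ 3 * k + + 3) * ((+ 3 * k + + 2) * (+ 3 * k + + 1)) * (t * z))
          ≡ + 27 * (+ 1 + k) * z * (D * t′) + (+ 3 * k + + 3) * ((+ 3 * k + + 2) * (+ 3 * k + + 1)) * (t * z)
      lem = solve-∀
      lem′ : ∀ k M t z → + 27 * (+ 1 + k) * z * (M * t) + (+ 3 * k + + 3) * ((+ 3 * k + + 2) * (+ 3 * k + + 1)) * (t * z)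
           ≡ + 3 * (+ 1 + k) * z * t * (+ 9 * M + (+ 3 * k + + 1) * (+ 3 * k + + 2))
      lem′ = solve-∀

  sumTo-≋ : ∀ m (f g : ℕ → ℤ) → (∀ k → k ℕ.< m → f k ≋ g k) → sumTo m f ≋ sumTo m g
  sumTo-≋ zero    f g eq = ≋-refl
  sumTo-≋ (suc m) f g eq = ≋-+ (eq 0 ℕ.z<s) (sumTo-≋ m (f ∘ suc) (g ∘ suc) (λ k k<m → eq (suc k) (ℕ.s<s k<m)))

  S≋even-sum : p / 3 ≡ n → S p ≋ even-sum n
  S≋even-sum p/3≡n = ≋-trans (≈⇒≋ (≡.trans (cong (λ i → foldr _+_ (+ 0) (map S-term (upTo (suc i)))) p/3≡n)
      (foldr-applyUpTo S-term (λ k → k) (suc n))))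
    (sumTo-≋ (suc n) S-term (even-term n) (λ k k<1+n → terms-≋ k (ℕ.s≤s⁻¹ k<1+n)))

-- Evaluation of the sum

_≟ᴱ_ : (x y : 𝔼) → Dec (x ≡ y)
(a ⊹ b) ≟ᴱ (c ⊹ d) = map′ (λ { (refl , refl) → refl }) (λ { refl → refl , refl }) ((a ℤ.≟ c) ×-dec (b ℤ.≟ d))

module 𝔼-Solver = Algebra.Solver.Ring.Simple (fromCommutativeRing 𝔼-ring) _≟ᴱ_
open 𝔼-Solver using (solve; _:+_; _:*_; _:-_; _:=_)

trace : 𝔼 → ℤ
trace (a ⊹ b) = + 2 * a - b

+-conj : ∀ x → x +ᴱ conj x ≡ ι (trace x)
+-conj (a ⊹ b) = cong₂ _⊹_ (lem a b) (ℤ.+-inverseʳ b)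
  where
  lem : ∀ a b → a + (a - b) ≡ + 2 * a - b
  lem = solve-∀

-- The closed form of the Morgan-Voyce numbers at ε = A/Ā, cleared of denominators.
module ClosedForm (p : ℕ) (A : 𝔼) (29N : ModE._≋_ p (A *ᴱ A +ᴱ conj A *ᴱ conj A) (ι (+ 29) *ᴱ (A *ᴱ conj A))) where
  open ModE p
  private
    Ā = conj A
    N = A *ᴱ Ā

    -- `V n` is A^(2n+1) + Ā^(2n+1), kept in a shape in which its recurrence is a polynomial
    -- identity.
    L V : ℕ → 𝔼
    L n = ι (even-sum n) *ᴱ (A +ᴱ Ā) *ᴱ N ^ n
    V n = A *ᴱ (A *ᴱ A) ^ n +ᴱ Ā *ᴱ (Ā *ᴱ Ā) ^ n

    open import Relation.Binary.Reasoning.Setoid setoid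

    L-rec : ∀ n → L (2 ℕ.+ n) ≡ ι (+ 29) *ᴱ N *ᴱ L (suc n) +ᴱ -ᴱ (N *ᴱ N *ᴱ L n)
    L-rec n = ≡.trans (cong (λ z → z *ᴱ (A +ᴱ Ā) *ᴱ N ^ (2 ℕ.+ n)) eq)
        (solve 6 (λ k b₁ b₀ t N M → (k :* b₁ :- b₀) :* t :* (N :* (N :* M)) := k :* N :* (b₁ :* t :* (N :* M)) :- N :* N :*
            (b₀ :* t :* M)) refl
          (ι (+ 29)) (ι (even-sum (suc n))) (ι (even-sum n)) (A +ᴱ Ā) N (N ^ n))
      where
      eq : ι (even-sum (2 ℕ.+ n)) ≡ ι (+ 29) *ᴱ ι (even-sum (suc n)) +ᴱ -ᴱ ι (even-sum n)
      eq = ≡.trans (cong ι (even-sum-rec n)) (cong (_+ᴱ -ᴱ ι (even-sum n)) (ι-* (+ 29) (even-sum (suc n))))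

    V-rec : ∀ n → (A *ᴱ A +ᴱ Ā *ᴱ Ā) *ᴱ V (suc n) +ᴱ -ᴱ (N *ᴱ N *ᴱ V n) ≡ V (2 ℕ.+ n)
    V-rec n = solve 4 (λ a b x y → (a :* a :+ b :* b) :* (a :* (a :* a :* x) :+ b :* (b :* b :* y)) :- (a :* b) :* (a :* b) :*
        (a :* x :+ b :* y)
        := a :* (a :* a :* (a :* a :* x)) :+ b :* (b :* b :* (b :* b :* y))) refl A Ā ((A *ᴱ A) ^ n) ((Ā *ᴱ Ā) ^ n)

    both : ∀ n → L n ≋ V n × L (suc n) ≋ V (suc n)
    both zero = ≈⇒≋ (solve 2 (λ a b → 𝔼-Solver.con 1# :* (a :+ b) :* 𝔼-Solver.con 1# := a :* 𝔼-Solver.con 1# :+ b :*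
        𝔼-Solver.con 1#) refl A Ā) , (begin
      -- 28 = 1 + 27 is the Morgan-Voyce number of index 1; the rest is the factorisation of A³ +
      -- Ā³.
      ι (+ 28) *ᴱ (A +ᴱ Ā) *ᴱ (N *ᴱ 1#)
        ≈⟨ ≈⇒≋ (solve 3 (λ a b N → 𝔼-Solver.con (ι (+ 28)) :* (a :+ b) :* (N :* 𝔼-Solver.con 1#) := (a :+ b) :*
            (𝔼-Solver.con (ι (+ 29)) :* N :- N)) refl A Ā N) ⟩
      (A +ᴱ Ā) *ᴱ (ι (+ 29) *ᴱ N +ᴱ -ᴱ N)  ≈⟨ ≋-* (≋-refl {A +ᴱ Ā}) (≋-+ (≋-sym 29N) (≋-refl { -ᴱ N})) ⟩
      (A +ᴱ Ā) *ᴱ (A *ᴱ A +ᴱ Ā *ᴱ Ā +ᴱ -ᴱ N)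
        ≈⟨ ≈⇒≋ (solve 2 (λ a b → (a :+ b) :* (a :* a :+ b :* b :- a :* b) := a :* (a :* a :* 𝔼-Solver.con 1#) :+ b :*
            (b :* b :* 𝔼-Solver.con 1#)) refl A Ā) ⟩
      V 1  ∎)
    both (suc n) = proj₂ (both n) , (begin
      L (2 ℕ.+ n)  ≈⟨ ≈⇒≋ (L-rec n) ⟩
      ι (+ 29) *ᴱ N *ᴱ L (suc n) +ᴱ -ᴱ (N *ᴱ N *ᴱ L n)
        ≈⟨ ≋-+ (≋-* (≋-sym 29N) (proj₂ (both n))) (≋-neg (≋-* (≋-refl {N *ᴱ N}) (proj₁ (both n)))) ⟩
      (A *ᴱ A +ᴱ Ā *ᴱ Ā) *ᴱ V (suc n) +ᴱ -ᴱ (N *ᴱ N *ᴱ V n)  ≈⟨ ≈⇒≋ (V-rec n) ⟩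
      V (2 ℕ.+ n)                                            ∎)

  closedForm : ∀ n → ι (even-sum n) *ᴱ (A +ᴱ conj A) *ᴱ (A *ᴱ conj A) ^ n ≋ A *ᴱ (A *ᴱ A) ^ n +ᴱ conj A *ᴱ (conj A *ᴱ conj A) ^ n
  closedForm n = proj₁ (both n)

  -- Reciprocity replaces one of the two factors A^n in A^(2n+1) by θĀ^n, which leaves θA times the
  -- n-th power of the norm; the other summand is conjugate.
  evaluate₁ : ∀ n θ → A ^ n ≋ θ *ᴱ conj A ^ n → θ *ᴱ conj θ ≡ 1# →
    (A *ᴱ conj A) ^ n *ᴱ (ι (even-sum n) *ᴱ (A +ᴱ conj A)) ≋ (A *ᴱ conj A) ^ n *ᴱ (θ *ᴱ A +ᴱ conj (θ *ᴱ A))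
  evaluate₁ n θ rec θθ̄ = begin
    N ^ n *ᴱ (ι (even-sum n) *ᴱ (A +ᴱ Ā))  ≈⟨ ≈⇒≋ (E.*-comm (N ^ n) _) ⟩
    L n                                    ≈⟨ closedForm n ⟩
    A *ᴱ (A *ᴱ A) ^ n +ᴱ Ā *ᴱ (Ā *ᴱ Ā) ^ n
      ≈⟨ ≈⇒≋ (cong₂ (λ u v → A *ᴱ u +ᴱ Ā *ᴱ v) (^-distrib-* A A n) (^-distrib-* Ā Ā n)) ⟩
    A *ᴱ (x *ᴱ x) +ᴱ Ā *ᴱ (y *ᴱ y)
      ≈⟨ ≋-+ (≋-* (≋-refl {A}) (≋-* (≋-refl {x}) rec)) (≋-* (≋-refl {Ā}) (≋-* (≋-refl {y}) rec̄)) ⟩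
    A *ᴱ (x *ᴱ (θ *ᴱ y)) +ᴱ Ā *ᴱ (y *ᴱ (conj θ *ᴱ x))
      ≈⟨ ≈⇒≋ (solve 6 (λ a b x y t u → a :* (x :* (t :* y)) :+ b :* (y :* (u :* x)) := (x :* y) :* (t :* a :+ u :* b)) refl A Ā
          x y θ (conj θ)) ⟩
    (x *ᴱ y) *ᴱ (θ *ᴱ A +ᴱ conj θ *ᴱ Ā)
      ≈⟨ ≈⇒≋ (cong₂ _*ᴱ_ (≡.sym (^-distrib-* A Ā n)) (cong (λ z → θ *ᴱ A +ᴱ z) (≡.sym (conj-* θ A)))) ⟩
    N ^ n *ᴱ (θ *ᴱ A +ᴱ conj (θ *ᴱ A))  ∎
    where
    x = A ^ n
    y = Ā ^ n
    rec̄ : y ≋ conj θ *ᴱ x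
    rec̄ = ≋-trans (≈⇒≋ (≡.trans (≡.sym (E.*-identityˡ y)) (≡.trans (cong (_*ᴱ y) (≡.trans (≡.sym θθ̄) (E.*-comm θ (conj θ))))
        (E.*-assoc (conj θ) θ y))))
      (≋-* (≋-refl {conj θ}) (≋-sym rec))

  -- Reciprocity now speaks of exponent n + 1, so one more factor AĀ is needed: A^(2n+1) becomes
  -- Ā(A^(n+1))². Here the two summands exchange roles, and the result is the same.
  evaluate₂ : ∀ n θ → A ^ suc n *ᴱ θ ≋ conj A ^ suc n → θ *ᴱ conj θ ≡ 1# →
    (A *ᴱ conj A) ^ suc n *ᴱ (ι (even-sum n) *ᴱ (A +ᴱ conj A)) ≋ (A *ᴱ conj A) ^ suc n *ᴱ (θ *ᴱ A +ᴱ conj (θ *ᴱ A))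
  evaluate₂ n θ rec θθ̄ = begin
    N ^ suc n *ᴱ (ι (even-sum n) *ᴱ (A +ᴱ Ā))
      ≈⟨ ≈⇒≋ (solve 3 (λ N M z → N :* M :* z := N :* (z :* M)) refl N (N ^ n) (ι (even-sum n) *ᴱ (A +ᴱ Ā))) ⟩
    N *ᴱ L n  ≈⟨ ≋-* (≋-refl {N}) (closedForm n) ⟩
    N *ᴱ (A *ᴱ (A *ᴱ A) ^ n +ᴱ Ā *ᴱ (Ā *ᴱ Ā) ^ n)
      ≈⟨ ≈⇒≋ (cong₂ (λ u v → N *ᴱ (A *ᴱ u +ᴱ Ā *ᴱ v)) (^-distrib-* A A n) (^-distrib-* Ā Ā n)) ⟩
    N *ᴱ (A *ᴱ (A ^ n *ᴱ A ^ n) +ᴱ Ā *ᴱ (Ā ^ n *ᴱ Ā ^ n))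
      ≈⟨ ≈⇒≋ (solve 4 (λ a b x y → (a :* b) :* (a :* (x :* x) :+ b :* (y :* y)) := b :* ((a :* x) :* (a :* x)) :+ a :*
          ((b :* y) :* (b :* y))) refl A Ā (A ^ n) (Ā ^ n)) ⟩
    Ā *ᴱ (x *ᴱ x) +ᴱ A *ᴱ (y *ᴱ y)
      ≈⟨ ≋-+ (≋-* (≋-refl {Ā}) (≋-* (≋-refl {x}) rec̄)) (≋-* (≋-refl {A}) (≋-* (≋-refl {y}) (≋-sym rec))) ⟩
    Ā *ᴱ (x *ᴱ (y *ᴱ conj θ)) +ᴱ A *ᴱ (y *ᴱ (x *ᴱ θ))
      ≈⟨ ≈⇒≋ (solve 6 (λ a b x y t u → b :* (x :* (y :* u)) :+ a :* (y :* (x :* t)) := (x :* y) :* (t :* a :+ u :* b)) refl A Ā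
          x y θ (conj θ)) ⟩
    (x *ᴱ y) *ᴱ (θ *ᴱ A +ᴱ conj θ *ᴱ Ā)
      ≈⟨ ≈⇒≋ (cong₂ _*ᴱ_ (≡.sym (^-distrib-* A Ā (suc n))) (cong (λ z → θ *ᴱ A +ᴱ z) (≡.sym (conj-* θ A)))) ⟩
    N ^ suc n *ᴱ (θ *ᴱ A +ᴱ conj (θ *ᴱ A))  ∎
    where
    x = A ^ suc n
    y = Ā ^ suc n
    rec̄ : x ≋ y *ᴱ conj θ
    rec̄ = ≋-trans (≈⇒≋ (≡.trans (≡.sym (E.*-identityʳ x)) (≡.trans (cong (x *ᴱ_) (≡.sym θθ̄)) (≡.sym (E.*-assoc x θ (conj θ))))))
      (≋-* rec (≋-refl {conj θ}))

≋1⇒≡1 : ∀ {q} → Prime q → ∀ {x} → CubicValue x → (let open ModE q in x ≋ 1#) → x ≡ 1#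
≋1⇒≡1 {q} pq c x≋1 = lem c (ModZ.≋⇒∣ q (ModE.re-≋ q x≋1)) (ModZ.≋⇒∣ q (ModE.im-≋ q x≋1))
  where
  lem : ∀ {x} → CubicValue x → + q ∣ re x - + 1 → + q ∣ im x - + 0 → x ≡ 1#
  lem c1  _ _ = refl
  lem c0  d _ = contradiction (ℤD.∣m⇒∣-m d) (prime∤1 pq)
  lem cω  _ d = contradiction d (prime∤1 pq)
  lem cω² _ d = contradiction (ℤD.∣m⇒∣-m d) (prime∤1 pq)

idempotent⇒≡1 : ∀ {x} → CubicValue x → x ≢ 0# → x ≡ x *ᴱ x → x ≡ 1#
idempotent⇒≡1 c1  _   _ = refl
idempotent⇒≡1 c0  x≢0 _ = contradiction refl x≢0
idempotent⇒≡1 cω  _   ()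
idempotent⇒≡1 cω² _   ()

-- -1 is not a square modulo 3; Fermat in the form y³ ≡ y replaces the case distinction.
3∤square+1 : ∀ y → ¬ (+ 3 ∣ y * y + + 1)
3∤square+1 y d = [ prime∤2 , (λ 3∣y → prime∤1 prime[3] (subst (+ 3 ∣_) (lem₂ y) (ℤD.∣m∣n⇒∣m-n d (ℤD.∣m⇒∣m*n y 3∣y)))) ]′
    (euclidℤ prime[3] (+ 2) y 3∣2y)
  where
  open ModZ 3
  prime∤2 : ¬ (+ 3 ∣ + 2)
  prime∤2 d = contradiction (primes-≡ prime[3] prime[2] d) λ ()
  lem₁ : ∀ y → y * (y * y + + 1) - (y * (y * (y * + 1)) - y) ≡ + 2 * y
  lem₁ = solve-∀
  lem₂ : ∀ y → y * y + + 1 - y * y ≡ + 1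
  lem₂ = solve-∀
  3∣2y : + 3 ∣ + 2 * y
  3∣2y = subst (+ 3 ∣_) (lem₁ y) (ℤD.∣m∣n⇒∣m-n (ℤD.∣n⇒∣m*n y d) (≋⇒∣ (fermat prime[3] y)))

norm-conj : ∀ x → norm (conj x) ≡ norm x
norm-conj (a ⊹ b) = lem a b
  where
  lem : ∀ a b → (a - b) * (a - b) - (a - b) * - b + - b * - b ≡ a * a - a * b + b * b
  lem = solve-∀

norm-^ : ∀ x n → norm (x ^ n) ≡ norm x ℤ.^ n
norm-^ x zero    = refl
norm-^ x (suc n) = ≡.trans (norm-* x (x ^ n)) (cong (norm x *_) (norm-^ x n))

norm-conj^∤ : ∀ {q A} → ¬ (+ q ∣ norm A) → Prime q → ∀ k → ¬ (+ q ∣ norm (conj A ^ k))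
norm-conj^∤ {q} {A} q∤N pq k d = prime∤^ pq (norm A) k q∤N (subst (+ q ∣_)
    (≡.trans (norm-^ (conj A) k) (cong (ℤ._^ k) (norm-conj A))) d)

A≋conj : ∀ {q A} → + q ∣ im A → let open ModE q in A ≋ conj A
A≋conj {q} {a ⊹ b} d = ModE.⊹-≋ q (ModZ.∣⇒≋ q (subst (+ q ∣_) (lem₁ a b) d))
    (ModZ.∣⇒≋ q (subst (+ q ∣_) (lem₂ b) (ℤD.∣m∣n⇒∣m+n d d)))
  where
  lem₁ : ∀ a b → b ≡ a - (a - b)
  lem₁ = solve-∀
  lem₂ : ∀ b → b + b ≡ b - - b
  lem₂ = solve-∀

module SymbolValues {A : 𝔼} (SA : CubicSymbol A) where
  open CubicSymbol SA

  χ-1 : χ (+ 1) ≡ 1#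
  χ-1 = idempotent⇒≡1 (χ-value (+ 1)) (χ≢0 (λ pq _ d → prime∤1 pq d)) (χ-* (+ 1) (+ 1))

  χ-neg1 : χ -[1+ 0 ] ≡ 1#
  χ-neg1 = square≡1⇒≡1 (χ-value -[1+ 0 ]) (≡.trans (≡.sym (χ-* -[1+ 0 ] -[1+ 0 ])) χ-1)

  χ-abs : ∀ y → χ y ≡ χ (+ ℤ.∣ y ∣)
  χ-abs (+ n)      = refl
  χ-abs -[1+ n ] = ≡.trans (cong χ (cong -[1+_] (≡.sym (ℕ.+-identityʳ n))))
      (≡.trans (χ-* -[1+ 0 ] (+ suc n)) (≡.trans (cong (_*ᴱ χ (+ suc n)) χ-neg1) (E.*-identityˡ _)))

  χ-product : ∀ qs → All Prime qs → (∀ {q} → Prime q → q ℕD.∣ product qs → χ (+ q) ≡ 1#) → χ (+ product qs) ≡ 1#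
  χ-product []       []        _   = χ-1
  χ-product (q ∷ qs) (pq ∷ ps) eq1 = ≡.trans (cong χ (ℤ.pos-* q (product qs))) (≡.trans (χ-* (+ q) (+ product qs))
    (cong₂ _*ᴱ_ (eq1 pq (ℕD.m∣m*n (product qs))) (χ-product qs ps (λ ps d → eq1 ps (ℕD.∣n⇒∣m*n q d)))))

  χ≡1 : ∀ y → y ≢ + 0 → (∀ {q} → Prime q → + q ∣ y → χ (+ q) ≡ 1#) → χ y ≡ 1#
  χ≡1 y y≢0 eq1 = ≡.trans (χ-abs y) (from-factors (factorise ℤ.∣ y ∣ {{ℕ.≢-nonZero (λ e → y≢0 (ℤ.∣i∣≡0⇒i≡0 e))}}))
    where
    from-factors : PrimeFactorisation ℤ.∣ y ∣ → χ (+ ℤ.∣ y ∣) ≡ 1#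
    from-factors record { factors = qs ; isFactorisation = eq ; factorsPrime = ps } =
      ≡.trans (cong (χ ∘ +_) eq) (χ-product qs ps (λ {q} pq d → eq1 pq (ℤD.∣ᵤ⇒∣ (subst (q ℕD.∣_) (≡.sym eq) d))))

  -- If A ≡ Ā modulo q then reciprocity forces χ(q) = 1.
  χ-prime≡1 : ∀ {q} → Prime q → q ≢ 3 → + q ∣ im A → ¬ (+ q ∣ norm A) → χ (+ q) ≡ 1#
  χ-prime≡1 {q} pq q≢3 q∣im q∤N with prime-mod3 pq q≢3
  ... | inj₁ (k , refl) = ≋1⇒≡1 pq (χ-value (+ q)) (≋-cancel-norm pq (conj A ^ k) (norm-conj^∤ {A = A} q∤N pq k)
        (≋-trans (≋-trans (≈⇒≋ (E.*-comm (conj A ^ k) (χ (+ q)))) (≋-sym (reciprocity₁ k pq q∤N)))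
          (≋-trans (≋-^ k (A≋conj {A = A} q∣im)) (≈⇒≋ (≡.sym (E.*-identityʳ _))))))
    where open ModE (1 ℕ.+ 3 ℕ.* k)
  ... | inj₂ (k , refl) = ≋1⇒≡1 pq (χ-value (+ q)) (≋-cancel-norm pq (conj A ^ suc k) (norm-conj^∤ {A = A} q∤N pq (suc k))
        (≋-trans (≋-* (≋-^ (suc k) (≋-sym (A≋conj {A = A} q∣im))) (≋-refl {χ (+ q)}))
          (≋-trans (reciprocity₂ k pq q∤N) (≈⇒≋ (≡.sym (E.*-identityʳ _))))))
    where open ModE (2 ℕ.+ 3 ℕ.* k)

prime[31] : Prime 31
prime[31] = from-yes (prime? 31)

prime∤2 : ∀ {p} → Prime p → 3 ℕ.< p → ¬ (+ p ∣ + 2)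
prime∤2 pp p>3 d = contradiction (ℕD.∣⇒≤ (ℤD.∣⇒∣ᵤ d)) (ℕ.<⇒≱ (ℕ.<-trans (ℕ.n<1+n 2) p>3))

-- Since ac = 8, one of a and c is 1 and the other 2 modulo 3, so exchanging the variables of the
-- form always achieves ap ≡ 2.
module Evaluation {p : ℕ} (pp : Prime p) (p>3 : 3 ℕ.< p) (n : ℕ) (p≡ : p ≡ 1 ℕ.+ 3 ℕ.* n ⊎ p ≡ 2 ℕ.+ 3 ℕ.* n) (p/3≡n : p / 3 ≡ n) (p≢31 : p ≢ 31)
  (a c X Y : ℤ) (ac≡8 : a * c ≡ + 8) (form : + p ≡ a * X * X + X * Y + c * Y * Y)
  (3∣ap+1 : + 3 ∣ a * + p + + 1) (coprime : ∀ {q} → Prime q → + q ∣ a → ¬ (+ q ∣ Y)) where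

  -- A = (t + 3Y√-3)/2 with t = -(2aX + Y). As t² ≡ -31Y² modulo p, the quotient A/Ā = A²/(AĀ) is
  -- (29 ± 3√93)/2.
  A : 𝔼
  A = Y - a * X ⊹ + 3 * Y

  norm-A : norm A ≡ a * + p - Y * Y
  norm-A = ≡.trans (lem a X Y) (≡.trans (cong (λ z → a * X * (a * X) + a * X * Y + z * Y * Y - Y * Y) (≡.sym ac≡8))
      (≡.trans (lem′ a c X Y) (cong (λ z → a * z - Y * Y) (≡.sym form))))
    where
    lem : ∀ a X Y → (Y - a * X) * (Y - a * X) - (Y - a * X) * (+ 3 * Y) + (+ 3 * Y) * (+ 3 * Y)
        ≡ a * X * (a * X) + a * X * Y + + 8 * Y * Y - Y * Y
    lem = solve-∀
    lem′ : ∀ a c X Y → a * X * (a * X) + a * X * Y + a * c * Y * Y - Y * Y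
         ≡ a * (a * X * X + X * Y + c * Y * Y) - Y * Y
    lem′ = solve-∀

  trace² : trace A * trace A ≡ + 4 * a * + p - + 31 * Y * Y
  trace² = ≡.trans (lem a X Y) (≡.trans (cong (λ z → + 4 * (a * X * (a * X) + a * X * Y + z * Y * Y) - + 31 * Y * Y) (≡.sym ac≡8))
      (≡.trans (lem′ a c X Y) (cong (λ z → + 4 * a * z - + 31 * Y * Y) (≡.sym form))))
    where
    lem : ∀ a X Y → (+ 2 * (Y - a * X) - + 3 * Y) * (+ 2 * (Y - a * X) - + 3 * Y)
        ≡ + 4 * (a * X * (a * X) + a * X * Y + + 8 * Y * Y) - + 31 * Y * Y
    lem = solve-∀
    lem′ : ∀ a c X Y → + 4 * (a * X * (a * X) + a * X * Y + a * c * Y * Y) - + 31 * Y * Y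
         ≡ + 4 * a * (a * X * X + X * Y + c * Y * Y) - + 31 * Y * Y
    lem′ = solve-∀

  p∤a : ¬ (+ p ∣ a)
  p∤a d = [ prime∤2 pp p>3 , (λ d → [ prime∤2 pp p>3 , prime∤2 pp p>3 ]′ (euclidℤ pp (+ 2) (+ 2) d)) ]′
    (euclidℤ pp (+ 2) (+ 4) (subst (+ p ∣_) ac≡8 (ℤD.∣m⇒∣m*n c d)))

  -- If p divided Y, it would divide aX², hence X, and the form would be divisible by p².
  p∤Y : ¬ (+ p ∣ Y)
  p∤Y p∣Y = p²∤p p∣X p∣Y
    where
    p∣aXX : + p ∣ a * X * X
    p∣aXX = subst (+ p ∣_) (≡.trans (cong (λ z → z - Y * (X + c * Y)) form) (lem (a * X * X) c X Y))
        (ℤD.∣m∣n⇒∣m-n ℤD.∣-refl (ℤD.∣m⇒∣m*n (X + c * Y) p∣Y))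
      where
      lem : ∀ s c X Y → s + X * Y + c * Y * Y - Y * (X + c * Y) ≡ s
      lem = solve-∀
    p∣X : + p ∣ X
    p∣X = [ (λ d → [ (λ d → contradiction d p∤a) , (λ d → d) ]′ (euclidℤ pp a X d)) , (λ d → d) ]′ (euclidℤ pp (a * X) X p∣aXX)
    p²∤p : + p ∣ X → ¬ (+ p ∣ Y)
    p²∤p (divides x X≡) (divides y Y≡) = prime∤1 pp (divides (a * x * x + x * y + c * y * y)
      (ℤ.*-cancelʳ-≡ (+ 1) _ (+ p) {{ℤ.≢-nonZero {+ p} λ { refl → contradiction p>3 λ () }}} (≡.trans (ℤ.*-identityˡ (+ p))
        (≡.trans form (≡.trans (cong₂ (λ X Y → a * X * X + X * Y + c * Y * Y) X≡ Y≡) (lem a c x y (+ p)))))))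
      where
      lem : ∀ a c x y p → a * (x * p) * (x * p) + x * p * (y * p) + c * (y * p) * (y * p)
          ≡ (a * x * x + x * y + c * y * y) * p * p
      lem = solve-∀

  p∤norm : ¬ (+ p ∣ norm A)
  p∤norm d = p∤Y (∣square⇒∣ pp Y (subst (+ p ∣_) (lem (a * + p) (Y * Y))
      (ℤD.∣m∣n⇒∣m-n (ℤD.∣n⇒∣m*n a ℤD.∣-refl) (subst (+ p ∣_) norm-A d))))
    where
    lem : ∀ u v → u - (u - v) ≡ v
    lem = solve-∀

  -- The square of the trace is -31Y² modulo p; here p ≠ 31 is used.
  p∤trace : ¬ (+ p ∣ trace A)
  p∤trace d = [ (λ d → contradiction (primes-≡ pp prime[31] d) p≢31) , p∤Y ]′
      (euclidℤ pp (+ 31) Y ([ (λ d → d) , (λ d → contradiction d p∤Y) ]′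
      (euclidℤ pp (+ 31 * Y) Y (subst (+ p ∣_) (lem (+ 4 * a * + p) (+ 31 * Y * Y))
        (ℤD.∣m∣n⇒∣m-n (ℤD.∣n⇒∣m*n (+ 4 * a) ℤD.∣-refl) (subst (+ p ∣_) trace² (ℤD.∣m⇒∣m*n (trace A) d)))))))
    where
    lem : ∀ u v → u - (u - v) ≡ v
    lem = solve-∀

  -- As 3 divides the ω-coordinate of A, it would otherwise divide the norm ap - Y², and with ap ≡
  -- -1 also Y² + 1.
  3∤re : ¬ (+ 3 ∣ re A)
  3∤re d = 3∤square+1 Y (subst (+ 3 ∣_) (lem (a * + p) (Y * Y)) (ℤD.∣m∣n⇒∣m-n 3∣ap+1 (subst (+ 3 ∣_) norm-A 3∣norm)))
    where
    3∣norm : + 3 ∣ norm A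
    3∣norm = ℤD.∣m∣n⇒∣m+n (ℤD.∣m∣n⇒∣m-n (ℤD.∣m⇒∣m*n (re A) d) (ℤD.∣m⇒∣m*n (im A) d)) (ℤD.∣m⇒∣m*n (im A) (ℤD.∣m⇒∣m*n Y ℤD.∣-refl))
    lem : ∀ u v → u + + 1 - (u - v) ≡ v + + 1
    lem = solve-∀

  -- Modulo Y the number ap is the square (aX)², and ap ≡ -1 modulo 3.
  3∤Y : ¬ (+ 3 ∣ Y)
  3∤Y d = 3∤square+1 (a * X) (subst (+ 3 ∣_) (lem Y (a * X)) (ℤD.∣m∣n⇒∣m-n (subst (+ 3 ∣_) (cong (_+ + 1) ap≡) 3∣ap+1)
      (ℤD.∣m⇒∣m*n (a * X + + 8 * Y) d)))
    where
    ap≡ : a * + p ≡ a * X * (a * X) + a * X * Y + + 8 * Y * Y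
    ap≡ = ≡.trans (cong (a *_) form) (≡.trans (lem₂ a c X Y) (cong (λ z → a * X * (a * X) + a * X * Y + z * Y * Y) ac≡8))
      where
      lem₂ : ∀ a c X Y → a * (a * X * X + X * Y + c * Y * Y) ≡ a * X * (a * X) + a * X * Y + a * c * Y * Y
      lem₂ = solve-∀
    lem : ∀ Y u → u * u + u * Y + + 8 * Y * Y + + 1 - Y * (u + + 8 * Y) ≡ u * u + + 1
    lem = solve-∀

  q∣Y⇒q∤norm : ∀ {q} → Prime q → + q ∣ Y → ¬ (+ q ∣ norm A)
  q∣Y⇒q∤norm {q} pq q∣Y d = [ (λ q∣a → coprime pq q∣a q∣Y) , (λ q∣p → p∤Y (subst (λ z → + z ∣ Y) (primes-≡ pq pp q∣p) q∣Y)) ]′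
    (euclidℤ pq a (+ p) (subst (+ q ∣_) (lem (a * + p) (Y * Y)) (ℤD.∣m∣n⇒∣m+n (subst (+ q ∣_) norm-A d) (ℤD.∣m⇒∣m*n Y q∣Y))))
    where
    lem : ∀ u v → u - v + v ≡ u
    lem = solve-∀

  A-primitive : Primitive A
  A-primitive {q} pq dre dim = [ (λ d → 3∤re (subst (λ z → + z ∣ re A) (primes-≡ pq prime[3] d) dre)) ,
      (λ q∣Y → q∣Y⇒q∤norm pq q∣Y q∣norm) ]′ (euclidℤ pq (+ 3) Y dim)
    where
    q∣norm : + q ∣ norm A
    q∣norm = ℤD.∣m∣n⇒∣m+n (ℤD.∣m∣n⇒∣m-n (ℤD.∣m⇒∣m*n (re A) dre) (ℤD.∣m⇒∣m*n (im A) dre)) (ℤD.∣m⇒∣m*n (im A) dim)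

  abstract
    symbol : CubicSymbol A
    symbol = cubicSymbol A A-primitive (ℤD.∣m⇒∣m*n Y ℤD.∣-refl) 3∤re

  open CubicSymbol symbol public
  open SymbolValues symbol

  χ-Y : χ Y ≡ 1#
  χ-Y = χ≡1 Y (λ { refl → p∤Y (divides (+ 0) refl) }) λ {q} pq q∣Y →
    χ-prime≡1 pq (λ { refl → 3∤Y q∣Y }) (ℤD.∣n⇒∣m*n (+ 3) q∣Y) (q∣Y⇒q∤norm pq q∣Y)

  χa*χp : χ a *ᴱ χ (+ p) ≡ 1#
  χa*χp = begin
    χ a *ᴱ χ (+ p)  ≡⟨ χ-* a (+ p) ⟨
    χ (a * + p)     ≡⟨ χ-periodic (ℤD.∣-reflexive norm-A) ⟩
    χ (Y * Y)       ≡⟨ χ-* Y Y ⟩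
    χ Y *ᴱ χ Y      ≡⟨ cong₂ _*ᴱ_ χ-Y χ-Y ⟩
    1#              ∎
    where open ≡.≡-Reasoning

  χp-unit : χ (+ p) *ᴱ conj (χ (+ p)) ≡ 1#
  χp-unit = *-conj-unit (χ-value (+ p)) (λ eq → contradiction (≡.trans (≡.sym χa*χp)
      (≡.trans (cong (χ a *ᴱ_) eq) (E.zeroʳ (χ a)))) λ ())

  29N : let open ModE p in A *ᴱ A +ᴱ conj A *ᴱ conj A ≋ ι (+ 29) *ᴱ (A *ᴱ conj A)
  -- The excess A² + Ā² - 29AĀ is (A + Ā)² - 31AĀ, which equals (4ap - 31Y²) - 31(ap - Y²) = -27ap.
  29N = by (ι (-[1+ 26 ] * a)) (begin
      A *ᴱ A +ᴱ conj A *ᴱ conj A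
        ≡⟨ solve 2 (λ a b → a :* a :+ b :* b := 𝔼-Solver.con (ι (+ 29)) :* (a :* b) :+
            ((a :+ b) :* (a :+ b) :- 𝔼-Solver.con (ι (+ 31)) :* (a :* b))) refl A (conj A) ⟩
      ι (+ 29) *ᴱ (A *ᴱ conj A) +ᴱ ((A +ᴱ conj A) *ᴱ (A +ᴱ conj A) +ᴱ -ᴱ (ι (+ 31) *ᴱ (A *ᴱ conj A)))
        ≡⟨ cong (λ z → ι (+ 29) *ᴱ (A *ᴱ conj A) +ᴱ z) rest ⟩
      ι (+ 29) *ᴱ (A *ᴱ conj A) +ᴱ ι (+ p) *ᴱ ι (-[1+ 26 ] * a)  ∎)
    where
    open ModE p using (by)
    open ≡.≡-Reasoning
    lem : ∀ a p Y → + 4 * a * p - + 31 * Y * Y - + 31 * (a * p - Y * Y) ≡ p * (-[1+ 26 ] * a)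
    lem = solve-∀
    rest : (A +ᴱ conj A) *ᴱ (A +ᴱ conj A) +ᴱ -ᴱ (ι (+ 31) *ᴱ (A *ᴱ conj A)) ≡ ι (+ p) *ᴱ ι (-[1+ 26 ] * a)
    rest = begin
      (A +ᴱ conj A) *ᴱ (A +ᴱ conj A) +ᴱ -ᴱ (ι (+ 31) *ᴱ (A *ᴱ conj A))
        ≡⟨ cong₂ (λ u v → u *ᴱ u +ᴱ -ᴱ (ι (+ 31) *ᴱ v)) (+-conj A) (*-conj A) ⟩
      ι (trace A) *ᴱ ι (trace A) +ᴱ -ᴱ (ι (+ 31) *ᴱ ι (norm A))
        ≡⟨ cong₂ (λ u v → u +ᴱ -ᴱ v) (ι-* (trace A) (trace A)) (ι-* (+ 31) (norm A)) ⟨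
      ι (trace A * trace A - + 31 * norm A)
        ≡⟨ cong ι (≡.trans (cong₂ (λ u v → u - + 31 * v) trace² norm-A) (lem a (+ p) Y)) ⟩
      ι (+ p * (-[1+ 26 ] * a))     ≡⟨ ι-* (+ p) (-[1+ 26 ] * a) ⟩
      ι (+ p) *ᴱ ι (-[1+ 26 ] * a)  ∎

  S-evaluation : let open ModZ p in S p * trace A ≋ trace (χ (+ p) *ᴱ A)
  S-evaluation = Z.≋-trans (Z.≋-* (S≋even-sum n pp p≡ p/3≡n) (Z.≋-refl {trace A}))
      (ModE.re-≋ p (≡.subst₂ (ModE._≋_ p) (≡.trans (cong (ι (even-sum n) *ᴱ_) (+-conj A)) (≡.sym (ι-* (even-sum n) (trace A))))
          (+-conj (χ (+ p) *ᴱ A))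
        ([ case₁ , case₂ ]′ p≡)))
    where
    module Z = ModZ p
    open ClosedForm p A 29N
    θ = χ (+ p)
    cancel-N : ∀ k {x y} → (let open ModE p in (A *ᴱ conj A) ^ k *ᴱ x ≋ (A *ᴱ conj A) ^ k *ᴱ y) → let open ModE p in x ≋ y
    cancel-N k {x} {y} eq = ModE.≋-cancel p pp (norm A ℤ.^ k) (prime∤^ pp (norm A) k p∤norm)
      (≡.subst₂ (ModE._≋_ p) (cong (_*ᴱ x) N^k) (cong (_*ᴱ y) N^k) eq)
      where
      N^k : (A *ᴱ conj A) ^ k ≡ ι (norm A ℤ.^ k)
      N^k = ≡.trans (cong (_^ k) (*-conj A)) (≡.sym (ι-^ (norm A) k))
    Goal = let open ModE p in ι (even-sum n) *ᴱ (A +ᴱ conj A) ≋ θ *ᴱ A +ᴱ conj (θ *ᴱ A)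
    case₁ : p ≡ 1 ℕ.+ 3 ℕ.* n → Goal
    case₁ refl = cancel-N n (evaluate₁ n θ (reciprocity₁ n pp p∤norm) χp-unit)
    case₂ : p ≡ 2 ℕ.+ 3 ℕ.* n → Goal
    case₂ refl = cancel-N (suc n) (evaluate₂ n θ (reciprocity₂ n pp p∤norm) χp-unit)

-- For the prime 2 the exponent in reciprocity is 1, so Aχ(2) ≡ Ā modulo 2. With both coordinates
-- odd, A ≡ 1 + ω ≡ ω² and Ā ≡ ω, hence χ(2) = ω².
χ-2 : ∀ {A} (SA : CubicSymbol A) → ¬ (+ 2 ∣ re A) → ¬ (+ 2 ∣ im A) → ¬ (+ 2 ∣ norm A) → CubicSymbol.χ SA (+ 2) ≡ ω²
χ-2 {A} SA 2∤re 2∤im 2∤N = cases A (χ-value (+ 2)) 2∤re 2∤im (≋-trans (≈⇒≋ (cong (_*ᴱ χ (+ 2)) (≡.sym (E.*-identityʳ A))))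
    (≋-trans (reciprocity₂ 0 prime[2] 2∤N) (≈⇒≋ (E.*-identityʳ (conj A)))))
  where
  open CubicSymbol SA
  open ModE 2
  module Z = ModZ 2
  cases : ∀ A {v} → CubicValue v → ¬ (+ 2 ∣ re A) → ¬ (+ 2 ∣ im A) → A *ᴱ v ≋ conj A → v ≡ ω²
  cases A       cω² _    _    _  = refl
  cases (a ⊹ b) c0  2∤re 2∤im eq = contradiction (subst (+ 2 ∣_) (lem a b) (Z.≋⇒∣ (im-≋ eq))) 2∤im
    where
    lem : ∀ a b → a * + 0 + b * + 0 - b * + 0 - - b ≡ b
    lem = solve-∀
  cases (a ⊹ b) c1  2∤re 2∤im eq = contradiction (subst (+ 2 ∣_) (lem a b) (Z.≋⇒∣ (re-≋ eq))) 2∤im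
    where
    lem : ∀ a b → a * + 1 - b * + 0 - (a - b) ≡ b
    lem = solve-∀
  cases (a ⊹ b) cω  2∤re 2∤im eq = contradiction (subst (+ 2 ∣_) (lem a b) (ℤD.∣m⇒∣-m (Z.≋⇒∣ (re-≋ eq)))) 2∤re
    where
    lem : ∀ a b → - (a * + 0 - b * + 1 - (a - b)) ≡ a
    lem = solve-∀

cube*≡1⇒≡1 : ∀ {v θ} → CubicValue v → v *ᴱ (v *ᴱ v) *ᴱ θ ≡ 1# → θ ≡ 1#
cube*≡1⇒≡1 {θ = θ} c1  eq = ≡.trans (≡.sym (E.*-identityˡ θ)) eq
cube*≡1⇒≡1 {θ = θ} cω  eq = ≡.trans (≡.sym (E.*-identityˡ θ)) eq
cube*≡1⇒≡1 {θ = θ} cω² eq = ≡.trans (≡.sym (E.*-identityˡ θ)) eq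
cube*≡1⇒≡1 {θ = θ} c0  eq = contradiction (≡.trans (≡.sym (E.zeroˡ θ)) eq) λ ()

power2-prime : ∀ {q} → Prime q → + q ∣ + 8 → q ≡ 2
power2-prime pq d = [ is-2 , (λ d → [ is-2 , is-2 ]′ (euclidℤ pq (+ 2) (+ 2) d)) ]′ (euclidℤ pq (+ 2) (+ 4) d)
  where
  is-2 : + _ ∣ + 2 → _ ≡ 2
  is-2 = primes-≡ pq prime[2]

-- The principal and the nonprincipal form of discriminant -31

module _ {p : ℕ} (pp : Prime p) (p>3 : p > 3) (p≢31 : p ≢ 31) where
  open ModZ p

  private
    n = p / 3

    Mod3 = p ≡ 1 ℕ.+ 3 ℕ.* n ⊎ p ≡ 2 ℕ.+ 3 ℕ.* n

    p-mod3 : Mod3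
    p-mod3 = by-remainder (p % 3) refl (m%n<n p 3)
      where
      by-remainder : ∀ r → r ≡ p % 3 → r ℕ.< 3 → Mod3
      by-remainder 0 eq _ = contradiction (primes-≡ prime[3] pp (divides (+ n)
          (≡.trans (cong +_ (≡.trans (m≡m%n+[m/n]*n p 3) (cong (ℕ._+ n ℕ.* 3) (≡.sym eq)))) (ℤ.pos-* n 3)))) (ℕ.<⇒≢ p>3)
      by-remainder 1 eq _ = inj₁ (≡.trans (m≡m%n+[m/n]*n p 3) (cong₂ ℕ._+_ (≡.sym eq) (ℕ.*-comm n 3)))
      by-remainder 2 eq _ = inj₂ (≡.trans (m≡m%n+[m/n]*n p 3) (cong₂ ℕ._+_ (≡.sym eq) (ℕ.*-comm n 3)))
      by-remainder (suc (suc (suc _))) _ (ℕ.s≤s (ℕ.s≤s (ℕ.s≤s ())))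

    2∤p : ¬ (+ 2 ∣ + p)
    2∤p d = contradiction (primes-≡ prime[2] pp d) (ℕ.<⇒≢ (ℕ.<-trans (ℕ.n<1+n 2) p>3))

    1+3n : ∀ j → + (j ℕ.+ 3 ℕ.* n) ≡ + j + + 3 * + n
    1+3n j = cong (λ z → + j + z) (ℤ.pos-* 3 n)

    3∣ap+1 : ∀ a j m → + p ≡ + j + + 3 * + n → a * + j + + 1 ≡ m * + 3 → + 3 ∣ a * + p + + 1
    3∣ap+1 a j m p≡ eq = divides (m + a * + n) (≡.trans (cong (λ z → a * z + + 1) p≡)
        (≡.trans (lem a (+ j) (+ n)) (≡.trans (cong (_+ a * + n * + 3) eq) (≡.sym (ℤ.*-distribʳ-+ (+ 3) m (a * + n))))))
      where
      lem : ∀ a j n → a * (j + + 3 * n) + + 1 ≡ a * j + + 1 + a * n * + 3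
      lem = solve-∀

  -- For p ≡ 2 modulo 3 take a = 1. For p ≡ 1 exchange the variables and take a = 8, a cube. Either
  -- way χ(a) = 1, so θ = 1 and the two traces agree.
  principal : ∀ X Y → + p ≡ X * X + X * Y + + 8 * Y * Y → S p ≋ + 1
  principal X Y form = [ p≡1 , p≡2 ]′ p-mod3
    where
    p≡2 : p ≡ 2 ℕ.+ 3 ℕ.* n → S p ≋ + 1
    p≡2 eq = ≋-cancel pp (trace A) p∤trace (≋-trans (≈⇒≋ (ℤ.*-comm (trace A) (S p))) (≋-trans S-evaluation
        (≈⇒≋ (≡.trans (cong (λ θ → trace (θ *ᴱ A)) θ≡1) (≡.trans (cong trace (E.*-identityˡ A))
            (≡.sym (ℤ.*-identityʳ (trace A))))))))
      where
      lem : ∀ X Y → X * X + X * Y + + 8 * Y * Y ≡ + 1 * X * X + X * Y + + 8 * Y * Y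
      lem = solve-∀
      open Evaluation pp p>3 n (inj₂ eq) refl p≢31 (+ 1) (+ 8) X Y refl (≡.trans form (lem X Y))
        (3∣ap+1 (+ 1) 2 (+ 1) (≡.trans (cong +_ eq) (1+3n 2)) refl) (λ pq q∣1 _ → prime∤1 pq q∣1)
      open SymbolValues symbol using (χ-1)
      θ≡1 : χ (+ p) ≡ 1#
      θ≡1 = ≡.trans (≡.sym (E.*-identityˡ (χ (+ p)))) (≡.trans (cong (_*ᴱ χ (+ p)) (≡.sym χ-1)) χa*χp)
    p≡1 : p ≡ 1 ℕ.+ 3 ℕ.* n → S p ≋ + 1
    p≡1 eq = ≋-cancel pp (trace A) p∤trace (≋-trans (≈⇒≋ (ℤ.*-comm (trace A) (S p))) (≋-trans S-evaluation
        (≈⇒≋ (≡.trans (cong (λ θ → trace (θ *ᴱ A)) θ≡1) (≡.trans (cong trace (E.*-identityˡ A))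
            (≡.sym (ℤ.*-identityʳ (trace A))))))))
      where
      lem : ∀ X Y → X * X + X * Y + + 8 * Y * Y ≡ + 8 * Y * Y + Y * X + + 1 * X * X
      lem = solve-∀
      2∤X : ¬ (+ 2 ∣ X)
      2∤X d = 2∤p (subst (+ 2 ∣_) (≡.trans (lem′ X Y) (≡.sym form)) (ℤD.∣m∣n⇒∣m+n (ℤD.∣m⇒∣m*n (X + Y) d)
          (ℤD.∣m⇒∣m*n (+ 4 * Y * Y) (ℤD.∣-refl {+ 2}))))
        where
        lem′ : ∀ X Y → X * (X + Y) + + 2 * (+ 4 * Y * Y) ≡ X * X + X * Y + + 8 * Y * Y
        lem′ = solve-∀
      open Evaluation pp p>3 n (inj₁ eq) refl p≢31 (+ 8) (+ 1) Y X refl (≡.trans form (lem X Y))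
        (3∣ap+1 (+ 8) 1 (+ 3) (≡.trans (cong +_ eq) (1+3n 1)) refl) (λ pq q∣8 q∣X → 2∤X
            (subst (λ z → + z ∣ X) (power2-prime pq q∣8) q∣X))
      θ≡1 : χ (+ p) ≡ 1#
      θ≡1 = cube*≡1⇒≡1 (χ-value (+ 2)) (≡.trans (cong (_*ᴱ χ (+ p)) (≡.sym
          (≡.trans (χ-* (+ 2) (+ 4)) (cong (χ (+ 2) *ᴱ_) (χ-* (+ 2) (+ 2)))))) χa*χp)

  module _ (X Y : ℤ) (form : + p ≡ + 2 * X * X + X * Y + + 4 * Y * Y) where
    private
      2∤X : ¬ (+ 2 ∣ X)
      2∤X d = 2∤p (subst (+ 2 ∣_) (≡.trans (lem X Y) (≡.sym form)) (ℤD.∣m∣n⇒∣m+n (ℤD.∣m⇒∣m*n (+ 2 * X + Y) d)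
          (ℤD.∣m⇒∣m*n (+ 2 * Y * Y) (ℤD.∣-refl {+ 2}))))
        where
        lem : ∀ X Y → X * (+ 2 * X + Y) + + 2 * (+ 2 * Y * Y) ≡ + 2 * X * X + X * Y + + 4 * Y * Y
        lem = solve-∀
      2∤Y : ¬ (+ 2 ∣ Y)
      2∤Y d = 2∤p (subst (+ 2 ∣_) (≡.trans (lem X Y) (≡.sym form)) (ℤD.∣m∣n⇒∣m+n (ℤD.∣m⇒∣m*n (X + + 4 * Y) d)
          (ℤD.∣m⇒∣m*n (X * X) (ℤD.∣-refl {+ 2}))))
        where
        lem : ∀ X Y → Y * (X + + 4 * Y) + + 2 * (X * X) ≡ + 2 * X * X + X * Y + + 4 * Y * Y
        lem = solve-∀

      odd-parts : ∀ a X Y → + 2 ∣ a → ¬ (+ 2 ∣ Y) → ¬ (+ 2 ∣ Y - a * X) × ¬ (+ 2 ∣ + 3 * Y)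
      odd-parts a X Y 2∣a 2∤Y =
        (λ d → 2∤Y (subst (+ 2 ∣_) (lem Y (a * X)) (ℤD.∣m∣n⇒∣m+n d (ℤD.∣m⇒∣m*n X 2∣a)))) ,
        (λ d → 2∤Y (subst (+ 2 ∣_) (lem′ Y) (ℤD.∣m∣n⇒∣m-n d (ℤD.∣m⇒∣m*n Y (ℤD.∣-refl {+ 2})))))
        where
        lem : ∀ Y u → Y - u + u ≡ Y
        lem = solve-∀
        lem′ : ∀ Y → + 3 * Y - + 2 * Y ≡ Y
        lem′ = solve-∀

      odd-norm : ∀ a Y N → + 2 ∣ a → ¬ (+ 2 ∣ Y) → N ≡ a * + p - Y * Y → ¬ (+ 2 ∣ N)
      odd-norm a Y N 2∣a 2∤Y N≡ d = 2∤Y (∣square⇒∣ prime[2] Y (subst (+ 2 ∣_) (lem (a * + p) (Y * Y))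
          (ℤD.∣m∣n⇒∣m-n (ℤD.∣m⇒∣m*n (+ p) 2∣a) (subst (+ 2 ∣_) N≡ d))))
        where
        lem : ∀ u v → u - (u - v) ≡ v
        lem = solve-∀

      Y-coprime : ∀ a c → a * c ≡ + 8 → ∀ Y → ¬ (+ 2 ∣ Y) → ∀ {q} → Prime q → + q ∣ a → ¬ (+ q ∣ Y)
      Y-coprime a c ac≡8 Y 2∤Y {q} pq q∣a q∣Y = 2∤Y (subst (λ z → + z ∣ Y)
          (power2-prime pq (subst (+ q ∣_) ac≡8 (ℤD.∣m⇒∣m*n c q∣a))) q∣Y)

    -- For a = 2 the trace of A is -(4X + Y) and that of ωA is 2X - 4Y. The same fraction serves
    -- both residues of p modulo 3.
    Nonprincipal = (S p * (+ 4 * X + Y) ≋ + 4 * Y - + 2 * X) × ¬ (+ p ∣ + 4 * X + Y)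

    -- a = 2, and θ is the inverse of χ(2) = ω², that is ω.
    nonprincipal₁ : p ≡ 1 ℕ.+ 3 ℕ.* n → Nonprincipal
    nonprincipal₁ eq = ∣⇒≋ (subst (+ p ∣_) (lem (S p) X Y) (ℤD.∣m⇒∣-m (≋⇒∣
        (≋-trans S-evaluation (≈⇒≋ (cong (λ θ → trace (θ *ᴱ A)) θ≡ω)))))) ,
        (λ d → p∤trace (subst (+ p ∣_) (lem′ X Y) (ℤD.∣m⇒∣-m d)))
      where
      open Evaluation pp p>3 n (inj₁ eq) refl p≢31 (+ 2) (+ 4) X Y refl form
        (3∣ap+1 (+ 2) 1 (+ 1) (≡.trans (cong +_ eq) (1+3n 1)) refl) (Y-coprime (+ 2) (+ 4) refl Y 2∤Y)
      lem : ∀ S X Y → - (S * (+ 2 * (Y - + 2 * X) - + 3 * Y)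
            - (+ 2 * (+ 0 * (Y - + 2 * X) - + 1 * (+ 3 * Y)) - (+ 0 * (+ 3 * Y) + + 1 * (Y - + 2 * X) - + 1 * (+ 3 * Y))))
          ≡ S * (+ 4 * X + Y) - (+ 4 * Y - + 2 * X)
      lem = solve-∀
      lem′ : ∀ X Y → - (+ 4 * X + Y) ≡ + 2 * (Y - + 2 * X) - + 3 * Y
      lem′ = solve-∀
      θ≡ω : χ (+ p) ≡ ω
      θ≡ω = begin
        χ (+ p)                    ≡⟨ E.*-identityˡ (χ (+ p)) ⟨
        ω *ᴱ ω² *ᴱ χ (+ p)         ≡⟨ cong (λ z → ω *ᴱ z *ᴱ χ (+ p)) χ2 ⟨
        ω *ᴱ χ (+ 2) *ᴱ χ (+ p)    ≡⟨ E.*-assoc ω (χ (+ 2)) (χ (+ p)) ⟩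
        ω *ᴱ (χ (+ 2) *ᴱ χ (+ p))  ≡⟨ cong (ω *ᴱ_) χa*χp ⟩
        ω                          ∎
        where
        open ≡.≡-Reasoning
        χ2 : χ (+ 2) ≡ ω²
        χ2 = χ-2 symbol (proj₁ (odd-parts (+ 2) X Y ℤD.∣-refl 2∤Y)) (proj₂ (odd-parts (+ 2) X Y ℤD.∣-refl 2∤Y))
            (odd-norm (+ 2) Y (norm A) ℤD.∣-refl 2∤Y norm-A)

    -- a = 4 with the variables exchanged, and θ is the inverse of χ(2)² = ω, that is ω². The
    -- denominator is now X + 8Y up to sign; passing to 4X + Y costs 9 times the form, a multiple of
    -- p.
    nonprincipal₂ : p ≡ 2 ℕ.+ 3 ℕ.* n → Nonprincipal
    nonprincipal₂ eq = ∣⇒≋ ([ (λ d → contradiction d p∤trace) , (λ d → d) ]′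
        (euclidℤ pp (trace A) (S p * (+ 4 * X + Y) - (+ 4 * Y - + 2 * X))
          (subst (+ p ∣_) (≡.trans (cong (λ z → (S p * trace A - trace (ω² *ᴱ A)) * (+ 4 * X + Y) + + 9 * z) form) (lem (S p) X Y))
            (ℤD.∣m∣n⇒∣m+n (ℤD.∣m⇒∣m*n (+ 4 * X + Y) S-value) (ℤD.∣n⇒∣m*n (+ 9) (ℤD.∣-refl {+ p})))))) ,
        -- The form plus (4X + Y)(15X - 4Y) is 62X², which p does not divide.
        (λ d → p∤62XX (subst (+ p ∣_) (≡.trans (cong (λ z → z + (+ 4 * X + Y) * (+ 15 * X - + 4 * Y)) form) (lem′ X Y))
          (ℤD.∣m∣n⇒∣m+n ℤD.∣-refl (ℤD.∣m⇒∣m*n (+ 15 * X - + 4 * Y) d))))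
      where
      swap : ∀ X Y → + 2 * X * X + X * Y + + 4 * Y * Y ≡ + 4 * Y * Y + Y * X + + 2 * X * X
      swap = solve-∀
      open Evaluation pp p>3 n (inj₂ eq) refl p≢31 (+ 4) (+ 2) Y X refl (≡.trans form (swap X Y))
        (3∣ap+1 (+ 4) 2 (+ 3) (≡.trans (cong +_ eq) (1+3n 2)) refl) (Y-coprime (+ 4) (+ 2) refl X 2∤X)
        renaming (p∤Y to p∤X)
      lem : ∀ S X Y → (S * (+ 2 * (X - + 4 * Y) - + 3 * X)
            - (+ 2 * (-[1+ 0 ] * (X - + 4 * Y) - -[1+ 0 ] * (+ 3 * X))
                - (-[1+ 0 ] * (+ 3 * X) + -[1+ 0 ] * (X - + 4 * Y) - -[1+ 0 ] * (+ 3 * X))))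
            * (+ 4 * X + Y) + + 9 * (+ 2 * X * X + X * Y + + 4 * Y * Y)
          ≡ (+ 2 * (X - + 4 * Y) - + 3 * X) * (S * (+ 4 * X + Y) - (+ 4 * Y - + 2 * X))
      lem = solve-∀
      lem′ : ∀ X Y → + 2 * X * X + X * Y + + 4 * Y * Y + (+ 4 * X + Y) * (+ 15 * X - + 4 * Y) ≡ + 2 * (+ 31 * (X * X))
      lem′ = solve-∀
      p∤62XX : ¬ (+ p ∣ + 2 * (+ 31 * (X * X)))
      p∤62XX d = [ prime∤2 pp p>3 , (λ d → [ (λ d → p≢31 (primes-≡ pp prime[31] d)) , (λ d → p∤X (∣square⇒∣ pp X d)) ]′
          (euclidℤ pp (+ 31) (X * X) d)) ]′
        (euclidℤ pp (+ 2) (+ 31 * (X * X)) d)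
      θ≡ω² : χ (+ p) ≡ ω²
      θ≡ω² = begin
        χ (+ p)                                ≡⟨ E.*-identityˡ (χ (+ p)) ⟨
        ω² *ᴱ (ω² *ᴱ ω²) *ᴱ χ (+ p)            ≡⟨ cong (λ z → ω² *ᴱ (z *ᴱ z) *ᴱ χ (+ p)) χ2 ⟨
        ω² *ᴱ (χ (+ 2) *ᴱ χ (+ 2)) *ᴱ χ (+ p)  ≡⟨ cong (λ z → ω² *ᴱ z *ᴱ χ (+ p)) (χ-* (+ 2) (+ 2)) ⟨
        ω² *ᴱ χ (+ 4) *ᴱ χ (+ p)               ≡⟨ E.*-assoc ω² (χ (+ 4)) (χ (+ p)) ⟩
        ω² *ᴱ (χ (+ 4) *ᴱ χ (+ p))             ≡⟨ cong (ω² *ᴱ_) χa*χp ⟩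
        ω²                                     ∎
        where
        open ≡.≡-Reasoning
        2∣4 : + 2 ∣ + 4
        2∣4 = divides (+ 2) refl
        χ2 : χ (+ 2) ≡ ω²
        χ2 = χ-2 symbol (proj₁ (odd-parts (+ 4) Y X 2∣4 2∤X)) (proj₂ (odd-parts (+ 4) Y X 2∣4 2∤X))
            (odd-norm (+ 4) X (norm A) 2∣4 2∤X norm-A)
      S-value : + p ∣ S p * trace A - trace (ω² *ᴱ A)
      S-value = ≋⇒∣ (≋-trans S-evaluation (≈⇒≋ (cong (λ θ → trace (θ *ᴱ A)) θ≡ω²)))

    nonprincipal : Nonprincipal
    nonprincipal = [ nonprincipal₁ , nonprincipal₂ ]′ p-mod3

    -- To check 31 y S ≡ l it suffices, after multiplication by 4X + Y, that the two sides differ by a multiple of the form.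
    conclude : ∀ y l m → + 31 * y * (+ 4 * Y - + 2 * X) - l * (+ 4 * X + Y) ≡ m * (+ 2 * X * X + X * Y + + 4 * Y * Y) →
      + 31 * y * S p ≡ l [mod p ]
    conclude y l m eq = ℤD.∣⇒∣ᵤ ([ (λ d → contradiction d (proj₂ nonprincipal)) , (λ d → d) ]′
        (euclidℤ pp (+ 4 * X + Y) (+ 31 * y * S p - l)
        (subst (+ p ∣_) (≡.trans (cong (λ z → + 31 * y * (S p * (+ 4 * X + Y) - (+ 4 * Y - + 2 * X)) + z)
            (≡.trans (cong (m *_) form) (≡.sym eq))) (lem (S p) y l X Y))
          (ℤD.∣m∣n⇒∣m+n (ℤD.∣n⇒∣m*n (+ 31 * y) (≋⇒∣ (proj₁ nonprincipal))) (ℤD.∣n⇒∣m*n m (ℤD.∣-refl {+ p}))))))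
      where
      lem : ∀ S y l X Y → + 31 * y * (S * (+ 4 * X + Y) - (+ 4 * Y - + 2 * X))
          + (+ 31 * y * (+ 4 * Y - + 2 * X) - l * (+ 4 * X + Y))
          ≡ (+ 4 * X + Y) * (+ 31 * y * S - l)
      lem = solve-∀

-- The seven forms of discriminant -279

theorem3p9 : (p : ℕ) → Prime p → p > 3 → LegendreOne p 31 →
    ((x y : ℤ) → (+ p ≡ x * x + x * y + + 70 * y * y) → S p ≡ + 1 [mod p ])
    × ((x y : ℤ) → (+ p ≡ + 9 * x * x + + 9 * x * y + + 10 * y * y) → S p ≡ + 1 [mod p ])
    × ((x y : ℤ) → (+ p ≡ + 8 * x * x + + 3 * x * y + + 9 * y * y) → S p ≡ + 1 [mod p ])
    × ((x y : ℤ) → (+ p ≡ + 5 * x * x + x * y + + 14 * y * y) → p ≢ 5 →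
    + 31 * y * S p ≡ + 15 * x - + 14 * y [mod p ])
    × ((x y : ℤ) → (+ p ≡ + 7 * x * x + x * y + + 10 * y * y) → p ≢ 7 →
    + 31 * y * S p ≡ + 21 * x - + 14 * y [mod p ])
    × ((x y : ℤ) → (+ p ≡ + 19 * x * x + + 5 * x * y + + 4 * y * y) → p ≢ 19 →
    + 31 * y * S p ≡ + 57 * x - + 8 * y [mod p ])
    × ((x y : ℤ) → (+ p ≡ + 35 * x * x + x * y + + 2 * y * y) →
    + 31 * y * S p ≡ - (+ 105 * x + + 17 * y) [mod p ])
theorem3p9 p pp p>3 (31∤p , _) =
    -- Each substitution has determinant ±3, which accounts for -279 = 9 · (-31).
    (λ x y eq → S≡1 (x - y) (+ 3 * y) (trans eq (form₁ x y)))
  , (λ x y eq → S≡1 (+ 3 * x + y) y (trans eq (form₂ x y)))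
  , (λ x y eq → S≡1 (+ 3 * y) x (trans eq (form₃ x y)))
  -- The multiplier of the form is found by comparing coefficients of x²: -15 · 3/5 = -9, and
  -- likewise -21 · 5/7 = -15, -57 · 11/19 = -33 and 105 · 1/35 = 3 in the next three cases.
  , (λ x y eq _ → conclude pp p>3 p≢31 (x - + 2 * y) (- x - y) (trans eq (form₄ x y)) y _ (- + 9) (identity₄ x y))
  , (λ x y eq _ → conclude pp p>3 p≢31 (x + + 2 * y) (x - y) (trans eq (form₅ x y)) y _ (- + 15) (identity₅ x y))
  , (λ x y eq _ → conclude pp p>3 p≢31 (+ 3 * x) (- x - y) (trans eq (form₆ x y)) y _ (- + 33) (identity₆ x y))
  , (λ x y eq → conclude pp p>3 p≢31 (x + y) (- (+ 3 * x)) (trans eq (form₇ x y)) y _ (+ 3) (identity₇ x y))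
  where
  open ≡ using (trans)

  p≢31 : p ≢ 31
  p≢31 refl = 31∤p ℕD.∣-refl

  S≡1 : ∀ X Y → + p ≡ X * X + X * Y + + 8 * Y * Y → S p ≡ + 1 [mod p ]
  S≡1 X Y form = ℤD.∣⇒∣ᵤ (ModZ.≋⇒∣ p (principal pp p>3 p≢31 X Y form))

  form₁ : ∀ x y → x * x + x * y + + 70 * y * y ≡ (x - y) * (x - y) + (x - y) * (+ 3 * y) + + 8 * (+ 3 * y) * (+ 3 * y)
  form₁ = solve-∀

  form₂ : ∀ x y → + 9 * x * x + + 9 * x * y + + 10 * y * y ≡ (+ 3 * x + y) * (+ 3 * x + y) + (+ 3 * x + y) * y + + 8 * y * y
  form₂ = solve-∀

  form₃ : ∀ x y → + 8 * x * x + + 3 * x * y + + 9 * y * y ≡ (+ 3 * y) * (+ 3 * y) + (+ 3 * y) * x + + 8 * x * x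
  form₃ = solve-∀

  form₄ : ∀ x y → + 5 * x * x + x * y + + 14 * y * y ≡ + 2 * (x - + 2 * y) * (x - + 2 * y) + (x - + 2 * y) * (- x - y) + + 4 *
      (- x - y) * (- x - y)
  form₄ = solve-∀

  identity₄ : ∀ x y → + 31 * y * (+ 4 * (- x - y) - + 2 * (x - + 2 * y)) - (+ 15 * x - + 14 * y) * (+ 4 * (x - + 2 * y) + (- x - y))
            ≡ (- + 9) * (+ 2 * (x - + 2 * y) * (x - + 2 * y) + (x - + 2 * y) * (- x - y) + + 4 * (- x - y) * (- x - y))
  identity₄ = solve-∀

  form₅ : ∀ x y → + 7 * x * x + x * y + + 10 * y * y ≡ + 2 * (x + + 2 * y) * (x + + 2 * y) + (x + + 2 * y) * (x - y) + + 4 *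
      (x - y) * (x - y)
  form₅ = solve-∀

  identity₅ : ∀ x y → + 31 * y * (+ 4 * (x - y) - + 2 * (x + + 2 * y)) - (+ 21 * x - + 14 * y) * (+ 4 * (x + + 2 * y) + (x - y))
            ≡ (- + 15) * (+ 2 * (x + + 2 * y) * (x + + 2 * y) + (x + + 2 * y) * (x - y) + + 4 * (x - y) * (x - y))
  identity₅ = solve-∀

  form₆ : ∀ x y → + 19 * x * x + + 5 * x * y + + 4 * y * y ≡ + 2 * (+ 3 * x) * (+ 3 * x) + (+ 3 * x) * (- x - y) + + 4 *
      (- x - y) * (- x - y)
  form₆ = solve-∀

  identity₆ : ∀ x y → + 31 * y * (+ 4 * (- x - y) - + 2 * (+ 3 * x)) - (+ 57 * x - + 8 * y) * (+ 4 * (+ 3 * x) + (- x - y))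
            ≡ (- + 33) * (+ 2 * (+ 3 * x) * (+ 3 * x) + (+ 3 * x) * (- x - y) + + 4 * (- x - y) * (- x - y))
  identity₆ = solve-∀

  form₇ : ∀ x y → + 35 * x * x + x * y + + 2 * y * y ≡ + 2 * (x + y) * (x + y) + (x + y) * (- (+ 3 * x)) + + 4 * (- (+ 3 * x)) *
      (- (+ 3 * x))
  form₇ = solve-∀

  identity₇ : ∀ x y → + 31 * y * (+ 4 * (- (+ 3 * x)) - + 2 * (x + y)) - (- (+ 105 * x + + 17 * y)) *
      (+ 4 * (x + y) + (- (+ 3 * x)))
            ≡ + 3 * (+ 2 * (x + y) * (x + y) + (x + y) * (- (+ 3 * x)) + + 4 * (- (+ 3 * x)) * (- (+ 3 * x)))
  identity₇ = solve-∀
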